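{- Let $(T,C,K,R)$ be an interval knapsack covering instance and let $y\in[0,1]^T$. Let $S^+=\{s\in[T]:y_s=1\}$ and, for every interval $(a,b]$ over $[T]$, let $\tilde R_{a,b}:=\max\{R_{a,b}-C(S^+\cap(a,b]),0\}$. Suppose that for every interval $(a,b]$ with $\tilde R_{a,b}>0$, either $$\sum_{s\in(a,b]\setminus S^+}\min\{C_s,\tilde R_{a,b}\}\,y_s\ \ge\ 10\,\tilde R_{a,b}\quad\text{or}\quad \sum_{s\in(a,b]\setminus S^+:\ C_s\ge \tilde R_{a,b}}y_s\ \ge\ 6.$$ Then one can find in polynomial time a feasible solution $S^*\supseteq S^+$ to the instance with $K(S^*)\le\sum_{s\in[T]}y_sK_s$.
   Context: For integers $a<b$, $(a,b]$ denotes the set of integers $\{a+1,\dots,b\}$; an interval over $[T]$ is $(a,b]$ with integers $0\le a<b\le T$. For vectors $C,K\in\mathbb R_{\ge0}^T$ and $S\subseteq[T]$, $C(S)=\sum_{s\in S}C_s$, $K(S)=\sum_{s\in S}K_s$. An interval knapsack covering instance $(T,C,K,R)$ consists of knapsacks $[T]$, each $s$ with capacity $C_s>0$ and cost $K_s\ge0$, and a requirement $R_{a,b}\ge0$ for every interval $(a,b]$ over $[T]$. A feasible solution is a set $S^*\subseteq[T]$ with $C(S^*\cap(a,b])\ge R_{a,b}$ for every interval $(a,b]$ over $[T]$; the goal is to minimize $K(S^*)$. -}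

module Defs where

open import Level using (Level; _⊔_) renaming (suc to lsuc)
open import Algebra.Bundles using (CommutativeRing)
open import Algebra.Structures using (IsCommutativeRing)
import Algebra.Definitions.RawMonoid as RawMonoidDefs
import Algebra.Construct.NaturalChoice.Max as Max
import Algebra.Construct.NaturalChoice.Min as Min
open import Data.Bool.Base using (if_then_else_; _∧_; not)
open import Data.Fin.Base using (Fin; toℕ)
open import Data.Fin.Subset using (Subset; _∩_; _─_; _⊆_)
open import Data.Integer.Base using (∣_∣)
open import Data.List.Base using (List; []; _∷_; _++_; map; concatMap; allFin)
import Data.Nat.ListAction as List
open import Data.Nat.Base as ℕ using (ℕ; zero; suc)
import Data.Nat.Properties as ℕ
open import Data.Nat.Logarithm using (⌈log₂_⌉)
open import Data.Product.Base using (∃; _×_; _,_)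
open import Data.Rational.Base as ℚ using (ℚ; 0ℚ; 1ℚ; ↥_; ↧ₙ_)
import Data.Rational.Properties as ℚ
open import Data.Sum.Base using (_⊎_)
open import Data.Vec.Base using (lookup; tabulate)
open import Relation.Binary.Bundles using (DecTotalOrder)
open import Relation.Binary.PropositionalEquality using (_≡_; _≢_; subst)
open import Relation.Binary.Structures using (IsDecTotalOrder)
open import Relation.Nullary.Decidable.Core using (does)
open import Relation.Nullary.Negation.Core using (¬_)

-- The decidable total order makes this the classical notion: with excluded
-- middle, ℝ is an instance.
record OrderedField (c ℓ₁ ℓ₂ : Level) : Set (lsuc (c ⊔ ℓ₁ ⊔ ℓ₂)) where
  infix  4 _≈_ _≤_ _<_
  infixl 6 _+_ _-_
  infixl 7 _*_
  infix  8 -_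
  field
    Carrier           : Set c
    _≈_               : Carrier → Carrier → Set ℓ₁
    _≤_               : Carrier → Carrier → Set ℓ₂
    _+_ _*_           : Carrier → Carrier → Carrier
    -_                : Carrier → Carrier
    0# 1#             : Carrier
    isCommutativeRing : IsCommutativeRing _≈_ _+_ _*_ -_ 0# 1#
    isDecTotalOrder   : IsDecTotalOrder _≈_ _≤_
    1≉0               : ¬ (1# ≈ 0#)
    inverse           : ∀ x → ¬ (x ≈ 0#) → ∃ λ x⁻¹ → x * x⁻¹ ≈ 1#
    +-monoˡ-≤         : ∀ z {x y} → x ≤ y → x + z ≤ y + z
    *-nonNeg          : ∀ {x y} → 0# ≤ x → 0# ≤ y → 0# ≤ x * y

  commutativeRing : CommutativeRing c ℓ₁
  commutativeRing = record { isCommutativeRing = isCommutativeRing }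

  decTotalOrder : DecTotalOrder c ℓ₁ ℓ₂
  decTotalOrder = record { isDecTotalOrder = isDecTotalOrder }

  open DecTotalOrder decTotalOrder public using (_≟_; _≤?_; totalOrder)
  open Max totalOrder public using () renaming (_⊔_ to max)
  open Min totalOrder public using () renaming (_⊓_ to min)
  open RawMonoidDefs (CommutativeRing.+-rawMonoid commutativeRing) public
    using (sum) renaming (_×_ to _·_)

  _<_ : Carrier → Carrier → Set (ℓ₁ ⊔ ℓ₂)
  x < y = x ≤ y × ¬ (x ≈ y)

  _-_ : Carrier → Carrier → Carrier
  x - y = x + (- y)

  Σ[_] : ∀ {n} → Subset n → (Fin n → Carrier) → Carrier
  Σ[ S ] f = sum λ s → if lookup S s then f s else 0#

-- The knapsack s ∈ [T] is the element of Fin T with toℕ equal to s - 1, so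
-- a < s ≤ b becomes a ≤ toℕ i < b.
⦅_,_] : ∀ {T} → Fin (suc T) → Fin (suc T) → Subset T
⦅ a , b ] = tabulate λ i → does (toℕ a ℕ.≤? toℕ i) ∧ does (toℕ i ℕ.<? toℕ b)

module Covering {c ℓ₁ ℓ₂} (F : OrderedField c ℓ₁ ℓ₂) where
  open OrderedField F

  -- Entries R a b with b ≤ a are never used.
  record Instance : Set (c ⊔ ℓ₁ ⊔ ℓ₂) where
    field
      T   : ℕ
      C K : Fin T → Carrier
      R   : Fin (suc T) → Fin (suc T) → Carrier
      C>0 : ∀ s → 0# < C s
      K≥0 : ∀ s → 0# ≤ K s
      R≥0 : ∀ a b → toℕ a ℕ.< toℕ b → 0# ≤ R a b

  module _ (I : Instance) where
    open Instance I

    Feasible : Subset T → Set ℓ₂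
    Feasible S = ∀ a b → toℕ a ℕ.< toℕ b → R a b ≤ Σ[ S ∩ ⦅ a , b ] ] C

    module _ (y : Fin T → Carrier) where

      InUnitCube : Set ℓ₂
      InUnitCube = ∀ s → 0# ≤ y s × y s ≤ 1#

      S⁺ : Subset T
      S⁺ = tabulate λ s → does (y s ≟ 1#)

      R̃ : Fin (suc T) → Fin (suc T) → Carrier
      R̃ a b = max (R a b - Σ[ S⁺ ∩ ⦅ a , b ] ] C) 0#

      CapacityAtLeast : Carrier → Subset T
      CapacityAtLeast r = tabulate λ s → does (r ≤? C s)

      RoundingHypothesis : Set (ℓ₁ ⊔ ℓ₂)
      RoundingHypothesis = ∀ a b → toℕ a ℕ.< toℕ b → 0# < R̃ a b →
          (10 · R̃ a b ≤ Σ[ ⦅ a , b ] ─ S⁺ ] (λ s → min (C s) (R̃ a b) * y s))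
        ⊎ (6 · 1# ≤ Σ[ (⦅ a , b ] ─ S⁺) ∩ CapacityAtLeast (R̃ a b) ] y)

      Rounds : Subset T → Set ℓ₂
      Rounds S = S⁺ ⊆ S × Feasible S × Σ[ S ] K ≤ sum (λ s → y s * K s)

-- Random access machine over ℕ with structured control and logarithmic cost,
-- polynomially equivalent to Turing machines.
Memory : Set
Memory = ℕ → ℕ

_[_↦_] : Memory → ℕ → ℕ → Memory
(σ [ a ↦ v ]) x = if does (x ℕ.≟ a) then v else σ x

infixl 6 _⊕_ _⊖_
infixl 7 _⊛_

-- mem e is the content of the cell whose address is the value of e;
-- ⊖ is truncated subtraction.
data Expr : Set where
  lit         : ℕ → Expr
  mem         : Expr → Expr
  _⊕_ _⊖_ _⊛_ : Expr → Expr → Expr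

⟦_⟧ : Expr → Memory → ℕ
⟦ lit n ⟧ σ   = n
⟦ mem e ⟧ σ   = σ (⟦ e ⟧ σ)
⟦ e ⊕ e′ ⟧ σ = ⟦ e ⟧ σ ℕ.+ ⟦ e′ ⟧ σ
⟦ e ⊖ e′ ⟧ σ = ⟦ e ⟧ σ ℕ.∸ ⟦ e′ ⟧ σ
⟦ e ⊛ e′ ⟧ σ = ⟦ e ⟧ σ ℕ.* ⟦ e′ ⟧ σ

-- One more than the number of binary digits, so that 0 has positive size.
size : ℕ → ℕ
size n = suc ⌈log₂ suc n ⌉

-- Every intermediate value, including every address, is charged its size.
cost : Expr → Memory → ℕ
cost e@(lit _)  σ = size (⟦ e ⟧ σ)
cost e@(mem d)  σ = size (⟦ e ⟧ σ) ℕ.+ cost d σ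
cost e@(d ⊕ d′) σ = size (⟦ e ⟧ σ) ℕ.+ (cost d σ ℕ.+ cost d′ σ)
cost e@(d ⊖ d′) σ = size (⟦ e ⟧ σ) ℕ.+ (cost d σ ℕ.+ cost d′ σ)
cost e@(d ⊛ d′) σ = size (⟦ e ⟧ σ) ℕ.+ (cost d σ ℕ.+ cost d′ σ)

infixr 3 _⨾_
infix  4 _≔_

-- e ≔ e′ stores the value of e′ in the cell whose address is the value of e.
data Program : Set where
  skip  : Program
  _≔_   : Expr → Expr → Program
  _⨾_   : Program → Program → Program
  if    : Expr → Program → Program → Program
  while : Expr → Program → Program

infix 2 ⟨_,_⟩⇓⟨_,_⟩

-- ⟨ P , σ ⟩⇓⟨ τ , t ⟩ : started in memory σ, the program P halts in memory τ
-- after time t.  Nonzero values count as true.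
data ⟨_,_⟩⇓⟨_,_⟩ : Program → Memory → Memory → ℕ → Set where
  skip : ∀ {σ} → ⟨ skip , σ ⟩⇓⟨ σ , 1 ⟩

  assign : ∀ {e e′ σ} →
    ⟨ e ≔ e′ , σ ⟩⇓⟨ σ [ ⟦ e ⟧ σ ↦ ⟦ e′ ⟧ σ ] , cost e σ ℕ.+ cost e′ σ ⟩

  seq : ∀ {P Q σ τ υ t u} →
    ⟨ P , σ ⟩⇓⟨ τ , t ⟩ → ⟨ Q , τ ⟩⇓⟨ υ , u ⟩ →
    ⟨ P ⨾ Q , σ ⟩⇓⟨ υ , t ℕ.+ u ⟩

  if-true : ∀ {e P Q σ τ t} → ⟦ e ⟧ σ ≢ 0 →
    ⟨ P , σ ⟩⇓⟨ τ , t ⟩ → ⟨ if e P Q , σ ⟩⇓⟨ τ , cost e σ ℕ.+ t ⟩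

  if-false : ∀ {e P Q σ τ t} → ⟦ e ⟧ σ ≡ 0 →
    ⟨ Q , σ ⟩⇓⟨ τ , t ⟩ → ⟨ if e P Q , σ ⟩⇓⟨ τ , cost e σ ℕ.+ t ⟩

  while-true : ∀ {e P σ τ υ t u} → ⟦ e ⟧ σ ≢ 0 →
    ⟨ P , σ ⟩⇓⟨ τ , t ⟩ → ⟨ while e P , τ ⟩⇓⟨ υ , u ⟩ →
    ⟨ while e P , σ ⟩⇓⟨ υ , cost e σ ℕ.+ (t ℕ.+ u) ⟩

  while-false : ∀ {e P σ} → ⟦ e ⟧ σ ≡ 0 →
    ⟨ while e P , σ ⟩⇓⟨ σ , cost e σ ⟩

-- Memory holding a list in cells 0, 1, …, all later cells being 0.
load : List ℕ → Memory
load []       _       = 0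
load (x ∷ _)  zero    = x
load (_ ∷ xs) (suc i) = load xs i

inputSize : List ℕ → ℕ
inputSize xs = List.sum (map size xs)

-- Coefficients, constant term first.
Polynomial : Set
Polynomial = List ℕ

eval : Polynomial → ℕ → ℕ
eval []       n = 0
eval (a ∷ as) n = a ℕ.+ n ℕ.* eval as n

ℚ-orderedField : OrderedField Level.zero Level.zero Level.zero
ℚ-orderedField = record
  { Carrier           = ℚ
  ; _≈_               = _≡_
  ; _≤_               = ℚ._≤_
  ; _+_               = ℚ._+_
  ; _*_               = ℚ._*_
  ; -_                = ℚ.-_
  ; 0#                = 0ℚ
  ; 1#                = 1ℚ
  ; isCommutativeRing = ℚ.+-*-isCommutativeRing
  ; isDecTotalOrder   = ℚ.≤-isDecTotalOrder
  ; 1≉0               = ℚ.1≢0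
  ; inverse           = λ x x≢0 → let instance _ = ℚ.≢-nonZero x≢0 in ℚ.1/ x , ℚ.*-inverseʳ x
  ; +-monoˡ-≤         = λ z → ℚ.+-monoˡ-≤ z
  ; *-nonNeg          = λ {x} {y} 0≤x 0≤y →
      let instance _ = ℚ.nonNegative 0≤y
      in subst (ℚ._≤ x ℚ.* y) (ℚ.*-zeroˡ y) (ℚ.*-monoʳ-≤-nonNeg y 0≤x)
  }

module ℚCovering = Covering ℚ-orderedField

-- Only ever applied to nonnegative rationals, for which it is injective.
encodeℚ : ℚ → List ℕ
encodeℚ q = ∣ ↥ q ∣ ∷ ↧ₙ q ∷ []

-- T, then (C s , K s , y s) for each s, then the row-major (T+1) × (T+1)
-- table of requirements, with 0 in the positions that are not intervals.
encode : (I : ℚCovering.Instance) → (Fin (ℚCovering.Instance.T I) → ℚ) → List ℕ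
encode I y = T ∷ concatMap knapsack (allFin T)
               ++ concatMap (λ a → concatMap (requirement a) (allFin (suc T))) (allFin (suc T))
  where
  open ℚCovering.Instance I

  knapsack : Fin T → List ℕ
  knapsack s = encodeℚ (C s) ++ encodeℚ (K s) ++ encodeℚ (y s)

  requirement : Fin (suc T) → Fin (suc T) → List ℕ
  requirement a b = encodeℚ (if does (toℕ a ℕ.<? toℕ b) then R a b else 0ℚ)

-- The output set consists of the s whose cell (among cells 0, …, T - 1) is nonzero.
decode : ∀ T → Memory → Subset T
decode T σ = tabulate λ s → not (does (σ (toℕ s) ℕ.≟ 0))

{-# OPTIONS --safe #-}
-- Only the fractional part w of y matters: w s = 0 on S⁺ and w s = y s < 1 elsewhere.  Go through the capacities r
-- in decreasing order and refine a partition of [T] into cells, cutting a cell whenever both parts have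
-- w-weight at least 1 among the knapsacks of capacity at least r.  In the end every cell of level r has weight
-- less than 3, and at least 1 unless it is the first cell.  From each cell of level r but the first, a knapsack of
-- capacity at least r is to be chosen.  A knapsack of capacity at least r that shares a cell of a lower level with
-- an element of a cell of level r lies in the latter cell.  Therefore a local-ratio argument (subtract the cheapest
-- cost, lowest levels first, then pick in reverse order) pays at most once per cell, where w has weight at least 1,
-- and hits all these cells at cost at most Σ w K.
-- An interval contains all but two of the cells it meets, so at every level its weight is less than 6 plus three
-- times the number of picks in it of capacity at least r.  If the picks left R̃ uncovered, then this bound at the
-- level of R̃ contradicts the hypothesis with 6, and summing it by parts over all levels bounds the truncated
-- volume by 6 R̃ + 3 R̃ < 10 R̃.
module Submission where

open import Defs
open import Algebra.Bundles using (CommutativeRing)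
import Algebra.Construct.NaturalChoice.Max as Max
import Algebra.Construct.NaturalChoice.Min as Min
import Algebra.Properties.CommutativeMonoid.Sum as Sum
import Algebra.Properties.Ring as RingProperties
import Algebra.Properties.Semiring.Mult as Mult
import Algebra.Solver.Ring.NaturalCoefficients.Default as Solver
open import Data.Bool.Base using (Bool; true; false; if_then_else_; _∧_; _∨_; not)
open import Data.Bool.Properties using (∨-zeroʳ)
open import Data.Fin.Base as Fin using (Fin; toℕ; fromℕ<)
open import Data.Fin.Patterns
import Data.Fin.Properties as Fin
open import Data.Fin.Subset using (Subset; _∩_; _─_; _⊆_)
open import Data.Integer.Base as ℤ using (∣_∣)
import Data.Integer.Properties as ℤ
import Data.Integer.Tactic.RingSolver as ℤSolver
open import Data.List.Base using (List; []; _∷_; _++_; concatMap; tabulate; allFin; length)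
open import Data.List.Properties using (++-assoc; length-++; length-tabulate)
open import Data.Nat.Base as ℕ using (ℕ; zero; suc; _≤ᵇ_; _∸_; z≤n; s≤s)
import Data.Nat.Properties as ℕ
import Data.Nat.Tactic.RingSolver as ℕSolver
open import Data.Product.Base using (Σ; ∃; _×_; _,_; proj₁; proj₂)
open import Data.Rational.Base as ℚ using (ℚ; 0ℚ; 1ℚ; ↥_; ↧ₙ_; mkℚ)
import Data.Rational.Properties as ℚ
open import Data.Rational.Unnormalised.Base as ℚᵘ using (mkℚᵘ; *≡*)
import Data.Rational.Unnormalised.Properties as ℚᵘ
open import Data.Sum.Base as Sum′ using (_⊎_; inj₁; inj₂)
open import Data.Vec.Base as Vec using (lookup)
open import Data.Vec.Properties using (lookup-zipWith; lookup∘tabulate; []=⇒lookup; lookup⇒[]=)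
open import Level using (Level; _⊔_)
open import Relation.Binary.Bundles using (DecTotalOrder)
open import Relation.Binary.Definitions using (tri<; tri≈; tri>)
open import Relation.Binary.PropositionalEquality as ≡ using (_≡_; _≢_)
import Relation.Binary.Reasoning.PartialOrder as PosetReasoning
open import Relation.Nullary using (¬_; contradiction; yes; no; does; proof)
open import Relation.Nullary.Reflects using (Reflects; ofʸ; ofⁿ)

-- Both bounds on a cell come from the one splitting rule. A cell that has reached weight 1 keeps
-- it, because weights only grow as r decreases. A cell that cannot be split consists of the part
-- before some knapsack, this knapsack and the part after it, each lighter than 1; here the removal
-- of S⁺ matters, since it makes w s < 1. The first cell may stay light, as no split creates its
-- left end. It gets no pick, and this does no harm because it is never strictly between the two end
-- cells of an interval. Summation by parts keeps the constant 6 although there are up to T levels: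
-- the coefficients of the levels telescope to at most R̃. The time bound has an obstacle of its
-- own, since repeated multiplication may double bit lengths. Once C, K and y have been brought to a
-- common denominator each, the algorithm only compares, adds and subtracts. It is therefore written
-- once for an abstract type of numbers, and run on an arbitrary field for the existence and on ℕ
-- for the program.

-- Ordered fields and finite sums.

module OrderedFieldProperties {c ℓ₁ ℓ₂} (F : OrderedField c ℓ₁ ℓ₂) where
  open OrderedField F
  open CommutativeRing commutativeRing public
    using ( +-cong; +-congˡ; +-congʳ; +-comm; +-assoc; +-identityˡ; +-identityʳ; -‿inverseʳ
          ; -‿inverseˡ; *-cong; *-congˡ; *-congʳ; *-comm; *-assoc; *-identityˡ; *-identityʳ
          ; distribˡ; zeroˡ; zeroʳ; refl; sym; trans; reflexive)
  open RingProperties (CommutativeRing.ring commutativeRing) public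
    using (-‿distribˡ-*; -‿involutive)
  open Solver (CommutativeRing.commutativeSemiring commutativeRing) public
    using (solve; _:+_; _:*_; _:=_)
  open DecTotalOrder decTotalOrder public
    using (poset; antisym; total; ≤-respˡ-≈; ≤-respʳ-≈)
    renaming (refl to ≤-refl; trans to ≤-trans; reflexive to ≤-reflexive)
  open PosetReasoning poset public hiding (start)

  ≰⇒> : ∀ {x y} → ¬ (x ≤ y) → y < x
  ≰⇒> {x} {y} x≰y with total x y
  ... | inj₁ x≤y = contradiction x≤y x≰y
  ... | inj₂ y≤x = y≤x , λ y≈x → x≰y (≤-reflexive (sym y≈x))

  <⇒≱ : ∀ {x y} → x < y → ¬ (y ≤ x)
  <⇒≱ (x≤y , x≉y) y≤x = x≉y (antisym x≤y y≤x)

  +-monoʳ-≤ : ∀ z {x y} → x ≤ y → z + x ≤ z + y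
  +-monoʳ-≤ z {x} {y} x≤y = begin
    z + x ≈⟨ +-comm z x ⟩
    x + z ≤⟨ +-monoˡ-≤ z x≤y ⟩
    y + z ≈⟨ +-comm y z ⟩
    z + y ∎

  +-mono-≤ : ∀ {x y u v} → x ≤ y → u ≤ v → x + u ≤ y + v
  +-mono-≤ {y = y} {u = u} x≤y u≤v = ≤-trans (+-monoˡ-≤ u x≤y) (+-monoʳ-≤ y u≤v)

  x+y-y≈x : ∀ x y → (x + y) - y ≈ x
  x+y-y≈x x y = trans (+-assoc x y (- y)) (trans (+-congˡ (-‿inverseʳ y)) (+-identityʳ x))

  x-y+y≈x : ∀ x y → (x - y) + y ≈ x
  x-y+y≈x x y = trans (+-assoc x (- y) y) (trans (+-congˡ (-‿inverseˡ y)) (+-identityʳ x))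

  +-cancelʳ-≤ : ∀ z {x y} → x + z ≤ y + z → x ≤ y
  +-cancelʳ-≤ z {x} {y} p = begin
    x           ≈⟨ x+y-y≈x x z ⟨
    (x + z) - z ≤⟨ +-monoˡ-≤ (- z) p ⟩
    (y + z) - z ≈⟨ x+y-y≈x y z ⟩
    y           ∎

  +-cancelˡ-≤ : ∀ z {x y} → z + x ≤ z + y → x ≤ y
  +-cancelˡ-≤ z {x} {y} p = +-cancelʳ-≤ z (begin
    x + z ≈⟨ +-comm x z ⟩
    z + x ≤⟨ p ⟩
    z + y ≈⟨ +-comm z y ⟩
    y + z ∎)

  x-y≤z⇒x≤z+y : ∀ {x y z} → x - y ≤ z → x ≤ z + y
  x-y≤z⇒x≤z+y {x} {y} {z} p = ≤-respˡ-≈ (x-y+y≈x x y) (+-monoˡ-≤ y p)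

  +-monoˡ-< : ∀ z {x y} → x < y → x + z < y + z
  +-monoˡ-< z x<y = ≰⇒> λ q → <⇒≱ x<y (+-cancelʳ-≤ z q)

  +-monoʳ-< : ∀ z {x y} → x < y → z + x < z + y
  +-monoʳ-< z x<y = ≰⇒> λ q → <⇒≱ x<y (+-cancelˡ-≤ z q)

  +-mono-<-≤ : ∀ {x y u v} → x < y → u ≤ v → x + u < y + v
  +-mono-<-≤ {x} {y} {u} {v} x<y u≤v = begin-strict
    x + u <⟨ +-monoˡ-< u x<y ⟩
    y + u ≤⟨ +-monoʳ-≤ y u≤v ⟩
    y + v ∎

  +-mono-≤-< : ∀ {x y u v} → x ≤ y → u < v → x + u < y + v
  +-mono-≤-< {x} {y} {u} {v} x≤y u<v = begin-strict
    x + u ≤⟨ +-monoˡ-≤ u x≤y ⟩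
    y + u <⟨ +-monoʳ-< y u<v ⟩
    y + v ∎

  +-nonNeg : ∀ {x y} → 0# ≤ x → 0# ≤ y → 0# ≤ x + y
  +-nonNeg 0≤x 0≤y = ≤-respˡ-≈ (+-identityˡ 0#) (+-mono-≤ 0≤x 0≤y)

  x≤x+y : ∀ {x y} → 0# ≤ y → x ≤ x + y
  x≤x+y {x} {y} 0≤y = ≤-respˡ-≈ (+-identityʳ x) (+-monoʳ-≤ x 0≤y)

  x≤y+x : ∀ {x y} → 0# ≤ y → x ≤ y + x
  x≤y+x {x} {y} 0≤y = ≤-respʳ-≈ (+-comm x y) (x≤x+y 0≤y)

  x≤y⇒0≤y-x : ∀ {x y} → x ≤ y → 0# ≤ y - x
  x≤y⇒0≤y-x {x} {y} x≤y = ≤-respˡ-≈ (-‿inverseʳ x) (+-monoˡ-≤ (- x) x≤y)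

  *-monoˡ-≤ : ∀ {z x y} → 0# ≤ z → x ≤ y → z * x ≤ z * y
  *-monoˡ-≤ {z} {x} {y} 0≤z x≤y = begin
    z * x               ≤⟨ x≤y+x (*-nonNeg 0≤z (x≤y⇒0≤y-x x≤y)) ⟩
    z * (y - x) + z * x ≈⟨ distribˡ z (y - x) x ⟨
    z * (y - x + x)     ≈⟨ *-congˡ (x-y+y≈x y x) ⟩
    z * y               ∎

  *-monoʳ-≤ : ∀ {z x y} → 0# ≤ z → x ≤ y → x * z ≤ y * z
  *-monoʳ-≤ {z} {x} {y} 0≤z x≤y = begin
    x * z ≈⟨ *-comm x z ⟩
    z * x ≤⟨ *-monoˡ-≤ 0≤z x≤y ⟩
    z * y ≈⟨ *-comm z y ⟩
    y * z ∎

  0≤1 : 0# ≤ 1#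
  0≤1 with total 0# 1#
  ... | inj₁ 0≤1 = 0≤1
  ... | inj₂ 1≤0 = begin
    0#            ≤⟨ *-nonNeg 0≤-1 0≤-1 ⟩
    - 1# * - 1#   ≈⟨ -‿distribˡ-* 1# (- 1#) ⟨
    - (1# * - 1#) ≈⟨ CommutativeRing.-‿cong commutativeRing (*-identityˡ (- 1#)) ⟩
    - - 1#        ≈⟨ -‿involutive 1# ⟩
    1#            ∎
    where
    0≤-1 : 0# ≤ - 1#
    0≤-1 = ≤-respʳ-≈ (+-identityˡ (- 1#)) (x≤y⇒0≤y-x 1≤0)

  0<1 : 0# < 1#
  0<1 = 0≤1 , λ 0≈1 → 1≉0 (sym 0≈1)

  three : Carrier
  three = 1# + (1# + 1#)

  0≤three : 0# ≤ three
  0≤three = +-nonNeg 0≤1 (+-nonNeg 0≤1 0≤1)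

  [_]_ : Bool → Carrier → Carrier
  [ b ] x = if b then x else 0#
  infixr 8 [_]_

  []-cong : ∀ b {x y} → x ≈ y → [ b ] x ≈ [ b ] y
  []-cong true  x≈y = x≈y
  []-cong false x≈y = refl

  []-nonNeg : ∀ b {x} → 0# ≤ x → 0# ≤ [ b ] x
  []-nonNeg true  0≤x = 0≤x
  []-nonNeg false 0≤x = ≤-refl

  []-∧ : ∀ b b′ x → [ b ∧ b′ ] x ≡ [ b ] [ b′ ] x
  []-∧ true  b′ x = ≡.refl
  []-∧ false b′ x = ≡.refl

  []-*ʳ : ∀ b x y → [ b ] x * y ≈ [ b ] (x * y)
  []-*ʳ true  x y = refl
  []-*ʳ false x y = zeroˡ y

  []-*ˡ : ∀ b x y → x * [ b ] y ≈ [ b ] (x * y)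
  []-*ˡ true  x y = refl
  []-*ˡ false x y = zeroʳ x

  []-+ : ∀ b x y → [ b ] (x + y) ≈ [ b ] x + [ b ] y
  []-+ true  x y = refl
  []-+ false x y = sym (+-identityˡ 0#)

  []-mono : ∀ {b b′ x y} → (b ≡ true → b′ ≡ true) → 0# ≤ y → x ≤ y → [ b ] x ≤ [ b′ ] y
  []-mono {true}  {b′} imp 0≤y x≤y rewrite imp ≡.refl = x≤y
  []-mono {false} {b′} imp 0≤y x≤y = []-nonNeg b′ 0≤y

  ∑ : ℕ → (ℕ → Carrier) → Carrier
  ∑ zero    f = 0#
  ∑ (suc n) f = ∑ n f + f n

  ∑-cong : ∀ n {f g} → (∀ s → s ℕ.< n → f s ≈ g s) → ∑ n f ≈ ∑ n g
  ∑-cong zero    f≈g = refl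
  ∑-cong (suc n) f≈g = +-cong (∑-cong n λ s s<n → f≈g s (ℕ.m<n⇒m<1+n s<n)) (f≈g n (ℕ.n<1+n n))

  ∑-mono : ∀ n {f g} → (∀ s → s ℕ.< n → f s ≤ g s) → ∑ n f ≤ ∑ n g
  ∑-mono zero    f≤g = ≤-refl
  ∑-mono (suc n) f≤g = +-mono-≤ (∑-mono n λ s s<n → f≤g s (ℕ.m<n⇒m<1+n s<n)) (f≤g n (ℕ.n<1+n n))

  ∑-mono-< : ∀ n {f g} → (∀ s → s ℕ.< n → f s ≤ g s) → ∀ s → s ℕ.< n → f s < g s → ∑ n f < ∑ n g
  ∑-mono-< (suc n) f≤g s s<1+n fs<gs with s ℕ.≟ n
  ... | yes ≡.refl = +-mono-≤-< (∑-mono n λ t t<n → f≤g t (ℕ.m<n⇒m<1+n t<n)) fs<gs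
  ... | no s≢n     = +-mono-<-≤
        (∑-mono-< n (λ t t<n → f≤g t (ℕ.m<n⇒m<1+n t<n)) s (ℕ.≤∧≢⇒< (ℕ.<⇒≤pred s<1+n) s≢n) fs<gs)
        (f≤g n (ℕ.n<1+n n))

  ∑-zero : ∀ n → ∑ n (λ _ → 0#) ≈ 0#
  ∑-zero zero    = refl
  ∑-zero (suc n) = trans (+-identityʳ _) (∑-zero n)

  ∑-nonNeg : ∀ n {f} → (∀ s → s ℕ.< n → 0# ≤ f s) → 0# ≤ ∑ n f
  ∑-nonNeg n 0≤f = ≤-respˡ-≈ (∑-zero n) (∑-mono n 0≤f)

  ∑-+ : ∀ n f g → ∑ n (λ s → f s + g s) ≈ ∑ n f + ∑ n g
  ∑-+ zero    f g = sym (+-identityˡ 0#)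
  ∑-+ (suc n) f g = trans (+-congʳ (∑-+ n f g))
    (solve 4 (λ a b x y → (a :+ b) :+ (x :+ y) := (a :+ x) :+ (b :+ y)) refl (∑ n f) (∑ n g) (f n) (g n))

  ∑-*ˡ : ∀ n x f → ∑ n (λ s → x * f s) ≈ x * ∑ n f
  ∑-*ˡ zero    x f = sym (zeroʳ x)
  ∑-*ˡ (suc n) x f = trans (+-congʳ (∑-*ˡ n x f)) (sym (distribˡ x (∑ n f) (f n)))

  ∑-swap : ∀ m n (f : ℕ → ℕ → Carrier) → ∑ m (λ s → ∑ n (f s)) ≈ ∑ n (λ t → ∑ m (λ s → f s t))
  ∑-swap zero    n f = sym (∑-zero n)
  ∑-swap (suc m) n f = trans (+-congʳ (∑-swap m n f)) (sym (∑-+ n (λ t → ∑ m (λ s → f s t)) (f m)))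

  term≤∑ : ∀ n {f} → (∀ s → s ℕ.< n → 0# ≤ f s) → ∀ s → s ℕ.< n → f s ≤ ∑ n f
  term≤∑ (suc n) 0≤f s s<1+n with s ℕ.≟ n
  ... | yes ≡.refl = x≤y+x (∑-nonNeg n λ t t<n → 0≤f t (ℕ.m<n⇒m<1+n t<n))
  ... | no s≢n     = ≤-trans
        (term≤∑ n (λ t t<n → 0≤f t (ℕ.m<n⇒m<1+n t<n)) s (ℕ.≤∧≢⇒< (ℕ.<⇒≤pred s<1+n) s≢n))
        (x≤x+y (0≤f n (ℕ.n<1+n n)))

  -- Every "at most one" enters the estimates through this bound: a cell is charged for one pick, an
  -- interval has one cell at either end, a prefix grows by one knapsack at a time.
  ∑-unique : ∀ n (b : ℕ → Bool) {x} → 0# ≤ x →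
    (∀ s t → s ℕ.< n → t ℕ.< n → b s ≡ true → b t ≡ true → s ≡ t) → ∑ n (λ s → [ b s ] x) ≤ x
  ∑-unique zero    b 0≤x uniq = 0≤x
  ∑-unique (suc n) b {x} 0≤x uniq with b n in bn
  ... | false = ≤-respˡ-≈ (sym (+-identityʳ _))
        (∑-unique n b 0≤x λ s t s<n t<n → uniq s t (ℕ.m<n⇒m<1+n s<n) (ℕ.m<n⇒m<1+n t<n))
  ... | true  = ≤-reflexive (trans (+-congʳ (trans (∑-cong n others) (∑-zero n))) (+-identityˡ x))
    where
    others : ∀ s → s ℕ.< n → [ b s ] x ≈ 0#
    others s s<n with b s in bs
    ... | false = refl
    ... | true  = contradiction (uniq s n (ℕ.m<n⇒m<1+n s<n) (ℕ.n<1+n n) bs bn) (ℕ.<⇒≢ s<n)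

  ∑-front : ∀ n f → ∑ (suc n) f ≈ f 0 + ∑ n (λ s → f (suc s))
  ∑-front zero    f = trans (+-identityˡ _) (sym (+-identityʳ _))
  ∑-front (suc n) f = trans (+-congʳ (∑-front n f)) (+-assoc _ _ _)

  sum≈∑ : ∀ {n} (f : Fin n → Carrier) (g : ℕ → Carrier) → (∀ s → f s ≈ g (toℕ s)) → sum f ≈ ∑ n g
  sum≈∑ {zero}  f g f≈g = refl
  sum≈∑ {suc n} f g f≈g = trans
    (+-cong (f≈g Fin.zero) (sum≈∑ (λ s → f (Fin.suc s)) (λ s → g (suc s)) λ s → f≈g (Fin.suc s)))
    (sym (∑-front n g))

-- Bounded loops and Boolean tests.

-- Index 0 is processed first, so `loop p` is also the state of a longer loop just before index `p`;
-- `cost′` relies on this.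
loop : ∀ {a} {A : Set a} → ℕ → (ℕ → A → A) → A → A
loop zero    f x = x
loop (suc n) f x = f n (loop n f x)

loop-invariant : ∀ {a p} {A : Set a} (P : ℕ → A → Set p) n {f x} → P 0 x →
  (∀ i y → i ℕ.< n → P i y → P (suc i) (f i y)) → P n (loop n f x)
loop-invariant P zero    base step = base
loop-invariant P (suc n) base step =
  step n _ (ℕ.n<1+n n) (loop-invariant P n base λ i y i<n → step i y (ℕ.m<n⇒m<1+n i<n))

module _ {p} {P : Set p} where
  true⇒ : ∀ {b} → Reflects P b → b ≡ true → P
  true⇒ (ofʸ x) ≡.refl = x

  false⇒ : ∀ {b} → Reflects P b → b ≡ false → ¬ P
  false⇒ (ofⁿ ¬x) ≡.refl = ¬x

  ⇒true : ∀ {b} → Reflects P b → P → b ≡ true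
  ⇒true (ofʸ x)  _ = ≡.refl
  ⇒true (ofⁿ ¬x) x = contradiction x ¬x

  ⇒false : ∀ {b} → Reflects P b → ¬ P → b ≡ false
  ⇒false (ofʸ x)  ¬x = contradiction x ¬x
  ⇒false (ofⁿ ¬x) _  = ≡.refl

∧-true : ∀ {b b′} → b ∧ b′ ≡ true → b ≡ true × b′ ≡ true
∧-true {true} {true} _ = ≡.refl , ≡.refl

∧-intro : ∀ {b b′} → b ≡ true → b′ ≡ true → b ∧ b′ ≡ true
∧-intro ≡.refl ≡.refl = ≡.refl

not-true : ∀ {b} → not b ≡ true → b ≡ false
not-true {false} _ = ≡.refl

≤ᵇ⇒≤ : ∀ {m n} → (m ≤ᵇ n) ≡ true → m ℕ.≤ n
≤ᵇ⇒≤ {m} {n} = true⇒ (ℕ.≤ᵇ-reflects-≤ m n)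

≤⇒≤ᵇ : ∀ {m n} → m ℕ.≤ n → (m ≤ᵇ n) ≡ true
≤⇒≤ᵇ {m} {n} = ⇒true (ℕ.≤ᵇ-reflects-≤ m n)

≰⇒≤ᵇ : ∀ {m n} → n ℕ.< m → (m ≤ᵇ n) ≡ false
≰⇒≤ᵇ {m} {n} n<m = ⇒false (ℕ.≤ᵇ-reflects-≤ m n) (ℕ.<⇒≱ n<m)

-- Spelled with `≤ᵇ` so that it coincides with the test `eqE` of the machine language, which can
-- only compare.
_==_ : ℕ → ℕ → Bool
m == n = (m ≤ᵇ n) ∧ (n ≤ᵇ m)

==⇒≡ : ∀ {m n} → (m == n) ≡ true → m ≡ n
==⇒≡ {m} {n} eq = let p , q = ∧-true {m ≤ᵇ n} eq in ℕ.≤-antisym (≤ᵇ⇒≤ p) (≤ᵇ⇒≤ q)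

≡⇒== : ∀ {m n} → m ≡ n → (m == n) ≡ true
≡⇒== {m} ≡.refl = ∧-intro (≤⇒≤ᵇ {m} ℕ.≤-refl) (≤⇒≤ᵇ {m} ℕ.≤-refl)

≢⇒== : ∀ {m n} → m ≢ n → (m == n) ≡ false
≢⇒== {m} {n} m≢n with m == n in eq
... | true  = contradiction (==⇒≡ eq) m≢n
... | false = ≡.refl

update-same : ∀ (f : Memory) x v → (f [ x ↦ v ]) x ≡ v
update-same f x v rewrite ⇒true (proof (x ℕ.≟ x)) ≡.refl = ≡.refl

update-other : ∀ (f : Memory) {x y} v → y ≢ x → (f [ x ↦ v ]) y ≡ f y
update-other f {x} {y} v y≢x rewrite ⇒false (proof (y ℕ.≟ x)) y≢x = ≡.refl

-- Cells of a set of cuts.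

-- The cells of ℕ delimited by the cuts X are represented by their least elements;
-- x ∈ X is a cut between x - 1 and x.
start : (ℕ → Bool) → ℕ → ℕ
start X zero    = 0
start X (suc s) = if X (suc s) then suc s else start X s

module _ (X : ℕ → Bool) where
  start≤ : ∀ s → start X s ℕ.≤ s
  start≤ zero    = z≤n
  start≤ (suc s) with X (suc s)
  ... | true  = ℕ.≤-refl
  ... | false = ℕ.m≤n⇒m≤1+n (start≤ s)

  start-cut : ∀ s → start X s ≡ 0 ⊎ X (start X s) ≡ true
  start-cut zero    = inj₁ ≡.refl
  start-cut (suc s) with X (suc s) in eq
  ... | true  = inj₂ eq
  ... | false = start-cut s

  start-at-cut : ∀ s → X s ≡ true → start X s ≡ s
  start-at-cut zero    _ = ≡.refl
  start-at-cut (suc s) eq rewrite eq = ≡.refl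

  start-mono : ∀ {s t} → s ℕ.≤ t → start X s ℕ.≤ start X t
  start-mono {s} {t} s≤t with ℕ.m≤n⇒m<n∨m≡n s≤t
  ... | inj₂ ≡.refl = ℕ.≤-refl
  ... | inj₁ s<t    = go t s<t
    where
    go : ∀ t → s ℕ.< t → start X s ℕ.≤ start X t
    go (suc t) (s≤s s≤t) with X (suc t)
    ... | true  = ℕ.≤-trans (start≤ s) (ℕ.m≤n⇒m≤1+n s≤t)
    ... | false = start-mono s≤t

module _ {X X′ : ℕ → Bool} where
  -- Every coarse cut is a fine one, so none lies above `start X′ s` and up to `s`: going back to
  -- the fine start does not leave the coarse cell.
  start-coarse : (∀ x → X x ≡ true → X′ x ≡ true) → ∀ s → start X (start X′ s) ≡ start X s
  start-coarse X⊆X′ zero    = ≡.refl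
  start-coarse X⊆X′ (suc s) with X′ (suc s) in eq′
  ... | true  = ≡.refl
  ... | false with X (suc s) in eq
  ...   | true  with () ← ≡.trans (≡.sym (X⊆X′ (suc s) eq)) eq′
  ...   | false = start-coarse X⊆X′ s

  start-refine : (∀ x → X x ≡ true → X′ x ≡ true) → ∀ s t → start X′ s ≡ start X′ t → start X s ≡ start X t
  start-refine X⊆X′ s t eq =
    ≡.trans (≡.sym (start-coarse X⊆X′ s)) (≡.trans (≡.cong (start X) eq) (start-coarse X⊆X′ t))

  start-cong : (∀ x → X x ≡ X′ x) → ∀ s → start X s ≡ start X′ s
  start-cong X≗X′ zero    = ≡.refl
  start-cong X≗X′ (suc s) rewrite X≗X′ (suc s) | start-cong X≗X′ s = ≡.refl

  module _ (z : ℕ) (cut : X′ z ≡ true) (same : ∀ x → x ≢ z → X′ x ≡ X x) where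
    start-below : ∀ s → s ℕ.< z → start X′ s ≡ start X s
    start-below zero    _   = ≡.refl
    start-below (suc s) s<z rewrite same (suc s) (ℕ.<⇒≢ s<z) | start-below s (ℕ.<⇒≤ s<z) = ≡.refl

    -- Beyond `z` both sets of cuts agree, so the walk down from `s` either meets an old cut above
    -- `z` or arrives at `z`, where a cell now begins.
    start-above : ∀ s → z ℕ.≤ s →
      (start X s ≡ start X z × start X′ s ≡ z) ⊎ (z ℕ.< start X s × start X′ s ≡ start X s)
    start-above s z≤s with ℕ.m≤n⇒m<n∨m≡n z≤s
    ... | inj₂ ≡.refl = inj₁ (≡.refl , start-at-cut X′ z cut)
    start-above (suc s) z≤s | inj₁ z<s rewrite same (suc s) (ℕ.>⇒≢ z<s) with X (suc s)
    ... | true  = inj₂ (z<s , ≡.refl)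
    ... | false = start-above s (ℕ.<⇒≤pred z<s)

-- The algorithm over an abstract type of numbers.

-- The algorithm is written over Ops so that it can be run both on the field itself and on ℕ, where C, K and y
-- are stored over common denominators; a Scale translates back.
record Ops (a : Level) : Set (Level.suc a) where
  field
    Number  : Set a
    plus    : Number → Number → Number
    minus   : Number → Number → Number
    null    : Number
    leq     : Number → Number → Bool

module Algorithm {a} (O : Ops a) (T : ℕ) (C W : ℕ → Ops.Number O) (one top : Ops.Number O) where
  open Ops O

  -- The sequence starts above every capacity, where no knapsack counts, and is `null` from index
  -- `T + 1` at the latest, where all of them count. These are the two ends of the summation by
  -- parts.
  level : ℕ → Number
  level zero    = top
  level (suc i) = loop T (λ s m → if not (leq (level i) (C s)) ∧ not (leq (C s) m) then C s else m) null

  -- One table of marks holds the whole chain of partitions: a larger threshold `τ` keeps fewer cuts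
  -- and so gives back an earlier, coarser partition.
  Cut : (ℕ → ℕ) → ℕ → ℕ → Bool
  Cut f τ x = τ ≤ᵇ f x

  active : Number → ℕ → Number
  active r s = if leq r (C s) then W s else null

  before after : (ℕ → Bool) → Number → ℕ → Number
  before X r x = loop T (λ s m → if (start X s == start X x) ∧ (suc s ≤ᵇ x) then plus m (active r s) else m) null
  after  X r x = loop T (λ s m → if (start X s == start X x) ∧ (x ≤ᵇ s) then plus m (active r s) else m) null

  split : ℕ → Number → ℕ → (ℕ → ℕ) → (ℕ → ℕ)
  split τ r x f = if leq one (before (Cut f τ) r x) ∧ leq one (after (Cut f τ) r x) then f [ x ↦ τ ] else f

  -- Stage i (from 0) marks its cuts with T - i, so a cut is present after stage i iff its mark is at least T - i.
  cutTime : ℕ → ℕ → ℕ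
  cutTime zero    = λ _ → 0
  cutTime (suc i) = loop T (split (T ∸ i) (level (suc i))) (cutTime i)

  levelAt : ℕ → Number
  levelAt τ = level (suc (T ∸ τ))

  CutAt : ℕ → ℕ → Bool
  CutAt = Cut (cutTime T)

  -- Knapsacks of weight `null` are left out. They add nothing to the weight of a cell, and without
  -- them no pick can fall into S⁺, whose cost is accounted for separately.
  inCell : ℕ → ℕ → ℕ → Bool
  inCell τ p s = (start (CutAt τ) s == p) ∧ (leq (levelAt τ) (C s) ∧ not (leq (W s) null))

  module Rounding (K : ℕ → Number) where
    -- One more than the index of a cheapest knapsack in the cell, and 0 if the cell is empty.
    cheapest : ℕ → ℕ → (ℕ → Number) → ℕ
    cheapest τ p k = loop T
      (λ s b → if inCell τ p s ∧ not ((1 ≤ᵇ b) ∧ leq (k (b ∸ 1)) (k s)) then suc s else b) 0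

    -- The test `CutAt τ p` skips the first cell and the indices where no cell starts. The test
    -- `suc s ≤ᵇ T` mirrors the machine, which changes entries below `T` only: the cost tables then
    -- agree at all indices, also at those that `cheapest` reads through its accumulator `b ∸ 1`.
    reduce : ℕ → ℕ → (ℕ → Number) → (ℕ → Number)
    reduce τ p k s =
      if (CutAt τ p ∧ inCell τ p s) ∧ (suc s ≤ᵇ T) then minus (k s) (k (cheapest τ p k ∸ 1)) else k s

    rowCost : ℕ → ℕ → Number
    rowCost zero    = K
    rowCost (suc i) = loop T (reduce (suc i)) (rowCost i)

    cost′ : ℕ → ℕ → ℕ → Number
    cost′ i p = loop p (reduce (suc i)) (rowCost i)

    choice : ℕ → ℕ → ℕ
    choice i p = cheapest (suc i) p (cost′ i p) ∸ 1

    hit : ℕ → ℕ → (ℕ → ℕ) → ℕ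
    hit τ p P = loop T (λ s h → if inCell τ p s ∧ (1 ≤ᵇ P s) then 1 else h) 0

    pick : ℕ → ℕ → (ℕ → ℕ) → (ℕ → ℕ)
    pick i p P = if CutAt (suc i) p ∧ not (1 ≤ᵇ hit (suc i) p P) then P [ choice i p ↦ 1 ] else P

    -- Rows run from `T` down to 1 and cells from right to left. This is the reverse of `rowCost`,
    -- as undoing the reductions one by one requires.
    rowPick : ℕ → ℕ → ℕ
    rowPick zero    = λ _ → 0
    rowPick (suc j) = loop T (λ q → pick (T ∸ suc j) (T ∸ suc q)) (rowPick j)

-- Subtraction is trusted only where it does not go below zero, since on ℕ it truncates.
record Scale {a c ℓ₁ ℓ₂} (O : Ops a) (F : OrderedField c ℓ₁ ℓ₂) : Set (a ⊔ c ⊔ ℓ₁ ⊔ ℓ₂) where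
  open Ops O
  open OrderedField F
  field
    ι       : Number → Carrier
    ι-null  : ι null ≈ 0#
    ι-plus  : ∀ m n → ι (plus m n) ≈ ι m + ι n
    ι-minus : ∀ m n → ι n ≤ ι m → ι (minus m n) ≈ ι m - ι n
    ι-leq   : ∀ m n → Reflects (ι m ≤ ι n) (leq m n)

  leq⇒≤ : ∀ {m n} → leq m n ≡ true → ι m ≤ ι n
  leq⇒≤ {m} {n} = true⇒ (ι-leq m n)

  leq⇒≰ : ∀ {m n} → leq m n ≡ false → ¬ ι m ≤ ι n
  leq⇒≰ {m} {n} = false⇒ (ι-leq m n)

  ≤⇒leq : ∀ {m n} → ι m ≤ ι n → leq m n ≡ true
  ≤⇒leq {m} {n} = ⇒true (ι-leq m n)

  ≰⇒leq : ∀ {m n} → ¬ ι m ≤ ι n → leq m n ≡ false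
  ≰⇒leq {m} {n} = ⇒false (ι-leq m n)

-- Capacity levels and summation by parts.

count : ℕ → (ℕ → Bool) → ℕ
count zero    b = 0
count (suc n) b = (if b n then 1 else 0) ℕ.+ count n b

count≤ : ∀ n b → count n b ℕ.≤ n
count≤ zero    b = z≤n
count≤ (suc n) b with b n
... | true  = s≤s (count≤ n b)
... | false = ℕ.m≤n⇒m≤1+n (count≤ n b)

count-mono : ∀ n {b b′} → (∀ s → s ℕ.< n → b s ≡ true → b′ s ≡ true) → count n b ℕ.≤ count n b′
count-mono zero    imp = z≤n
count-mono (suc n) {b} {b′} imp with b n in bn
... | false = ℕ.≤-trans (count-mono n λ s s<n → imp s (ℕ.m<n⇒m<1+n s<n)) (ℕ.m≤n+m _ _)
... | true rewrite imp n (ℕ.n<1+n n) bn = s≤s (count-mono n λ s s<n → imp s (ℕ.m<n⇒m<1+n s<n))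

count-mono-< : ∀ n {b b′} → (∀ s → s ℕ.< n → b s ≡ true → b′ s ≡ true) →
  ∀ s → s ℕ.< n → b s ≡ false → b′ s ≡ true → count n b ℕ.< count n b′
count-mono-< (suc n) {b} {b′} imp s s<1+n bs b′s with s ℕ.≟ n
... | yes ≡.refl rewrite bs | b′s = s≤s (count-mono n λ t t<n → imp t (ℕ.m<n⇒m<1+n t<n))
... | no s≢n with b n in bn
...   | false = ℕ.≤-trans rest (ℕ.m≤n+m _ _)
    where
    rest = count-mono-< n (λ t t<n → imp t (ℕ.m<n⇒m<1+n t<n)) s (ℕ.≤∧≢⇒< (ℕ.<⇒≤pred s<1+n) s≢n) bs b′s
...   | true rewrite imp n (ℕ.n<1+n n) bn =
    s≤s (count-mono-< n (λ t t<n → imp t (ℕ.m<n⇒m<1+n t<n)) s (ℕ.≤∧≢⇒< (ℕ.<⇒≤pred s<1+n) s≢n) bs b′s)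

module Levels {a c ℓ₁ ℓ₂} (O : Ops a) (F : OrderedField c ℓ₁ ℓ₂) (T : ℕ) (C W : ℕ → Ops.Number O)
  (one top : Ops.Number O) (σC : Scale O F)
  (C>0 : ∀ s → s ℕ.< T → OrderedField._<_ F (OrderedField.0# F) (Scale.ι σC (C s)))
  (C<top : ∀ s → s ℕ.< T → OrderedField._<_ F (Scale.ι σC (C s)) (Scale.ι σC top))
  (top≥0 : OrderedField._≤_ F (OrderedField.0# F) (Scale.ι σC top)) where

  open Ops O
  open OrderedField F
  open OrderedFieldProperties F
  open Algorithm O T C W one top
  open Scale σC

  cap : ℕ → Carrier
  cap s = ι (C s)

  lev : ℕ → Carrier
  lev i = ι (level i)

  level-bound : ∀ i s → s ℕ.< T → cap s < lev i → cap s ≤ lev (suc i)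
  level-bound i = loop-invariant (λ n m → ∀ s → s ℕ.< n → cap s < lev i → cap s ≤ ι m) T
    (λ s ()) step
    where
    step : ∀ n m → n ℕ.< T → (∀ s → s ℕ.< n → cap s < lev i → cap s ≤ ι m) → ∀ s → s ℕ.< suc n → cap s < lev i →
      cap s ≤ ι (if not (leq (level i) (C n)) ∧ not (leq (C n) m) then C n else m)
    step n m n<T ih s s<1+n cs<l with leq (level i) (C n) in eq₁ | leq (C n) m in eq₂ | s ℕ.≟ n
    ... | true  | _     | yes ≡.refl = contradiction (leq⇒≤ eq₁) (<⇒≱ cs<l)
    ... | true  | _     | no s≢n     = ih s (ℕ.≤∧≢⇒< (ℕ.<⇒≤pred s<1+n) s≢n) cs<l
    ... | false | true  | yes ≡.refl = leq⇒≤ eq₂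
    ... | false | true  | no s≢n     = ih s (ℕ.≤∧≢⇒< (ℕ.<⇒≤pred s<1+n) s≢n) cs<l
    ... | false | false | yes ≡.refl = ≤-refl
    ... | false | false | no s≢n     = ≤-trans (ih s (ℕ.≤∧≢⇒< (ℕ.<⇒≤pred s<1+n) s≢n) cs<l) (proj₁ (≰⇒> (leq⇒≰ eq₂)))

  level-attained : ∀ i → level (suc i) ≡ null ⊎ ∃ λ s → s ℕ.< T × level (suc i) ≡ C s × cap s < lev i
  level-attained i = loop-invariant (λ n m → m ≡ null ⊎ ∃ λ s → s ℕ.< T × m ≡ C s × cap s < lev i) T
    (inj₁ ≡.refl) step
    where
    step : ∀ n m → n ℕ.< T → (m ≡ null ⊎ ∃ λ s → s ℕ.< T × m ≡ C s × cap s < lev i) →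
      let m′ = if not (leq (level i) (C n)) ∧ not (leq (C n) m) then C n else m in
      m′ ≡ null ⊎ ∃ λ s → s ℕ.< T × m′ ≡ C s × cap s < lev i
    step n m n<T ih with leq (level i) (C n) in eq₁ | leq (C n) m
    ... | true  | _     = ih
    ... | false | true  = ih
    ... | false | false = inj₂ (n , n<T , ≡.refl , ≰⇒> (leq⇒≰ eq₁))

  lev≥0 : ∀ i → 0# ≤ lev i
  lev≥0 zero    = top≥0
  lev≥0 (suc i) with level-attained i
  ... | inj₁ eq rewrite eq = ≤-reflexive (sym ι-null)
  ... | inj₂ (s , s<T , eq , _) rewrite eq = proj₁ (C>0 s s<T)

  above : ℕ → ℕ → Bool
  above i s = leq (level i) (C s)

  above-step : ∀ i s → s ℕ.< T → above i s ≡ true → above (suc i) s ≡ true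
  above-step i s s<T eq with level-attained i
  ... | inj₁ eq′ rewrite eq′ = ≤⇒leq (≤-respˡ-≈ (sym ι-null) (proj₁ (C>0 s s<T)))
  ... | inj₂ (t , t<T , eq′ , ct<l) rewrite eq′ = ≤⇒leq (≤-trans (proj₁ ct<l) (leq⇒≤ eq))

  -- Until the level is null, the number of capacities below it drops at every step.
  private
    below : ℕ → ℕ → Bool
    below i s = not (above i s)

    below-step : ∀ i s → s ℕ.< T → below (suc i) s ≡ true → below i s ≡ true
    below-step i s s<T eq with above i s in eq′
    ... | false = ≡.refl
    ... | true  rewrite above-step i s s<T eq′ = eq

    few-below : ∀ i → level i ≡ null ⊎ count T (below i) ℕ.+ i ℕ.≤ T
    few-below zero    = inj₂ (≡.subst (ℕ._≤ T) (≡.sym (ℕ.+-identityʳ _)) (count≤ T (below 0)))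
    few-below (suc i) with level-attained i
    ... | inj₁ eq = inj₁ eq
    ... | inj₂ (s , s<T , eq , cs<l) with few-below i
    ...   | inj₁ eq′ = contradiction (≤-respʳ-≈ (trans (reflexive (≡.cong ι eq′)) ι-null) (proj₁ cs<l)) (<⇒≱ (C>0 s s<T))
    ...   | inj₂ le  = inj₂ (ℕ.≤-trans (ℕ.≤-reflexive (ℕ.+-suc _ i)) (ℕ.≤-trans (ℕ.+-monoˡ-≤ i drop) le))
      where
      drop : count T (below (suc i)) ℕ.< count T (below i)
      drop = count-mono-< T (below-step i) s s<T
        (≡.cong not (≤⇒leq (≤-reflexive (reflexive (≡.cong ι eq)))))
        (≡.cong not (≰⇒leq (<⇒≱ cs<l)))

  last-level : level (suc T) ≡ null
  last-level with few-below (suc T)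
  ... | inj₁ eq = eq
  ... | inj₂ le = contradiction (ℕ.≤-trans (ℕ.m≤n+m (suc T) _) le) (ℕ.<⇒≱ (ℕ.n<1+n T))

  above-top : ∀ s → s ℕ.< T → above 0 s ≡ false
  above-top s s<T = ≰⇒leq (<⇒≱ (C<top s s<T))

  above-last : ∀ s → s ℕ.< T → above (suc T) s ≡ true
  above-last s s<T = ≤⇒leq (≤-respˡ-≈ (sym (trans (reflexive (≡.cong ι last-level)) ι-null)) (proj₁ (C>0 s s<T)))

  -- The next level is the greatest capacity below level `i`, so whatever joins at level `i + 1`
  -- attains it exactly. In the summation by parts the `excess` of a newcomer is therefore zero.
  above-suc : ∀ i s → s ℕ.< T → above (suc i) s ≡ true → above i s ≡ false → cap s ≈ lev (suc i)
  above-suc i s s<T eq eq′ = antisym (level-bound i s s<T (≰⇒> (leq⇒≰ eq′))) (leq⇒≤ eq)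

  -- No capacity lies strictly between two consecutive levels, so the last level that is still at
  -- least `ρ` selects the same knapsacks as `ρ` itself.
  threshold-level : ∀ ρ → 0# < ρ → ∃ λ i → i ℕ.≤ T × (∀ s → s ℕ.< T → ρ ≤ cap s → above i s ≡ true)
    × (∀ s → s ℕ.< T → above i s ≡ true → ρ ≤ cap s)
  threshold-level ρ 0<ρ with ρ ≤? lev 0
  -- Here `ρ` exceeds all capacities: it selects nothing, and neither does level 0.
  ... | no ρ≰top = 0 , z≤n , (λ s s<T ρ≤cs → contradiction (≤-trans ρ≤cs (proj₁ (C<top s s<T))) ρ≰top)
                 , λ s s<T eq → contradiction (≡.trans (≡.sym eq) (above-top s s<T)) λ ()
  ... | yes ρ≤top = search T 0 (ℕ.+-identityʳ T) ρ≤top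
    where
    search : ∀ k i → k ℕ.+ i ≡ T → ρ ≤ lev i → ∃ λ i → i ℕ.≤ T × (∀ s → s ℕ.< T → ρ ≤ cap s → above i s ≡ true)
      × (∀ s → s ℕ.< T → above i s ≡ true → ρ ≤ cap s)
    found : ∀ i → i ℕ.≤ T → ρ ≤ lev i → ¬ ρ ≤ lev (suc i) → ∃ λ i → i ℕ.≤ T × (∀ s → s ℕ.< T → ρ ≤ cap s → above i s ≡ true)
      × (∀ s → s ℕ.< T → above i s ≡ true → ρ ≤ cap s)
    found i i≤T ρ≤l ρ≰l′ = i , i≤T , to , λ s s<T eq → ≤-trans ρ≤l (leq⇒≤ eq)
      where
      to : ∀ s → s ℕ.< T → ρ ≤ cap s → above i s ≡ true
      to s s<T ρ≤cs with above i s in eq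
      ... | true  = ≡.refl
      ... | false = contradiction (≤-trans ρ≤cs (level-bound i s s<T (≰⇒> (leq⇒≰ eq)))) ρ≰l′
    search k i eq ρ≤l with ρ ≤? lev (suc i)
    ... | no ρ≰l′ = found i (≡.subst (i ℕ.≤_) eq (ℕ.m≤n+m i k)) ρ≤l ρ≰l′
    search (suc k) i eq ρ≤l | yes ρ≤l′ = search k (suc i) (≡.trans (ℕ.+-suc k i) eq) ρ≤l′
    -- Here `i = T`, and level `T + 1` is `null`, which a positive `ρ` exceeds.
    search zero i ≡.refl ρ≤l | yes ρ≤l′ =
      contradiction (≤-respʳ-≈ (trans (reflexive (≡.cong ι last-level)) ι-null) ρ≤l′) (<⇒≱ 0<ρ)

  -- Summation by parts: g ∘ cap is a nonnegative combination of the indicators of the sets {cap ≥ lev i},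
  -- with coefficients g (lev i) - g (lev (i+1)).
  module _ (g : Carrier → Carrier) (ρ κ : Carrier) (g-cong : ∀ {x y} → x ≈ y → g x ≈ g y)
    (g-mono : ∀ {x y} → x ≤ y → g x ≤ g y) (g-bound : ∀ x → g x ≤ ρ) (g-zero : g 0# ≈ 0#) (0≤κ : 0# ≤ κ)
    (u v : ℕ → Carrier)
    (u≤v : ∀ i → i ℕ.≤ T → ∑ T (λ s → [ above i s ] u s) ≤ κ + ∑ T (λ s → [ above i s ] v s)) where

    private
      μ ε : ℕ → Carrier
      μ i = g (lev i)
      ε i = μ i - μ (suc i)

      -- Closed form of the sum of `ε j` over the levels `j < i` at which `s` counts: it is 0 at
      -- level 0 and reaches `g (cap s)` at level `T + 1`.
      excess : ℕ → ℕ → Carrier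
      excess i s = [ above i s ] (g (cap s) - μ i)

      lev-step : ∀ i → lev (suc i) ≤ lev i
      lev-step i with level-attained i
      ... | inj₂ (s , _ , eq , cs<l) rewrite eq = proj₁ cs<l
      ... | inj₁ eq rewrite eq = ≤-respˡ-≈ (sym ι-null) (lev≥0 i)

      0≤ε : ∀ i → 0# ≤ ε i
      0≤ε i = x≤y⇒0≤y-x (g-mono (lev-step i))

      telescope : ∀ x i → x - μ (suc i) ≈ (x - μ i) + ε i
      telescope x i = sym (trans (+-assoc x (- μ i) (ε i)) (+-congˡ
        (trans (sym (+-assoc (- μ i) (μ i) (- μ (suc i)))) (trans (+-congʳ (-‿inverseˡ (μ i))) (+-identityˡ _)))))

      excess-step : ∀ i s → s ℕ.< T → ∀ x → x * excess (suc i) s ≈ x * excess i s + ε i * [ above i s ] x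
      excess-step i s s<T x with above i s in eq | above (suc i) s in eq′
      ... | true  | false = contradiction (≡.trans (≡.sym (above-step i s s<T eq)) eq′) λ ()
      ... | false | false = sym (trans (+-congˡ (zeroʳ (ε i))) (+-identityʳ _))
      ... | true  | true  = trans (*-congˡ (telescope (g (cap s)) i))
                              (trans (distribˡ x _ (ε i)) (+-congˡ (*-comm x (ε i))))
      ... | false | true  = trans (*-congˡ (trans (+-congʳ (g-cong (above-suc i s s<T eq′ eq))) (-‿inverseʳ _)))
                              (sym (trans (+-congˡ (zeroʳ (ε i))) (+-identityʳ _)))

      ∑-excess-step : ∀ i (z : ℕ → Carrier) → ∑ T (λ s → z s * excess (suc i) s)
        ≈ ∑ T (λ s → z s * excess i s) + ε i * ∑ T (λ s → [ above i s ] z s)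
      ∑-excess-step i z = trans (∑-cong T λ s s<T → excess-step i s s<T (z s))
        (trans (∑-+ T _ _) (+-congˡ (∑-*ˡ T (ε i) _)))

      -- The slack `κ` is paid at every level with coefficient `ε i`. These coefficients telescope,
      -- so the total is at most `κ * ρ` however many levels there are.
      partial : ∀ i → i ℕ.≤ suc T →
        ∑ T (λ s → u s * excess i s) ≤ κ * (ρ - μ i) + ∑ T (λ s → v s * excess i s)
      partial zero    _ = begin
        ∑ T (λ s → u s * excess 0 s)                     ≈⟨ vanish u ⟩
        0#                                               ≤⟨ *-nonNeg 0≤κ (x≤y⇒0≤y-x (g-bound _)) ⟩
        κ * (ρ - μ 0)                                    ≈⟨ +-identityʳ _ ⟨
        κ * (ρ - μ 0) + 0#                               ≈⟨ +-congˡ (vanish v) ⟨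
        κ * (ρ - μ 0) + ∑ T (λ s → v s * excess 0 s)     ∎
        where
        vanish : (z : ℕ → Carrier) → ∑ T (λ s → z s * excess 0 s) ≈ 0#
        vanish z = trans (∑-cong T λ s s<T →
          trans (*-congˡ (reflexive (≡.cong (λ b → [ b ] (g (cap s) - μ 0)) (above-top s s<T)))) (zeroʳ (z s))) (∑-zero T)
      partial (suc i) (s≤s i≤T) = begin
        ∑ T (λ s → u s * excess (suc i) s)
          ≈⟨ ∑-excess-step i u ⟩
        ∑ T (λ s → u s * excess i s) + ε i * ∑ T (λ s → [ above i s ] u s)
          ≤⟨ +-mono-≤ (partial i (ℕ.m≤n⇒m≤1+n i≤T)) (*-monoˡ-≤ (0≤ε i) (u≤v i i≤T)) ⟩
        (κ * (ρ - μ i) + V) + ε i * (κ + V′)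
          ≈⟨ solve 5 (λ k d V e V′ → (k :* d :+ V) :+ e :* (k :+ V′) := k :* (d :+ e) :+ (V :+ e :* V′))
               refl κ (ρ - μ i) V (ε i) V′ ⟩
        κ * ((ρ - μ i) + ε i) + (V + ε i * V′)
          ≈⟨ +-cong (*-congˡ (telescope ρ i)) (∑-excess-step i v) ⟨
        κ * (ρ - μ (suc i)) + ∑ T (λ s → v s * excess (suc i) s) ∎
        where
        V V′ : Carrier
        V  = ∑ T (λ s → v s * excess i s)
        V′ = ∑ T (λ s → [ above i s ] v s)

      minus-last : ∀ x → x - μ (suc T) ≈ x
      minus-last x = trans (+-congˡ (CommutativeRing.-‿cong commutativeRing
        (trans (g-cong (trans (reflexive (≡.cong ι last-level)) ι-null)) g-zero)))
        (trans (+-congˡ (trans (sym (+-identityˡ _)) (-‿inverseʳ 0#))) (+-identityʳ x))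

      excess-last : (z : ℕ → Carrier) → ∑ T (λ s → z s * excess (suc T) s) ≈ ∑ T (λ s → z s * g (cap s))
      excess-last z = ∑-cong T λ s s<T → *-congˡ (trans
        (reflexive (≡.cong (λ b → [ b ] (g (cap s) - μ (suc T))) (above-last s s<T))) (minus-last _))

    summation-by-parts : ∑ T (λ s → u s * g (cap s)) ≤ κ * ρ + ∑ T (λ s → v s * g (cap s))
    summation-by-parts = begin
      ∑ T (λ s → u s * g (cap s))                            ≈⟨ excess-last u ⟨
      ∑ T (λ s → u s * excess (suc T) s)                     ≤⟨ partial (suc T) ℕ.≤-refl ⟩
      κ * (ρ - μ (suc T)) + ∑ T (λ s → v s * excess (suc T) s) ≈⟨ +-cong (*-congˡ (minus-last ρ)) (excess-last v) ⟩
      κ * ρ + ∑ T (λ s → v s * g (cap s))                    ∎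

-- The successive partitions and the weights of their cells.

-- Capacities, costs and weights are never compared with one another, so each kind may have a unit
-- of its own; a denominator common to all three is never formed.
record Setup {a c ℓ₁ ℓ₂} (O : Ops a) (F : OrderedField c ℓ₁ ℓ₂) (T : ℕ) : Set (a ⊔ c ⊔ ℓ₁ ⊔ ℓ₂) where
  field
    σC σK σW   : Scale O F
  open Ops O public
  open OrderedField F public
  open Scale σC public using () renaming (ι to ιC)
  open Scale σK public using () renaming (ι to ιK)
  open Scale σW public using () renaming (ι to ιW)
  field
    C K W      : ℕ → Number
    one top    : Number
    C>0        : ∀ s → s ℕ.< T → 0# < ιC (C s)
    C<top      : ∀ s → s ℕ.< T → ιC (C s) < ιC top
    top≥0      : 0# ≤ ιC top
    K≥0        : ∀ s → s ℕ.< T → 0# ≤ ιK (K s)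
    W≥0        : ∀ s → s ℕ.< T → 0# ≤ ιW (W s)
    W<1        : ∀ s → s ℕ.< T → ιW (W s) < 1#
    one≈1      : ιW one ≈ 1#

module Cells {a c ℓ₁ ℓ₂} {O : Ops a} {F : OrderedField c ℓ₁ ℓ₂} {T : ℕ} (S : Setup O F T) where
  open Setup S
  open OrderedFieldProperties F public
  open Algorithm O T C W one top public
  open Levels O F T C W one top σC C>0 C<top top≥0 public

  w : ℕ → Carrier
  w s = ιW (W s)

  weight : ℕ → ℕ → Carrier
  weight i s = [ above i s ] w s

  weight≥0 : ∀ i s → s ℕ.< T → 0# ≤ weight i s
  weight≥0 i s s<T = []-nonNeg (above i s) (W≥0 s s<T)

  weight<1 : ∀ i s → s ℕ.< T → weight i s < 1#
  weight<1 i s s<T with above i s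
  ... | true  = W<1 s s<T
  ... | false = 0<1

  weight-mono : ∀ i s → s ℕ.< T → weight i s ≤ weight (suc i) s
  weight-mono i s s<T = []-mono (above-step i s s<T) (W≥0 s s<T) ≤-refl

  mass : (ℕ → Bool) → ℕ → ℕ → Carrier
  mass X i p = ∑ T λ s → [ start X s == p ] weight i s

  pre suf : (ℕ → Bool) → ℕ → ℕ → ℕ → Carrier
  pre X i p x = ∑ T λ s → [ (start X s == p) ∧ (suc s ≤ᵇ x) ] weight i s
  suf X i p x = ∑ T λ s → [ (start X s == p) ∧ (x ≤ᵇ s) ] weight i s

  private
    ι-loop : ∀ n (b : ℕ → Bool) (g : ℕ → Number) → ιW (loop n (λ s m → if b s then plus m (g s) else m) null) ≈ ∑ n (λ s → [ b s ] ιW (g s))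
    ι-loop zero    b g = Scale.ι-null σW
    ι-loop (suc n) b g with b n
    ... | true  = trans (Scale.ι-plus σW _ _) (+-congʳ (ι-loop n b g))
    ... | false = trans (ι-loop n b g) (sym (+-identityʳ _))

    ι-active : ∀ i s → ιW (active (level i) s) ≈ weight i s
    ι-active i s with above i s
    ... | true  = refl
    ... | false = Scale.ι-null σW

  before≈pre : ∀ X i x → ιW (before X (level i) x) ≈ pre X i (start X x) x
  before≈pre X i x = trans (ι-loop T _ _) (∑-cong T λ s _ → []-cong _ (ι-active i s))

  after≈suf : ∀ X i x → ιW (after X (level i) x) ≈ suf X i (start X x) x
  after≈suf X i x = trans (ι-loop T _ _) (∑-cong T λ s _ → []-cong _ (ι-active i s))

  pre+suf : ∀ X i p x → mass X i p ≈ pre X i p x + suf X i p x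
  pre+suf X i p x = trans (∑-cong T λ s _ → split-at s) (∑-+ T _ _)
    where
    split-at : ∀ s → [ start X s == p ] weight i s
      ≈ [ (start X s == p) ∧ (suc s ≤ᵇ x) ] weight i s + [ (start X s == p) ∧ (x ≤ᵇ s) ] weight i s
    split-at s with start X s == p | suc s ℕ.≤? x
    ... | false | _       = sym (+-identityˡ 0#)
    ... | true  | yes s<x rewrite ≤⇒≤ᵇ s<x | ≰⇒≤ᵇ s<x = sym (+-identityʳ _)
    ... | true  | no s≮x  rewrite ≰⇒≤ᵇ (ℕ.≰⇒> s≮x) | ≤⇒≤ᵇ (ℕ.≮⇒≥ s≮x) = sym (+-identityˡ _)

  ∑-[]-mono : ∀ i {b b′ : ℕ → Bool} → (∀ s → s ℕ.< T → b s ≡ true → b′ s ≡ true) →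
    ∑ T (λ s → [ b s ] weight i s) ≤ ∑ T (λ s → [ b′ s ] weight i s)
  ∑-[]-mono i imp = ∑-mono T λ s s<T → []-mono (imp s s<T) (weight≥0 i s s<T) ≤-refl

  ∑-[]-zero : ∀ i {b : ℕ → Bool} → (∀ s → s ℕ.< T → b s ≡ false) → ∑ T (λ s → [ b s ] weight i s) ≈ 0#
  ∑-[]-zero i none = trans (∑-cong T λ s s<T → reflexive (≡.cong ([_] weight i s) (none s s<T))) (∑-zero T)

  mass-level-mono : ∀ X i p → mass X i p ≤ mass X (suc i) p
  mass-level-mono X i p = ∑-mono T λ s s<T → []-mono {start X s == p} (λ eq → eq) (weight≥0 (suc i) s s<T) (weight-mono i s s<T)

  mass-cong : ∀ {X X′} → (∀ x → X x ≡ X′ x) → ∀ i p → mass X i p ≈ mass X′ i p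
  mass-cong X≗X′ i p = ∑-cong T λ s _ →
    reflexive (≡.cong (λ t → [ t == p ] weight i s) (start-cong X≗X′ s))

  pre-at-cut : ∀ {X x} i → X x ≡ true → pre X i (start X x) x ≈ 0#
  pre-at-cut {X} {x} i cut = ∑-[]-zero i λ s _ → outside s
    where
    outside : ∀ s → (start X s == start X x) ∧ (suc s ≤ᵇ x) ≡ false
    outside s with start X s == start X x in eq | suc s ≤ᵇ x in eq′
    ... | false | _     = ≡.refl
    ... | true  | false = ≡.refl
    ... | true  | true  = contradiction (≤ᵇ⇒≤ eq′) (ℕ.≤⇒≯ (≡.subst (ℕ._≤ s)
          (≡.trans (==⇒≡ eq) (start-at-cut X x cut)) (start≤ X s)))

  Unsplittable : (ℕ → Bool) → ℕ → ℕ → Set ℓ₂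
  Unsplittable X i x = ¬ (1# ≤ pre X i (start X x) x) ⊎ ¬ (1# ≤ suf X i (start X x) x)

  -- A further cut can only shrink the parts on either side of `x`. A point rejected once stays
  -- rejected within the level, so a single sweep per level suffices.
  unsplittable-refine : ∀ {X X′} → (∀ x → X x ≡ true → X′ x ≡ true) →
    ∀ i x → Unsplittable X i x → Unsplittable X′ i x
  unsplittable-refine {X} {X′} X⊆X′ i x = λ where
      (inj₁ ¬1≤pre) → inj₁ λ 1≤pre′ → ¬1≤pre (≤-trans 1≤pre′ (∑-[]-mono i λ s _ → finer s _))
      (inj₂ ¬1≤suf) → inj₂ λ 1≤suf′ → ¬1≤suf (≤-trans 1≤suf′ (∑-[]-mono i λ s _ → finer s _))
    where
    finer : ∀ s b → (start X′ s == start X′ x) ∧ b ≡ true → (start X s == start X x) ∧ b ≡ true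
    finer s b eq = let p , q = ∧-true {start X′ s == start X′ x} eq in
      ∧-intro (≡⇒== (start-refine X⊆X′ s x (==⇒≡ p))) q

  -- Move `x` down from `T` as long as the part before `x` weighs at least 1; the part from `x` on
  -- then stays lighter than 1. Where this stops, the part before `x`, the knapsack `x` and the part
  -- after it are all lighter than 1.
  unsplittable⇒mass<3 : ∀ X i → (∀ x → x ℕ.< T → Unsplittable X i x) → ∀ p → mass X i p < three
  unsplittable⇒mass<3 X i uns p = search T ℕ.≤-refl λ 1≤rest → <⇒≱ 0<1 (≤-respʳ-≈ (∑-[]-zero i tail) 1≤rest)
    where
    tail : ∀ s → s ℕ.< T → (start X s == p) ∧ (T ≤ᵇ s) ≡ false
    tail s s<T rewrite ≰⇒≤ᵇ s<T with start X s == p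
    ... | true  = ≡.refl
    ... | false = ≡.refl

    pre-zero : pre X i p 0 ≈ 0#
    pre-zero = ∑-[]-zero i λ s _ → lemma s
      where
      lemma : ∀ s → (start X s == p) ∧ false ≡ false
      lemma s with start X s == p
      ... | true  = ≡.refl
      ... | false = ≡.refl

    pre-suc : ∀ x → x ℕ.< T → pre X i p (suc x) ≤ pre X i p x + 1#
    pre-suc x x<T = begin
      pre X i p (suc x)                          ≤⟨ ∑-mono T pointwise ⟩
      ∑ T (λ s → [ (start X s == p) ∧ (suc s ≤ᵇ x) ] weight i s + [ s == x ] 1#) ≈⟨ ∑-+ T _ _ ⟩
      pre X i p x + ∑ T (λ s → [ s == x ] 1#)    ≤⟨ +-monoʳ-≤ _ (∑-unique T (_== x) 0≤1
                                                     λ s t _ _ p q → ≡.trans (==⇒≡ p) (≡.sym (==⇒≡ q))) ⟩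
      pre X i p x + 1#                           ∎
      where
      pointwise : ∀ s → s ℕ.< T → [ (start X s == p) ∧ (suc s ≤ᵇ suc x) ] weight i s
        ≤ [ (start X s == p) ∧ (suc s ≤ᵇ x) ] weight i s + [ s == x ] 1#
      pointwise s s<T with start X s == p | s ℕ.≟ x
      ... | false | _ = ≤-respʳ-≈ (sym (+-identityˡ _)) ([]-nonNeg (s == x) 0≤1)
      ... | true  | yes ≡.refl rewrite ≤⇒≤ᵇ (ℕ.≤-refl {suc s}) | ≰⇒≤ᵇ (ℕ.n<1+n s) | ≡⇒== {s} ≡.refl =
            ≤-respʳ-≈ (sym (+-identityˡ _)) (proj₁ (weight<1 i s s<T))
      ... | true  | no s≢x with suc s ≤ᵇ suc x in eq
      ...   | false = +-nonNeg ([]-nonNeg (suc s ≤ᵇ x) (weight≥0 i s s<T)) ([]-nonNeg (s == x) 0≤1)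
      ...   | true rewrite ≤⇒≤ᵇ (ℕ.≤∧≢⇒< (ℕ.≤-pred (≤ᵇ⇒≤ {suc s} eq)) s≢x) = x≤x+y ([]-nonNeg (s == x) 0≤1)

    apart : ∀ {m b} → m ≢ p → (m == p) ∧ b ≡ false
    apart m≢p rewrite ≢⇒== m≢p = ≡.refl

    -- For `x` inside the cell this is unsplittability. If `x` lies left of the cell, its prefix is
    -- empty; if right of it, its suffix is.
    light-suf : ∀ x → x ℕ.< T → 1# ≤ pre X i p x → ¬ (1# ≤ suf X i p x)
    light-suf x x<T 1≤pre 1≤suf with ℕ.<-cmp (start X x) p
    ... | tri≈ _ ≡.refl _ with uns x x<T
    ...   | inj₁ ¬1≤pre = ¬1≤pre 1≤pre
    ...   | inj₂ ¬1≤suf = ¬1≤suf 1≤suf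
    light-suf x x<T 1≤pre 1≤suf | tri< sx<p _ _ = <⇒≱ 0<1 (≤-respʳ-≈ (∑-[]-zero i λ s _ → outside s) 1≤pre)
      where
      outside : ∀ s → (start X s == p) ∧ (suc s ≤ᵇ x) ≡ false
      outside s with suc s ℕ.≤? x
      ... | yes s<x = apart (ℕ.<⇒≢ (ℕ.≤-<-trans (start-mono X (ℕ.<⇒≤ s<x)) sx<p))
      ... | no s≮x rewrite ≰⇒≤ᵇ (ℕ.≰⇒> s≮x) with start X s == p
      ...   | true  = ≡.refl
      ...   | false = ≡.refl
    light-suf x x<T 1≤pre 1≤suf | tri> _ _ p<sx = <⇒≱ 0<1 (≤-respʳ-≈ (∑-[]-zero i λ s _ → outside s) 1≤suf)
      where
      outside : ∀ s → (start X s == p) ∧ (x ≤ᵇ s) ≡ false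
      outside s with x ℕ.≤? s
      ... | yes x≤s = apart (ℕ.>⇒≢ (ℕ.<-≤-trans p<sx (start-mono X x≤s)))
      ... | no x≰s rewrite ≰⇒≤ᵇ (ℕ.≰⇒> x≰s) with start X s == p
      ...   | true  = ≡.refl
      ...   | false = ≡.refl

    bound : ∀ x → pre X i p x ≤ 1# + 1# → ¬ (1# ≤ suf X i p x) → mass X i p < three
    bound x pre≤2 ¬1≤suf = begin-strict
      mass X i p                ≈⟨ pre+suf X i p x ⟩
      pre X i p x + suf X i p x <⟨ +-mono-≤-< pre≤2 (≰⇒> ¬1≤suf) ⟩
      (1# + 1#) + 1#            ≈⟨ +-assoc 1# 1# 1# ⟩
      three                     ∎

    search : ∀ x → x ℕ.≤ T → ¬ (1# ≤ suf X i p x) → mass X i p < three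
    search zero    _   ¬1≤suf = bound 0 (≤-respˡ-≈ (sym pre-zero) (+-nonNeg 0≤1 0≤1)) ¬1≤suf
    search (suc x) x<T ¬1≤suf with 1# ≤? pre X i p x
    ... | yes 1≤pre = search x (ℕ.<⇒≤ x<T) (light-suf x x<T 1≤pre)
    ... | no ¬1≤pre = bound (suc x) (≤-trans (pre-suc x x<T) (+-monoˡ-≤ 1# (proj₁ (≰⇒> ¬1≤pre)))) ¬1≤suf

  Heavy : (ℕ → Bool) → ℕ → Set ℓ₂
  Heavy X i = ∀ p → X p ≡ true → 1# ≤ mass X i p

  -- Only two cells are new: the one starting at `z` is the old right part, the one starting at
  -- `start X z` the old left part. Both weigh at least 1 by assumption.
  heavy-split : ∀ {X X′} z → X′ z ≡ true → (∀ x → x ≢ z → X′ x ≡ X x) → ∀ i →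
    1# ≤ pre X i (start X z) z → 1# ≤ suf X i (start X z) z → Heavy X i → Heavy X′ i
  heavy-split {X} {X′} z cut same i 1≤pre 1≤suf heavy p X′p with p ℕ.≟ z
  ... | yes ≡.refl = ≤-trans 1≤suf (∑-[]-mono i λ s _ → right s)
    where
    right : ∀ s → (start X s == start X z) ∧ (z ≤ᵇ s) ≡ true → (start X′ s == z) ≡ true
    right s eq with ∧-true {start X s == start X z} eq
    ... | e , z≤s with start-above z cut same s (≤ᵇ⇒≤ z≤s)
    ...   | inj₁ (_ , e′) = ≡⇒== e′
    ...   | inj₂ (z<s , _) = contradiction (≡.subst (z ℕ.<_) (==⇒≡ e) z<s) (ℕ.≤⇒≯ (start≤ X z))
  ... | no p≢z with p ℕ.≟ start X z
  ...   | yes ≡.refl = ≤-trans 1≤pre (∑-[]-mono i λ s _ → left s)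
    where
    left : ∀ s → (start X s == start X z) ∧ (suc s ≤ᵇ z) ≡ true → (start X′ s == start X z) ≡ true
    left s eq with ∧-true {start X s == start X z} eq
    ... | e , s<z = ≡⇒== (≡.trans (start-below z cut same s (≤ᵇ⇒≤ s<z)) (==⇒≡ e))
  ...   | no p≢start = ≤-trans (heavy p (≡.trans (≡.sym (same p p≢z)) X′p)) (∑-[]-mono i λ s _ → other s)
    where
    other : ∀ s → (start X s == p) ≡ true → (start X′ s == p) ≡ true
    other s eq with suc s ℕ.≤? z
    ... | yes s<z = ≡⇒== (≡.trans (start-below z cut same s s<z) (==⇒≡ eq))
    ... | no s≮z with start-above z cut same s (ℕ.≮⇒≥ s≮z)
    ...   | inj₁ (e , _) = contradiction (≡.trans (≡.sym (==⇒≡ eq)) e) p≢start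
    ...   | inj₂ (_ , e) = ≡⇒== (≡.trans e (==⇒≡ eq))

  -- No mark lies strictly between 0 and the mark of the current stage, so lowering the threshold by
  -- one for the next stage admits no new cut.
  Recorded : (ℕ → ℕ) → ℕ → Set
  Recorded f τ = ∀ x → f x ≡ 0 ⊎ τ ℕ.≤ f x

  data Split (f f′ : ℕ → ℕ) (τ i x : ℕ) : Set (c ⊔ ℓ₁ ⊔ ℓ₂) where
    kept : Unsplittable (Cut f τ) i x → f′ ≡ f → Split f f′ τ i x
    divided : 1# ≤ pre (Cut f τ) i (start (Cut f τ) x) x → 1# ≤ suf (Cut f τ) i (start (Cut f τ) x) x →
           f′ ≡ f [ x ↦ τ ] → Split f f′ τ i x

  split-view : ∀ f τ i x → Split f (split τ (level i) x f) τ i x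
  split-view f τ i x with leq one (before X (level i) x) in eq₁ | leq one (after X (level i) x) in eq₂
    where X = Cut f τ
  ... | true | true = divided
    (≤-respˡ-≈ one≈1 (≤-respʳ-≈ (before≈pre _ i x) (Scale.leq⇒≤ σW eq₁)))
    (≤-respˡ-≈ one≈1 (≤-respʳ-≈ (after≈suf _ i x) (Scale.leq⇒≤ σW eq₂))) ≡.refl
  ... | true | false = kept (inj₂ λ 1≤suf → Scale.leq⇒≰ σW eq₂
    (≤-respˡ-≈ (sym one≈1) (≤-respʳ-≈ (sym (after≈suf _ i x)) 1≤suf))) ≡.refl
  ... | false | _ = kept (inj₁ λ 1≤pre → Scale.leq⇒≰ σW eq₁
    (≤-respˡ-≈ (sym one≈1) (≤-respʳ-≈ (sym (before≈pre _ i x)) 1≤pre))) ≡.refl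

  Cut-new : ∀ f τ x → Cut (f [ x ↦ τ ]) τ x ≡ true
  Cut-new f τ x rewrite update-same f x τ = ≤⇒≤ᵇ (ℕ.≤-refl {τ})

  Cut-old : ∀ f τ′ τ x z → z ≢ x → Cut (f [ x ↦ τ′ ]) τ z ≡ Cut f τ z
  Cut-old f τ′ τ x z z≢x rewrite update-other f {x} {z} τ′ z≢x = ≡.refl

  Cut-mono : ∀ f τ x z → Cut f τ z ≡ true → Cut (f [ x ↦ τ ]) τ z ≡ true
  Cut-mono f τ x z eq with z ℕ.≟ x
  ... | yes ≡.refl = Cut-new f τ x
  ... | no z≢x     = ≡.trans (Cut-old f τ τ x z z≢x) eq

  record Stage (f : ℕ → ℕ) (τ i n : ℕ) : Set (c ⊔ ℓ₁ ⊔ ℓ₂) where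
    field
      recorded     : Recorded f τ
      heavy        : Heavy (Cut f τ) i
      unsplittable : ∀ x → x ℕ.< n → Unsplittable (Cut f τ) i x

  stage-step : ∀ {f τ i n} → Stage f τ i n → Stage (split τ (level i) n f) τ i (suc n)
  stage-step {f} {τ} {i} {n} st with split τ (level i) n f | split-view f τ i n
  ... | _ | kept uns ≡.refl = record { Stage st ; unsplittable = extend }
    where
    extend : ∀ x → x ℕ.< suc n → Unsplittable (Cut f τ) i x
    extend x x<1+n with x ℕ.≟ n
    ... | yes ≡.refl = uns
    ... | no x≢n     = Stage.unsplittable st x (ℕ.≤∧≢⇒< (ℕ.<⇒≤pred x<1+n) x≢n)
  ... | _ | divided 1≤pre 1≤suf ≡.refl = record
    { recorded     = rec
    ; heavy        = heavy-split n (Cut-new f τ n) (Cut-old f τ τ n) i 1≤pre 1≤suf (Stage.heavy st)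
    ; unsplittable = extend
    }
    where
    rec : Recorded (f [ n ↦ τ ]) τ
    rec x with x ℕ.≟ n
    ... | yes ≡.refl = inj₂ (ℕ.≤-reflexive (≡.sym (update-same f n τ)))
    ... | no x≢n     rewrite update-other f τ x≢n = Stage.recorded st x

    extend : ∀ x → x ℕ.< suc n → Unsplittable (Cut (f [ n ↦ τ ]) τ) i x
    extend x x<1+n with x ℕ.≟ n
    -- The point has just become the start of a cell, so nothing precedes it there.
    ... | yes ≡.refl = inj₁ λ 1≤pre′ → <⇒≱ 0<1 (≤-respʳ-≈ (pre-at-cut i (Cut-new f τ n)) 1≤pre′)
    ... | no x≢n     = unsplittable-refine (Cut-mono f τ n) i x
                         (Stage.unsplittable st x (ℕ.≤∧≢⇒< (ℕ.<⇒≤pred x<1+n) x≢n))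

  next-stage : ∀ {f τ i n} → 0 ℕ.< τ → Stage f (suc τ) i n → Stage f τ (suc i) 0
  next-stage {f} {τ} {i} 0<τ st = record
    { recorded     = λ x → Sum′.map₂ ℕ.<⇒≤ (Stage.recorded st x)
    ; heavy        = λ p cut → ≤-trans (Stage.heavy st p (≡.trans (≡.sym (same p)) cut))
                       (≤-trans (mass-level-mono _ i p) (≤-reflexive (mass-cong (λ x → ≡.sym (same x)) (suc i) p)))
    ; unsplittable = λ x ()
    }
    where
    same : ∀ x → Cut f τ x ≡ Cut f (suc τ) x
    same x with Stage.recorded st x
    -- An uncut point has mark 0, which stays below the threshold as long as `τ` is positive; this
    -- is why marks run from `T` down to 1.
    ... | inj₁ eq rewrite eq = ≰⇒≤ᵇ 0<τ
    ... | inj₂ le = ≡.trans (≤⇒≤ᵇ (ℕ.<⇒≤ le)) (≡.sym (≤⇒≤ᵇ le))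

  stage : ∀ i → i ℕ.< T → Stage (cutTime (suc i)) (T ∸ i) (suc i) T
  stage i i<T = loop-invariant (λ n f → Stage f (T ∸ i) (suc i) n) T (initial i i<T) λ n f _ → stage-step
    where
    initial : ∀ i → i ℕ.< T → Stage (cutTime i) (T ∸ i) (suc i) 0
    initial zero    0<T = record
      { recorded = λ x → inj₁ ≡.refl
      ; heavy = λ p cut → contradiction (≤ᵇ⇒≤ {T} cut) (ℕ.<⇒≱ 0<T)
      ; unsplittable = λ x () }
    initial (suc i) 1+i<T = next-stage (ℕ.m<n⇒0<n∸m 1+i<T)
      (≡.subst (λ τ → Stage (cutTime (suc i)) τ (suc i) T) (ℕ.+-∸-assoc 1 (ℕ.<⇒≤ 1+i<T)) (stage i (ℕ.<⇒≤ 1+i<T)))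

  -- Later stages only add cuts with smaller time stamps.
  private
    split-later : ∀ {τ τ′} → τ′ ℕ.< τ → ∀ i x f z → Cut (split τ′ (level i) x f) τ z ≡ Cut f τ z
    split-later {τ} {τ′} τ′<τ i x f z with split τ′ (level i) x f | split-view f τ′ i x
    ... | _ | kept _ ≡.refl = ≡.refl
    ... | _ | divided 1≤pre _ ≡.refl with z ℕ.≟ x
    ...   | no z≢x     = Cut-old f τ′ τ x z z≢x
    ...   | yes ≡.refl rewrite update-same f x τ′ = ≡.trans (≰⇒≤ᵇ τ′<τ) (≡.sym (≰⇒≤ᵇ (ℕ.<-trans uncut τ′<τ)))
      where
      -- A cut point has an empty left part, so it is never divided again and its mark is never
      -- lowered.
      uncut : f x ℕ.< τ′
      uncut with τ′ ℕ.≤? f x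
      ... | no τ′≰fx  = ℕ.≰⇒> τ′≰fx
      ... | yes τ′≤fx = contradiction (≤-respʳ-≈ (pre-at-cut i (≤⇒≤ᵇ τ′≤fx)) 1≤pre) (<⇒≱ 0<1)

    cut-later : ∀ k i → i ℕ.< T → i ℕ.< k → k ℕ.≤ T → ∀ z → Cut (cutTime k) (T ∸ i) z ≡ Cut (cutTime (suc i)) (T ∸ i) z
    cut-later (suc k) i i<T i<1+k k<T z with i ℕ.≟ k
    ... | yes ≡.refl = ≡.refl
    ... | no i≢k = ≡.trans
      (loop-invariant (λ _ f → Cut f (T ∸ i) z ≡ Cut (cutTime k) (T ∸ i) z) T ≡.refl
        λ x f _ eq → ≡.trans (split-later (ℕ.∸-monoʳ-< i<k (ℕ.<⇒≤ k<T)) (suc k) x f z) eq)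
      (cut-later k i i<T i<k (ℕ.<⇒≤ k<T) z)
      where
      i<k : i ℕ.< k
      i<k = ℕ.≤∧≢⇒< (ℕ.<⇒≤pred i<1+k) i≢k

    CutAt-stage : ∀ τ → 0 ℕ.< τ → τ ℕ.≤ T → let i = T ∸ τ in
      i ℕ.< T × T ∸ i ≡ τ × (∀ z → CutAt τ z ≡ Cut (cutTime (suc i)) (T ∸ i) z)
    CutAt-stage τ 0<τ τ≤T = i<T , eq ,
      λ z → ≡.trans (≡.cong (λ t → CutAt t z) (≡.sym eq)) (cut-later T (T ∸ τ) i<T i<T ℕ.≤-refl z)
      where
      i<T : T ∸ τ ℕ.< T
      i<T = ℕ.∸-monoʳ-< 0<τ τ≤T
      eq : T ∸ (T ∸ τ) ≡ τ
      eq = ℕ.m∸[m∸n]≡n τ≤T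

  -- Stage `T ∸ τ` sets the mark `τ`, and stage `i` works with level `suc i` because level 0 selects
  -- nothing.
  clock : ℕ → ℕ
  clock τ = suc (T ∸ τ)

  mass<3 : ∀ τ → 0 ℕ.< τ → τ ℕ.≤ T → ∀ p → mass (CutAt τ) (clock τ) p < three
  mass<3 τ 0<τ τ≤T p with CutAt-stage τ 0<τ τ≤T
  ... | i<T , _ , same = begin-strict
    mass (CutAt τ) (clock τ) p ≈⟨ mass-cong same (clock τ) p ⟩
    mass _ (clock τ) p         <⟨ unsplittable⇒mass<3 _ (clock τ) (Stage.unsplittable (stage (T ∸ τ) i<T)) p ⟩
    three                      ∎

  mass≥1 : ∀ τ → 0 ℕ.< τ → τ ℕ.≤ T → ∀ p → CutAt τ p ≡ true → 1# ≤ mass (CutAt τ) (clock τ) p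
  mass≥1 τ 0<τ τ≤T p cut with CutAt-stage τ 0<τ τ≤T
  ... | i<T , _ , same = ≤-respʳ-≈ (sym (mass-cong same (clock τ) p))
    (Stage.heavy (stage (T ∸ τ) i<T) p (≡.trans (≡.sym (same p)) cut))

-- Local-ratio choice of the knapsacks.

module RoundingProperties {a c ℓ₁ ℓ₂} {O : Ops a} {F : OrderedField c ℓ₁ ℓ₂} {T : ℕ} (S : Setup O F T) where
  open Setup S
  open Cells S public
  open Rounding K public

  true-or-false : ∀ b → b ≡ true ⊎ b ≡ false
  true-or-false true  = inj₁ ≡.refl
  true-or-false false = inj₂ ≡.refl

  picked : (ℕ → ℕ) → ℕ → Bool
  picked P s = 1 ≤ᵇ P s

  inCell-parts : ∀ τ p s → inCell τ p s ≡ true →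
    start (CutAt τ) s ≡ p × above (clock τ) s ≡ true × leq (W s) null ≡ false
  inCell-parts τ p s eq with ∧-true {start (CutAt τ) s == p} eq
  ... | e₁ , e₂ with ∧-true {above (clock τ) s} e₂
  ... | e₃ , e₄ = ==⇒≡ e₁ , e₃ , not-true e₄

  inCell-intro : ∀ τ p s → start (CutAt τ) s ≡ p → above (clock τ) s ≡ true → leq (W s) null ≡ false →
    inCell τ p s ≡ true
  inCell-intro τ p s e₁ e₂ e₃ = ∧-intro (≡⇒== e₁) (∧-intro e₂ (≡.cong not e₃))

  cell-weight : ∀ τ p → ∑ T (λ s → [ inCell τ p s ] w s) ≈ mass (CutAt τ) (clock τ) p
  cell-weight τ p = ∑-cong T pointwise
    where
    pointwise : ∀ s → s ℕ.< T → [ inCell τ p s ] w s ≈ [ start (CutAt τ) s == p ] weight (clock τ) s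
    pointwise s s<T with start (CutAt τ) s == p | above (clock τ) s | leq (W s) null in eq
    ... | false | _     | _     = refl
    ... | true  | false | _     = refl
    ... | true  | true  | false = refl
    ... | true  | true  | true  = antisym (W≥0 s s<T) (≤-respʳ-≈ (Scale.ι-null σW) (Scale.leq⇒≤ σW eq))

  above-mono : ∀ {i j} s → s ℕ.< T → i ℕ.≤ j → above i s ≡ true → above j s ≡ true
  above-mono {i} {j} s s<T i≤j eq = ≡.subst (λ j → above j s ≡ true) (ℕ.m∸n+n≡m i≤j) (go (j ∸ i))
    where
    go : ∀ d → above (d ℕ.+ i) s ≡ true
    go zero    = eq
    go (suc d) = above-step (d ℕ.+ i) s s<T (go d)

  -- The partition of `τ₀` refines that of `τ₂`, which puts `s` between the same cuts as `t`.
  -- Membership at `τ₁`, whose capacity level is at least as high, certifies that `s` is large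
  -- enough.
  shared-cell : ∀ τ₀ τ₁ τ₂ p₀ p₁ p₂ s t → s ℕ.< T → τ₀ ℕ.≤ τ₂ → τ₂ ℕ.≤ τ₁ →
    inCell τ₀ p₀ s ≡ true → inCell τ₀ p₀ t ≡ true → inCell τ₁ p₁ s ≡ true → inCell τ₂ p₂ t ≡ true →
    inCell τ₂ p₂ s ≡ true
  shared-cell τ₀ τ₁ τ₂ p₀ p₁ p₂ s t s<T τ₀≤τ₂ τ₂≤τ₁ s₀ t₀ s₁ t₂
    with inCell-parts τ₀ p₀ s s₀ | inCell-parts τ₀ p₀ t t₀ | inCell-parts τ₁ p₁ s s₁ | inCell-parts τ₂ p₂ t t₂
  ... | es , _ , _ | et , _ , _ | _ , ab , fr | ep , _ , _ = inCell-intro τ₂ p₂ s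
    (≡.trans (start-refine {CutAt τ₂} {CutAt τ₀} (λ x cut → ≤⇒≤ᵇ (ℕ.≤-trans τ₀≤τ₂ (≤ᵇ⇒≤ {τ₂} cut))) s t (≡.trans es (≡.sym et))) ep)
    (above-mono s s<T (s≤s (ℕ.∸-monoʳ-≤ T τ₂≤τ₁)) ab) fr

  NonNeg : (ℕ → Number) → Set ℓ₂
  NonNeg k = ∀ s → s ℕ.< T → 0# ≤ ιK (k s)

  -- The index is genuine: a cell that starts at a cut weighs at least 1 and so cannot be empty.
  cheapest-spec : ∀ τ p k → 0 ℕ.< τ → τ ℕ.≤ T → CutAt τ p ≡ true →
    let t = cheapest τ p k ∸ 1 in
    t ℕ.< T × inCell τ p t ≡ true × (∀ s → s ℕ.< T → inCell τ p s ≡ true → ιK (k t) ≤ ιK (k s))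
  cheapest-spec τ p k 0<τ τ≤T isCut with loop-invariant Q T (inj₁ (≡.refl , λ s ())) step
    where
    Q : ℕ → ℕ → Set ℓ₂
    Q n b = (b ≡ 0 × ∀ s → s ℕ.< n → inCell τ p s ≡ false) ⊎ (1 ℕ.≤ b × b ∸ 1 ℕ.< T × inCell τ p (b ∸ 1) ≡ true
      × (∀ s → s ℕ.< n → inCell τ p s ≡ true → ιK (k (b ∸ 1)) ≤ ιK (k s)))

    step : ∀ n b → n ℕ.< T → Q n b →
      Q (suc n) (if inCell τ p n ∧ not ((1 ≤ᵇ b) ∧ leq (k (b ∸ 1)) (k n)) then suc n else b)
    step n b n<T q with inCell τ p n in eq
    step n b n<T (inj₁ (≡.refl , none)) | false = inj₁ (≡.refl , extend)
      where
      extend : ∀ s → s ℕ.< suc n → inCell τ p s ≡ false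
      extend s s<1+n with s ℕ.≟ n
      ... | yes ≡.refl = eq
      ... | no s≢n     = none s (ℕ.≤∧≢⇒< (ℕ.<⇒≤pred s<1+n) s≢n)
    step n b n<T (inj₂ (1≤b , b<T , inb , low)) | false = inj₂ (1≤b , b<T , inb , extend)
      where
      extend : ∀ s → s ℕ.< suc n → inCell τ p s ≡ true → ιK (k (b ∸ 1)) ≤ ιK (k s)
      extend s s<1+n ins with s ℕ.≟ n
      ... | yes ≡.refl = contradiction (≡.trans (≡.sym ins) eq) λ ()
      ... | no s≢n     = low s (ℕ.≤∧≢⇒< (ℕ.<⇒≤pred s<1+n) s≢n) ins
    step n b n<T (inj₁ (≡.refl , none)) | true = inj₂ (s≤s z≤n , n<T , eq , extend)
      where
      extend : ∀ s → s ℕ.< suc n → inCell τ p s ≡ true → ιK (k n) ≤ ιK (k s)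
      extend s s<1+n ins with s ℕ.≟ n
      ... | yes ≡.refl = ≤-refl
      ... | no s≢n     = contradiction (≡.trans (≡.sym ins) (none s (ℕ.≤∧≢⇒< (ℕ.<⇒≤pred s<1+n) s≢n))) λ ()
    step n b n<T (inj₂ (1≤b , b<T , inb , low)) | true rewrite ≤⇒≤ᵇ 1≤b with leq (k (b ∸ 1)) (k n) in eq′
    ... | true  = inj₂ (1≤b , b<T , inb , extend)
      where
      extend : ∀ s → s ℕ.< suc n → inCell τ p s ≡ true → ιK (k (b ∸ 1)) ≤ ιK (k s)
      extend s s<1+n ins with s ℕ.≟ n
      ... | yes ≡.refl = Scale.leq⇒≤ σK eq′
      ... | no s≢n     = low s (ℕ.≤∧≢⇒< (ℕ.<⇒≤pred s<1+n) s≢n) ins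
    ... | false = inj₂ (s≤s z≤n , n<T , eq , extend)
      where
      extend : ∀ s → s ℕ.< suc n → inCell τ p s ≡ true → ιK (k n) ≤ ιK (k s)
      extend s s<1+n ins with s ℕ.≟ n
      ... | yes ≡.refl = ≤-refl
      ... | no s≢n     = ≤-trans (proj₁ (≰⇒> (Scale.leq⇒≰ σK eq′))) (low s (ℕ.≤∧≢⇒< (ℕ.<⇒≤pred s<1+n) s≢n) ins)
  ... | inj₂ (_ , t<T , int , low) = t<T , int , low
  ... | inj₁ (_ , none) = contradiction 1≤0 (<⇒≱ 0<1)
    where
    1≤0 : 1# ≤ 0#
    1≤0 = begin
      1#                                  ≤⟨ mass≥1 τ 0<τ τ≤T p isCut ⟩
      mass (CutAt τ) (clock τ) p          ≈⟨ cell-weight τ p ⟨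
      ∑ T (λ s → [ inCell τ p s ] w s)    ≈⟨ ∑-cong T (λ s s<T → reflexive (≡.cong ([_] w s) (none s s<T))) ⟩
      ∑ T (λ _ → 0#)                      ≈⟨ ∑-zero T ⟩
      0#                                  ∎

  record Reduction (τ p : ℕ) (k k′ : ℕ → Number) : Set (c ⊔ ℓ₁ ⊔ ℓ₂) where
    field
      t      : ℕ
      t<T    : t ℕ.< T
      t∈cell : inCell τ p t ≡ true
      δ≥0    : 0# ≤ ιK (k t)
      cost-t : ιK (k′ t) ≈ 0#
      costs  : ∀ s → s ℕ.< T → ιK (k s) ≈ ιK (k′ s) + [ inCell τ p s ] ιK (k t)

  reduction : ∀ τ p k → 0 ℕ.< τ → τ ℕ.≤ T → CutAt τ p ≡ true → NonNeg k → Reduction τ p k (reduce τ p k)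
  reduction τ p k 0<τ τ≤T isCut k≥0 with cheapest-spec τ p k 0<τ τ≤T isCut
  ... | t<T , int , low = record
    { t = t ; t<T = t<T ; t∈cell = int ; δ≥0 = k≥0 t t<T
    ; cost-t = cost-t ; costs = costs }
    where
    t : ℕ
    t = cheapest τ p k ∸ 1
    cost-t : ιK (reduce τ p k t) ≈ 0#
    cost-t rewrite isCut | int | ≤⇒≤ᵇ t<T = trans (Scale.ι-minus σK (k t) (k t) ≤-refl) (-‿inverseʳ _)
    costs : ∀ s → s ℕ.< T → ιK (k s) ≈ ιK (reduce τ p k s) + [ inCell τ p s ] ιK (k t)
    costs s s<T rewrite isCut | ≤⇒≤ᵇ s<T with inCell τ p s in eq
    ... | true  = sym (trans (+-congʳ (Scale.ι-minus σK (k s) (k t) (low s s<T eq))) (x-y+y≈x _ _))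
    ... | false = sym (+-identityʳ _)

  reduce-nonNeg : ∀ τ p k → 0 ℕ.< τ → τ ℕ.≤ T → NonNeg k → NonNeg (reduce τ p k)
  reduce-nonNeg τ p k 0<τ τ≤T k≥0 s s<T rewrite ≤⇒≤ᵇ s<T with CutAt τ p in isCut
  ... | false = k≥0 s s<T
  ... | true with inCell τ p s in eq
  ...   | false = k≥0 s s<T
  ...   | true with cheapest-spec τ p k 0<τ τ≤T isCut
  ...     | _ , _ , low = ≤-respʳ-≈ (sym (Scale.ι-minus σK _ _ (low s s<T eq))) (x≤y⇒0≤y-x (low s s<T eq))

  rowCost-nonNeg : ∀ i → i ℕ.≤ T → NonNeg (rowCost i)
  cost-nonNeg : ∀ i p → i ℕ.< T → NonNeg (cost′ i p)
  rowCost-nonNeg zero    _   = K≥0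
  rowCost-nonNeg (suc i) i<T = cost-nonNeg i T i<T
  cost-nonNeg i p i<T = loop-invariant (λ _ k → NonNeg k) p (rowCost-nonNeg i (ℕ.<⇒≤ i<T))
    λ q k _ → reduce-nonNeg (suc i) q k (s≤s z≤n) i<T

  hit-spec : ∀ τ p P → (picked (λ _ → hit τ p P) 0 ≡ false × ∀ s → s ℕ.< T → inCell τ p s ≡ true → picked P s ≡ false)
    ⊎ (picked (λ _ → hit τ p P) 0 ≡ true × ∃ λ s → s ℕ.< T × inCell τ p s ≡ true × picked P s ≡ true)
  hit-spec τ p P = loop-invariant Q T (inj₁ (≡.refl , λ s ())) step
    where
    Q : ℕ → ℕ → Set
    Q n h = ((1 ≤ᵇ h) ≡ false × ∀ s → s ℕ.< n → inCell τ p s ≡ true → picked P s ≡ false)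
      ⊎ ((1 ≤ᵇ h) ≡ true × ∃ λ s → s ℕ.< T × inCell τ p s ≡ true × picked P s ≡ true)
    step : ∀ n h → n ℕ.< T → Q n h → Q (suc n) (if inCell τ p n ∧ (1 ≤ᵇ P n) then 1 else h)
    step n h n<T q with inCell τ p n in eq | 1 ≤ᵇ P n in eq′
    ... | true | true = inj₂ (≡.refl , n , n<T , eq , eq′)
    step n h n<T (inj₂ q) | true  | false = inj₂ q
    step n h n<T (inj₂ q) | false | _     = inj₂ q
    step n h n<T (inj₁ (h≡ , none)) | true | false = inj₁ (h≡ , extend)
      where
      extend : ∀ s → s ℕ.< suc n → inCell τ p s ≡ true → picked P s ≡ false
      extend s s<1+n ins with s ℕ.≟ n
      ... | yes ≡.refl = eq′
      ... | no s≢n     = none s (ℕ.≤∧≢⇒< (ℕ.<⇒≤pred s<1+n) s≢n) ins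
    step n h n<T (inj₁ (h≡ , none)) | false | _ = inj₁ (h≡ , extend)
      where
      extend : ∀ s → s ℕ.< suc n → inCell τ p s ≡ true → picked P s ≡ false
      extend s s<1+n ins with s ℕ.≟ n
      ... | yes ≡.refl = contradiction (≡.trans (≡.sym ins) eq) λ ()
      ... | no s≢n     = none s (ℕ.≤∧≢⇒< (ℕ.<⇒≤pred s<1+n) s≢n) ins

  -- Invariant of the picking pass. `unique` also covers the finer cells of rows still to come,
  -- because each of them will have to pay for its reduction at most once; `origin` keeps for every
  -- pick the evidence on its capacity that `shared-cell` asks for.
  record Rounded (τ : ℕ) (k : ℕ → Number) (P : ℕ → ℕ) : Set (c ⊔ ℓ₁ ⊔ ℓ₂) where
    field
      origin : ∀ s → picked P s ≡ true → s ℕ.< T × ∃ λ τ₁ → ∃ λ p₁ → τ ℕ.≤ τ₁ × inCell τ₁ p₁ s ≡ true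
      unique : ∀ τ₀ p₀ → τ₀ ℕ.≤ τ → ∀ s t → picked P s ≡ true → picked P t ≡ true →
               inCell τ₀ p₀ s ≡ true → inCell τ₀ p₀ t ≡ true → s ≡ t
      cheap  : ∑ T (λ s → [ picked P s ] ιK (k s)) ≤ ∑ T (λ s → w s * ιK (k s))

  weaken : ∀ {τ τ′ k P} → τ′ ℕ.≤ τ → Rounded τ k P → Rounded τ′ k P
  weaken τ′≤τ r = record
    { origin = λ s eq → let s<T , τ₁ , p₁ , τ≤τ₁ , ins = Rounded.origin r s eq in
                        s<T , τ₁ , p₁ , ℕ.≤-trans τ′≤τ τ≤τ₁ , ins
    ; unique = λ τ₀ p₀ τ₀≤τ′ → Rounded.unique r τ₀ p₀ (ℕ.≤-trans τ₀≤τ′ τ′≤τ)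
    ; cheap  = Rounded.cheap r
    }

  -- Local ratio: at most one pick pays δ in the cell, whereas the cell has fractional weight at least 1.
  pay : ∀ {τ p k k′ P P′} → 0 ℕ.< τ → τ ℕ.≤ T → CutAt τ p ≡ true → NonNeg k →
    (red : Reduction τ p k k′) →
    (∀ s t → picked P′ s ≡ true → picked P′ t ≡ true → inCell τ p s ≡ true → inCell τ p t ≡ true → s ≡ t) →
    (∀ s → s ≢ Reduction.t red → picked P′ s ≡ picked P s) →
    ∑ T (λ s → [ picked P s ] ιK (k′ s)) ≤ ∑ T (λ s → w s * ιK (k′ s)) →
    ∑ T (λ s → [ picked P′ s ] ιK (k s)) ≤ ∑ T (λ s → w s * ιK (k s))
  pay {τ} {p} {k} {k′} {P} {P′} 0<τ τ≤T isCut k≥0 red uniq same cheap = begin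
    ∑ T (λ s → [ picked P′ s ] ιK (k s))
      ≈⟨ ∑-cong T split-cost ⟩
    ∑ T (λ s → [ picked P s ] ιK (k′ s) + [ picked P′ s ∧ inCell τ p s ] δ)
      ≈⟨ ∑-+ T _ _ ⟩
    ∑ T (λ s → [ picked P s ] ιK (k′ s)) + ∑ T (λ s → [ picked P′ s ∧ inCell τ p s ] δ)
      ≤⟨ +-mono-≤ cheap (∑-unique T _ δ≥0 one-pick) ⟩
    ∑ T (λ s → w s * ιK (k′ s)) + δ
      ≈⟨ +-congˡ (*-identityʳ δ) ⟨
    ∑ T (λ s → w s * ιK (k′ s)) + δ * 1#
      ≤⟨ +-monoʳ-≤ _ (*-monoˡ-≤ δ≥0 (≤-respʳ-≈ (sym (cell-weight τ p)) (mass≥1 τ 0<τ τ≤T p isCut))) ⟩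
    ∑ T (λ s → w s * ιK (k′ s)) + δ * ∑ T (λ s → [ inCell τ p s ] w s)
      ≈⟨ +-congˡ (∑-*ˡ T δ _) ⟨
    ∑ T (λ s → w s * ιK (k′ s)) + ∑ T (λ s → δ * [ inCell τ p s ] w s)
      ≈⟨ ∑-+ T _ _ ⟨
    ∑ T (λ s → w s * ιK (k′ s) + δ * [ inCell τ p s ] w s)
      ≈⟨ ∑-cong T merge-cost ⟩
    ∑ T (λ s → w s * ιK (k s)) ∎
    where
    open Reduction red
    δ : Carrier
    δ = ιK (k t)

    split-cost : ∀ s → s ℕ.< T →
      [ picked P′ s ] ιK (k s) ≈ [ picked P s ] ιK (k′ s) + [ picked P′ s ∧ inCell τ p s ] δ
    split-cost s s<T = trans ([]-cong _ (costs s s<T)) (trans ([]-+ (picked P′ s) _ _)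
      (+-cong same-cost (reflexive (≡.sym ([]-∧ (picked P′ s) (inCell τ p s) δ)))))
      where
      vanish : ∀ b → ιK (k′ s) ≈ 0# → [ b ] ιK (k′ s) ≈ 0#
      vanish true  eq = eq
      vanish false eq = refl
      -- The two sets of picks can differ only at `t`, whose reduced cost is 0.
      same-cost : [ picked P′ s ] ιK (k′ s) ≈ [ picked P s ] ιK (k′ s)
      same-cost with s ℕ.≟ t
      ... | no s≢t     = reflexive (≡.cong ([_] ιK (k′ s)) (same s s≢t))
      ... | yes ≡.refl = trans (vanish (picked P′ s) cost-t) (sym (vanish (picked P s) cost-t))

    one-pick : ∀ s t → s ℕ.< T → t ℕ.< T → picked P′ s ∧ inCell τ p s ≡ true → picked P′ t ∧ inCell τ p t ≡ true → s ≡ t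
    one-pick s t _ _ es et = let ps , is = ∧-true {picked P′ s} es ; pt , it = ∧-true {picked P′ t} et in uniq s t ps pt is it

    merge-cost : ∀ s → s ℕ.< T → w s * ιK (k′ s) + δ * [ inCell τ p s ] w s ≈ w s * ιK (k s)
    merge-cost s s<T = trans (+-congˡ (trans ([]-*ˡ (inCell τ p s) δ (w s))
        (trans ([]-cong (inCell τ p s) (*-comm δ (w s))) (sym ([]-*ˡ (inCell τ p s) (w s) δ)))))
      (trans (sym (distribˡ (w s) _ _)) (*-congˡ (sym (costs s s<T))))

  -- `pick i p` is the instance with costs `cost′ i p`. Leaving the costs free lets the invariant be
  -- carried through a single reduction of any cost vector.
  choose : ℕ → ℕ → (ℕ → Number) → (ℕ → ℕ) → (ℕ → ℕ)
  choose τ p k P = if CutAt τ p ∧ not (1 ≤ᵇ hit τ p P) then P [ cheapest τ p k ∸ 1 ↦ 1 ] else P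

  choose-rounded : ∀ τ p k P → 0 ℕ.< τ → τ ℕ.≤ T → NonNeg k → Rounded τ (reduce τ p k) P → Rounded τ k (choose τ p k P)
  choose-rounded τ p k P 0<τ τ≤T k≥0 r with true-or-false (CutAt τ p)
  ... | inj₂ isFalse = ≡.subst (Rounded τ k)
    (≡.cong (λ b → if b ∧ not (1 ≤ᵇ hit τ p P) then P [ cheapest τ p k ∸ 1 ↦ 1 ] else P) (≡.sym isFalse))
    record { Rounded r ; cheap = begin
      ∑ T (λ s → [ picked P s ] ιK (k s))             ≈⟨ ∑-cong T (λ s _ → []-cong _ (same s)) ⟨
      ∑ T (λ s → [ picked P s ] ιK (reduce τ p k s))  ≤⟨ Rounded.cheap r ⟩
      ∑ T (λ s → w s * ιK (reduce τ p k s))           ≈⟨ ∑-cong T (λ s _ → *-congˡ (same s)) ⟩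
      ∑ T (λ s → w s * ιK (k s))                      ∎ }
    where
    same : ∀ s → ιK (reduce τ p k s) ≈ ιK (k s)
    same s rewrite isFalse = refl
  ... | inj₁ isCut = ≡.subst (Rounded τ k)
    (≡.cong (λ b → if b ∧ not (1 ≤ᵇ hit τ p P) then P [ cheapest τ p k ∸ 1 ↦ 1 ] else P) (≡.sym isCut)) go
    where
    red : Reduction τ p k (reduce τ p k)
    red = reduction τ p k 0<τ τ≤T isCut k≥0
    open Reduction red using (t; t<T; t∈cell)
    P′ : ℕ → ℕ
    P′ = P [ t ↦ 1 ]

    same : ∀ s → s ≢ t → picked P′ s ≡ picked P s
    same s s≢t = ≡.cong (1 ≤ᵇ_) (update-other P 1 s≢t)

    module _ (none : ∀ s → s ℕ.< T → inCell τ p s ≡ true → picked P s ≡ false) where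
      orig : ∀ s → picked P′ s ≡ true → s ℕ.< T × ∃ λ τ₁ → ∃ λ p₁ → τ ℕ.≤ τ₁ × inCell τ₁ p₁ s ≡ true
      orig s eq with s ℕ.≟ t
      ... | yes ≡.refl = t<T , τ , p , ℕ.≤-refl , t∈cell
      ... | no s≢t     = Rounded.origin r s (≡.trans (≡.sym (same s s≢t)) eq)

      -- An earlier pick sharing a lower cell with t would already have hit the cell of t.
      clash : ∀ τ₀ p₀ → τ₀ ℕ.≤ τ → ∀ s → picked P s ≡ true → inCell τ₀ p₀ s ≡ true → inCell τ₀ p₀ t ≡ true → picked P s ≡ false
      clash τ₀ p₀ τ₀≤τ s ps is it = let s<T , τ₁ , p₁ , τ≤τ₁ , is₁ = Rounded.origin r s ps in
        none s s<T (shared-cell τ₀ τ₁ τ p₀ p₁ p s t s<T τ₀≤τ τ≤τ₁ is it is₁ t∈cell)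

      uniq : ∀ τ₀ p₀ → τ₀ ℕ.≤ τ → ∀ s u → picked P′ s ≡ true → picked P′ u ≡ true →
             inCell τ₀ p₀ s ≡ true → inCell τ₀ p₀ u ≡ true → s ≡ u
      uniq τ₀ p₀ τ₀≤τ s u ps pu is iu with s ℕ.≟ t | u ℕ.≟ t
      ... | yes ≡.refl | yes ≡.refl = ≡.refl
      ... | no s≢t | no u≢t = Rounded.unique r τ₀ p₀ τ₀≤τ s u
              (≡.trans (≡.sym (same s s≢t)) ps) (≡.trans (≡.sym (same u u≢t)) pu) is iu
      ... | no s≢t | yes ≡.refl = contradiction (≡.trans (≡.sym old) (clash τ₀ p₀ τ₀≤τ s old is iu)) λ ()
        where old = ≡.trans (≡.sym (same s s≢t)) ps
      ... | yes ≡.refl | no u≢t = contradiction (≡.trans (≡.sym old) (clash τ₀ p₀ τ₀≤τ u old iu is)) λ ()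
        where old = ≡.trans (≡.sym (same u u≢t)) pu

    go : Rounded τ k (if not (1 ≤ᵇ hit τ p P) then P′ else P)
    go with 1 ≤ᵇ hit τ p P | hit-spec τ p P
    -- The cell is hit already. By `unique` it contains just one pick, so undoing the reduction is
    -- paid for without a new one.
    ... | true | inj₂ _ = record { Rounded r ; cheap = pay {P = P} {P′ = P} 0<τ τ≤T isCut k≥0
          red (Rounded.unique r τ p ℕ.≤-refl) (λ _ _ → ≡.refl) (Rounded.cheap r) }
    ... | false | inj₁ (_ , none) = record { origin = orig none ; unique = uniq none
          ; cheap = pay {P = P} {P′ = P′} 0<τ τ≤T isCut k≥0 red (uniq none τ p ℕ.≤-refl) same (Rounded.cheap r) }

  choose-mono : ∀ τ p k P s → picked P s ≡ true → picked (choose τ p k P) s ≡ true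
  choose-mono τ p k P s eq with CutAt τ p ∧ not (1 ≤ᵇ hit τ p P)
  ... | false = eq
  ... | true with s ℕ.≟ cheapest τ p k ∸ 1
  ...   | yes ≡.refl = ≡.cong (1 ≤ᵇ_) (update-same P s 1)
  ...   | no s≢t     = ≡.trans (≡.cong (1 ≤ᵇ_) (update-other P 1 s≢t)) eq

  Hit : ℕ → ℕ → (ℕ → ℕ) → Set
  Hit τ p P = CutAt τ p ≡ true → ∃ λ s → s ℕ.< T × inCell τ p s ≡ true × picked P s ≡ true

  choose-hit : ∀ τ p k P → 0 ℕ.< τ → τ ℕ.≤ T → Hit τ p (choose τ p k P)
  choose-hit τ p k P 0<τ τ≤T isCut rewrite isCut with 1 ≤ᵇ hit τ p P | hit-spec τ p P
  ... | true  | inj₂ (_ , h) = h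
  ... | false | inj₁ _ = let t<T , int , _ = cheapest-spec τ p k 0<τ τ≤T isCut in
        cheapest τ p k ∸ 1 , t<T , int , ≡.cong (1 ≤ᵇ_) (update-same P (cheapest τ p k ∸ 1) 1)

  hit-mono : ∀ τ p τ′ p′ k P → Hit τ p P → Hit τ p (choose τ′ p′ k P)
  hit-mono τ p τ′ p′ k P h isCut = let s , s<T , ins , ps = h isCut in
    s , s<T , ins , choose-mono τ′ p′ k P s ps

  final : ℕ → ℕ
  final = rowPick T

  private
    -- After `j` rows exactly their reductions have been undone, so the costs in force are
    -- `rowCost (T ∸ j)`; for `j = T` these are the original ones.
    Rows : ℕ → (ℕ → ℕ) → Set (c ⊔ ℓ₁ ⊔ ℓ₂)
    Rows j P = Rounded (suc (T ∸ j)) (rowCost (T ∸ j)) P × (∀ i p → T ∸ j ℕ.≤ i → i ℕ.< T → p ℕ.< T → Hit (suc i) p P)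

    Columns : ℕ → ℕ → (ℕ → ℕ) → Set (c ⊔ ℓ₁ ⊔ ℓ₂)
    Columns i q P = Rounded (suc i) (cost′ i (T ∸ q)) P
      × (∀ i′ p → i ℕ.< i′ → i′ ℕ.< T → p ℕ.< T → Hit (suc i′) p P) × (∀ p → T ∸ q ℕ.≤ p → p ℕ.< T → Hit (suc i) p P)

    column-step : ∀ i q P → i ℕ.< T → q ℕ.< T → Columns i q P → Columns i (suc q) (pick i (T ∸ suc q) P)
    column-step i q P i<T q<T (r , hits , hits′) =
        choose-rounded (suc i) p (cost′ i p) P (s≤s z≤n) i<T (cost-nonNeg i p i<T)
          (≡.subst (λ n → Rounded (suc i) (cost′ i n) P) eq r)
      , (λ i′ p′ i<i′ i′<T p′<T → hit-mono (suc i′) p′ (suc i) p (cost′ i p) P (hits i′ p′ i<i′ i′<T p′<T))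
      , row-hits
      where
      p : ℕ
      p = T ∸ suc q
      eq : T ∸ q ≡ suc p
      eq = ℕ.+-∸-assoc 1 q<T
      row-hits : ∀ p′ → p ℕ.≤ p′ → p′ ℕ.< T → Hit (suc i) p′ (pick i p P)
      row-hits p′ p≤p′ p′<T with p ℕ.≟ p′
      ... | yes ≡.refl = choose-hit (suc i) p (cost′ i p) P (s≤s z≤n) i<T
      ... | no p≢p′    = hit-mono (suc i) p′ (suc i) p (cost′ i p) P (hits′ p′ (≡.subst (ℕ._≤ p′) (≡.sym eq) (ℕ.≤∧≢⇒< p≤p′ p≢p′)) p′<T)

    row-step : ∀ j P → j ℕ.< T → Rows j P → Rows (suc j) (loop T (λ q → pick (T ∸ suc j) (T ∸ suc q)) P)
    row-step j P j<T (r , hits) with loop-invariant (Columns i) T first (λ q P q<T → column-step i q P i<T q<T)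
      where
      i : ℕ
      i = T ∸ suc j
      i<T : i ℕ.< T
      i<T = ℕ.∸-monoʳ-< (s≤s z≤n) j<T
      eq : T ∸ j ≡ suc i
      eq = ℕ.+-∸-assoc 1 j<T
      first : Columns i 0 P
      first = weaken (ℕ.n≤1+n (suc i)) (≡.subst (λ n → Rounded (suc n) (rowCost n) P) eq r)
        , (λ i′ p i<i′ → hits i′ p (≡.subst (ℕ._≤ i′) (≡.sym eq) i<i′))
        , λ p T≤p p<T → contradiction p<T (ℕ.≤⇒≯ T≤p)
    ... | r′ , hits₁ , hits₂ = ≡.subst (λ n → Rounded (suc (T ∸ suc j)) (cost′ (T ∸ suc j) n) (loop T (λ q → pick (T ∸ suc j) (T ∸ suc q)) P)) (ℕ.n∸n≡0 T) r′
        , all-hits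
      where
      all-hits : ∀ i p → T ∸ suc j ℕ.≤ i → i ℕ.< T → p ℕ.< T →
        Hit (suc i) p (loop T (λ q → pick (T ∸ suc j) (T ∸ suc q)) P)
      all-hits i p le i<T p<T with (T ∸ suc j) ℕ.≟ i
      ... | yes ≡.refl = hits₂ p (≡.subst (ℕ._≤ p) (≡.sym (ℕ.n∸n≡0 T)) z≤n) p<T
      ... | no ≢i      = hits₁ i p (ℕ.≤∧≢⇒< le ≢i) i<T p<T

    rows : ∀ j → j ℕ.≤ T → Rows j (rowPick j)
    rows zero    _   = record { origin = λ s () ; unique = λ τ₀ p₀ _ s t () ; cheap = empty }
      , λ i p T≤i i<T → contradiction i<T (ℕ.≤⇒≯ T≤i)
      where
      empty : ∑ T (λ s → 0#) ≤ ∑ T (λ s → w s * ιK (rowCost T s))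
      empty = ∑-mono T λ s s<T → *-nonNeg (W≥0 s s<T) (rowCost-nonNeg T ℕ.≤-refl s s<T)
    rows (suc j) j<T = row-step j (rowPick j) j<T (rows j (ℕ.<⇒≤ j<T))

  final-picks : ∀ s → picked final s ≡ true → s ℕ.< T × leq (W s) null ≡ false
  final-picks s eq = let s<T , τ , p , _ , ins = Rounded.origin (proj₁ (rows T ℕ.≤-refl)) s eq in
    s<T , proj₂ (proj₂ (inCell-parts τ p s ins))

  final-cheap : ∑ T (λ s → [ picked final s ] ιK (K s)) ≤ ∑ T (λ s → w s * ιK (K s))
  final-cheap = ≡.subst (λ n → ∑ T (λ s → [ picked final s ] ιK (rowCost n s)) ≤ ∑ T (λ s → w s * ιK (rowCost n s)))
    (ℕ.n∸n≡0 T) (Rounded.cheap (proj₁ (rows T ℕ.≤-refl)))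

  final-hits : ∀ i p → i ℕ.< T → p ℕ.< T → Hit (suc i) p final
  final-hits i p = proj₂ (rows T ℕ.≤-refl) i p (≡.subst (ℕ._≤ i) (≡.sym (ℕ.n∸n≡0 T)) z≤n)

-- Coverage of an interval by the picks.

module Coverage {a c ℓ₁ ℓ₂} {O : Ops a} {F : OrderedField c ℓ₁ ℓ₂} {T : ℕ} (S : Setup O F T) where
  open Setup S
  open RoundingProperties S public

  interval : ℕ → ℕ → ℕ → Bool
  interval x y s = (x ≤ᵇ s) ∧ (suc s ≤ᵇ y)

  -- Each index is counted once, at the start of its cell; this start is below `T` since it does not
  -- exceed the index.
  [start]-sum : ∀ X (f : ℕ → Carrier) → (∀ s → s ℕ.< T → 0# ≤ f s) →
    ∑ T f ≈ ∑ T (λ p → ∑ T (λ s → [ start X s == p ] f s))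
  [start]-sum X f f≥0 = trans (∑-cong T λ s s<T → sym (antisym
      (∑-unique T (start X s ==_) (f≥0 s s<T) λ p q _ _ e e′ → ≡.trans (≡.sym (==⇒≡ e)) (==⇒≡ e′))
      (≤-trans (≤-reflexive (reflexive (≡.cong ([_] f s) (≡.sym (≡⇒== {start X s} ≡.refl)))))
        (term≤∑ T {λ p → [ start X s == p ] f s} (λ p _ → []-nonNeg (start X s == p) (f≥0 s s<T)) (start X s) (ℕ.≤-<-trans (start≤ X s) s<T)))))
    (∑-swap T T λ s p → [ start X s == p ] f s)

  module _ {x y : ℕ} (x<y : x ℕ.< y) (y≤T : y ℕ.≤ T) where

    private
      I : ℕ → Bool
      I = interval x y

      x<T : x ℕ.< T
      x<T = ℕ.<-≤-trans x<y y≤T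

    module _ (i : ℕ) (i<T : i ℕ.< T) where
      private
        τ = T ∸ i
        X = CutAt τ
        j = suc i

        0<τ : 0 ℕ.< τ
        0<τ = ℕ.m<n⇒0<n∸m i<T

        clock-τ : clock τ ≡ j
        clock-τ = ≡.cong suc (ℕ.m∸[m∸n]≡n (ℕ.<⇒≤ i<T))

        light : ∀ p → mass X j p < three
        light p = ≡.subst (λ n → mass X n p < three) clock-τ (mass<3 τ 0<τ (ℕ.m∸n≤m T i) p)

        need have : ℕ → Carrier
        need s = [ I s ] weight j s
        have s = [ I s ] [ above j s ] [ picked final s ] three

        need≥0 : ∀ s → s ℕ.< T → 0# ≤ need s
        need≥0 s s<T = []-nonNeg (I s) (weight≥0 j s s<T)

        have≥0 : ∀ s → s ℕ.< T → 0# ≤ have s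
        have≥0 s s<T = []-nonNeg (I s) ([]-nonNeg (above j s) ([]-nonNeg (picked final s) 0≤three))

        -- The cells of `x` and `y` may stick out of the interval and have their pick outside it;
        -- `slack` grants each of them its whole weight bound 3.
        needIn haveIn slack : ℕ → Carrier
        needIn p = ∑ T λ s → [ start X s == p ] need s
        haveIn p = ∑ T λ s → [ start X s == p ] have s
        slack p  = [ p == start X x ] three + [ p == start X y ] three

        haveIn≥0 : ∀ p → 0# ≤ haveIn p
        haveIn≥0 p = ∑-nonNeg T λ s s<T → []-nonNeg (start X s == p) (have≥0 s s<T)

        slack≥0 : ∀ p → 0# ≤ slack p
        slack≥0 p = +-nonNeg ([]-nonNeg (p == start X x) 0≤three) ([]-nonNeg (p == start X y) 0≤three)

        needIn≤mass : ∀ p → needIn p ≤ mass X j p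
        needIn≤mass p = ∑-mono T λ s s<T → []-mono {start X s == p} (λ e → e) (weight≥0 j s s<T)
          ([]-mono {I s} {true} (λ _ → ≡.refl) (weight≥0 j s s<T) ≤-refl)

        needIn-zero : ∀ p → (∀ s → s ℕ.< T → start X s ≡ p → I s ≡ false) → needIn p ≈ 0#
        needIn-zero p out = trans (∑-cong T pointwise) (∑-zero T)
          where
          pointwise : ∀ s → s ℕ.< T → [ start X s == p ] need s ≈ 0#
          pointwise s s<T with start X s == p in eq
          ... | false = refl
          ... | true rewrite out s s<T (==⇒≡ eq) = refl

        three≤slackˣ : three ≤ slack (start X x)
        three≤slackˣ rewrite ≡⇒== {start X x} ≡.refl = x≤x+y ([]-nonNeg (start X x == start X y) 0≤three)

        three≤slackʸ : three ≤ slack (start X y)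
        three≤slackʸ rewrite ≡⇒== {start X y} ≡.refl = x≤y+x ([]-nonNeg (start X y == start X x) 0≤three)

        -- A `p` beyond `start X x` is positive, so it is a cut or no cell starts there. At a cut,
        -- `final-hits` supplies a pick. The cell lies inside the interval, so this pick counts with
        -- 3, which exceeds the weight of the cell.
        full-cell : ∀ p → start X x ℕ.< p → p ℕ.< start X y → needIn p ≤ haveIn p
        full-cell p x<p p<y with true-or-false (X p)
        ... | inj₂ isFalse = ≤-trans (≤-reflexive (needIn-zero p λ s _ eq → contradiction eq (off s))) (haveIn≥0 p)
          where
          off : ∀ s → start X s ≢ p
          off s eq with start-cut X s
          ... | inj₁ eq′ = contradiction (≡.trans (≡.sym eq) eq′) (ℕ.>⇒≢ (ℕ.≤-<-trans z≤n x<p))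
          ... | inj₂ isCut = contradiction (≡.trans (≡.sym isCut) (≡.trans (≡.cong X eq) isFalse)) λ ()
        ... | inj₁ isCut with final-hits (ℕ.pred τ) p pred<T p<T (≡.subst (λ t → CutAt t p ≡ true) (≡.sym suc-pred) isCut)
          where
          suc-pred : suc (ℕ.pred τ) ≡ τ
          suc-pred = ℕ.suc-pred τ {{ℕ.>-nonZero 0<τ}}
          pred<T : ℕ.pred τ ℕ.< T
          pred<T = ≡.subst (ℕ._≤ T) (≡.sym suc-pred) (ℕ.m∸n≤m T i)
          p<T : p ℕ.< T
          p<T = ℕ.<-≤-trans p<y (ℕ.≤-trans (start≤ X y) y≤T)
        ... | s , s<T , ins , ps with inCell-parts (suc (ℕ.pred τ)) p s ins
        ... | e₁ , e₂ , _ = begin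
          needIn p                       ≤⟨ needIn≤mass p ⟩
          mass X j p                     ≤⟨ proj₁ (light p) ⟩
          three                          ≈⟨ reflexive here ⟨
          [ start X s == p ] have s      ≤⟨ term≤∑ T (λ t t<T → []-nonNeg (start X t == p) (have≥0 t t<T)) s s<T ⟩
          haveIn p                       ∎
          where
          suc-pred : suc (ℕ.pred τ) ≡ τ
          suc-pred = ℕ.suc-pred τ {{ℕ.>-nonZero 0<τ}}
          e₁′ : start X s ≡ p
          e₁′ = ≡.subst (λ t → start (CutAt t) s ≡ p) suc-pred e₁
          e₂′ : above j s ≡ true
          e₂′ = ≡.subst (λ n → above n s ≡ true) (≡.trans (≡.cong clock suc-pred) clock-τ) e₂
          x≤s : x ℕ.≤ s
          x≤s with x ℕ.≤? s
          ... | yes x≤s = x≤s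
          ... | no x≰s  = contradiction (start-mono X (ℕ.<⇒≤ (ℕ.≰⇒> x≰s))) (ℕ.<⇒≱ (≡.subst (start X x ℕ.<_) (≡.sym e₁′) x<p))
          s<y : s ℕ.< y
          s<y with suc s ℕ.≤? y
          ... | yes s<y = s<y
          ... | no s≮y  = contradiction (start-mono X (ℕ.≮⇒≥ s≮y)) (ℕ.<⇒≱ (≡.subst (ℕ._< start X y) (≡.sym e₁′) p<y))
          here : [ start X s == p ] have s ≡ three
          here rewrite ≡⇒== e₁′ | ≤⇒≤ᵇ x≤s | ≤⇒≤ᵇ s<y | e₂′ | ps = ≡.refl

        cell : ∀ p → needIn p ≤ haveIn p + slack p
        cell p with ℕ.<-cmp p (start X x) | ℕ.<-cmp p (start X y)
        ... | tri≈ _ ≡.refl _ | _ = ≤-trans (≤-trans (needIn≤mass p) (proj₁ (light p))) (≤-trans three≤slackˣ (x≤y+x (haveIn≥0 p)))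
        ... | _ | tri≈ _ ≡.refl _ = ≤-trans (≤-trans (needIn≤mass p) (proj₁ (light p))) (≤-trans three≤slackʸ (x≤y+x (haveIn≥0 p)))
        ... | tri> _ _ x<p | tri< p<y _ _ = ≤-trans (full-cell p x<p p<y) (x≤x+y (slack≥0 p))
        ... | tri< p<x _ _ | _ = ≤-trans (≤-reflexive (needIn-zero p out)) (+-nonNeg (haveIn≥0 p) (slack≥0 p))
          where
          out : ∀ s → s ℕ.< T → start X s ≡ p → I s ≡ false
          out s _ ≡.refl with x ℕ.≤? s
          ... | yes x≤s = contradiction (start-mono X x≤s) (ℕ.<⇒≱ p<x)
          ... | no x≰s rewrite ≰⇒≤ᵇ (ℕ.≰⇒> x≰s) = ≡.refl
        ... | _ | tri> _ _ y<p = ≤-trans (≤-reflexive (needIn-zero p out)) (+-nonNeg (haveIn≥0 p) (slack≥0 p))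
          where
          out : ∀ s → s ℕ.< T → start X s ≡ p → I s ≡ false
          out s _ ≡.refl with suc s ℕ.≤? y
          ... | yes s<y = contradiction (start-mono X (ℕ.<⇒≤ s<y)) (ℕ.<⇒≱ y<p)
          ... | no s≮y rewrite ≰⇒≤ᵇ (ℕ.≰⇒> s≮y) with x ≤ᵇ s
          ...   | true  = ≡.refl
          ...   | false = ≡.refl

        -- One strict inequality makes the whole bound strict; this is what rules out a weight of
        -- exactly 6 in `number-covered`.
        cell-strict : needIn (start X x) < haveIn (start X x) + slack (start X x)
        cell-strict = begin-strict
          needIn (start X x)                        ≤⟨ needIn≤mass _ ⟩
          mass X j (start X x)                      <⟨ light _ ⟩
          three                                     ≤⟨ three≤slackˣ ⟩
          slack (start X x)                         ≤⟨ x≤y+x (haveIn≥0 _) ⟩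
          haveIn (start X x) + slack (start X x)    ∎

        slack-total : ∑ T slack ≤ three + three
        slack-total = ≤-trans (≤-reflexive (∑-+ T _ _)) (+-mono-≤
          (∑-unique T (_== start X x) 0≤three λ p q _ _ e e′ → ≡.trans (==⇒≡ e) (≡.sym (==⇒≡ e′)))
          (∑-unique T (_== start X y) 0≤three λ p q _ _ e e′ → ≡.trans (==⇒≡ e) (≡.sym (==⇒≡ e′))))

      interval-count′ : ∑ T (λ s → [ I s ] weight (suc i) s)
        < (three + three) + ∑ T (λ s → [ I s ] [ above (suc i) s ] [ picked final s ] three)
      interval-count′ = begin-strict
        ∑ T need                       ≈⟨ [start]-sum X need need≥0 ⟩
        ∑ T needIn                     <⟨ ∑-mono-< T (λ p _ → cell p) (start X x) (ℕ.≤-<-trans (start≤ X x) x<T) cell-strict ⟩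
        ∑ T (λ p → haveIn p + slack p) ≈⟨ ∑-+ T haveIn slack ⟩
        ∑ T haveIn + ∑ T slack         ≤⟨ +-monoʳ-≤ _ slack-total ⟩
        ∑ T haveIn + (three + three)   ≈⟨ +-congʳ ([start]-sum X have have≥0) ⟨
        ∑ T have + (three + three)     ≈⟨ +-comm _ _ ⟩
        (three + three) + ∑ T have     ∎

    0<six : 0# < three + three
    0<six = begin-strict
      0#            <⟨ 0<1 ⟩
      1#            ≤⟨ x≤x+y (+-nonNeg 0≤1 0≤1) ⟩
      three         ≤⟨ x≤x+y 0≤three ⟩
      three + three ∎

    interval-count : ∀ i → i ℕ.≤ T → ∑ T (λ s → [ I s ] weight i s)
      < (three + three) + ∑ T (λ s → [ I s ] [ above i s ] [ picked final s ] three)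
    interval-count (suc i) i<T = interval-count′ i i<T
    interval-count zero    _   = begin-strict
      ∑ T (λ s → [ I s ] weight 0 s) ≈⟨ ∑-cong T empty ⟩
      ∑ T (λ _ → 0#)                 ≈⟨ ∑-zero T ⟩
      0#                             <⟨ 0<six ⟩
      three + three                  ≤⟨ x≤x+y (∑-nonNeg T λ s _ →
                                          []-nonNeg (I s) ([]-nonNeg (above 0 s) ([]-nonNeg (picked final s) 0≤three))) ⟩
      (three + three) + ∑ T (λ s → [ I s ] [ above 0 s ] [ picked final s ] three) ∎
      where
      empty : ∀ s → s ℕ.< T → [ I s ] weight 0 s ≈ 0#
      empty s s<T rewrite above-top s s<T with I s
      ... | true  = refl
      ... | false = refl

    private
      []-comm : ∀ b b′ z → [ b ] [ b′ ] z ≡ [ b′ ] [ b ] z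
      []-comm true  true  z = ≡.refl
      []-comm true  false z = ≡.refl
      []-comm false true  z = ≡.refl
      []-comm false false z = ≡.refl

      module MinP = Min totalOrder

      supply : Carrier
      supply = ∑ T (λ s → [ I s ] [ picked final s ] cap s)

      cap≥0 : ∀ s → s ℕ.< T → 0# ≤ [ I s ] [ picked final s ] cap s
      cap≥0 s s<T = []-nonNeg (I s) ([]-nonNeg (picked final s) (proj₁ (C>0 s s<T)))

    volume-covered : ∀ ρ → 0# < ρ → 10 · ρ ≤ ∑ T (λ s → [ I s ] (min (cap s) ρ * w s)) → ρ ≤ supply
    volume-covered ρ 0<ρ vol with ρ ≤? supply
    ... | yes ρ≤supply = ρ≤supply
    ... | no ρ≰supply  = contradiction ten≤nine nine<ten
      where
      g : Carrier → Carrier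
      g v = min v ρ
      u v : ℕ → Carrier
      u s = [ I s ] w s
      v s = [ I s ] [ picked final s ] three

      counts : ∀ i → i ℕ.≤ T → ∑ T (λ s → [ above i s ] u s) ≤ (three + three) + ∑ T (λ s → [ above i s ] v s)
      counts i i≤T = begin
        ∑ T (λ s → [ above i s ] u s)         ≈⟨ ∑-cong T (λ s _ → reflexive ([]-comm (above i s) (I s) (w s))) ⟩
        ∑ T (λ s → [ I s ] weight i s)        ≤⟨ proj₁ (interval-count i i≤T) ⟩
        (three + three) + ∑ T (λ s → [ I s ] [ above i s ] [ picked final s ] three)
          ≈⟨ +-congˡ (∑-cong T λ s _ → reflexive ([]-comm (I s) (above i s) _)) ⟩
        (three + three) + ∑ T (λ s → [ above i s ] v s) ∎

      parts : ∑ T (λ s → u s * g (cap s)) ≤ (three + three) * ρ + ∑ T (λ s → v s * g (cap s))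
      -- The truncation `g` never exceeds `ρ`, so the 6 lost at every level costs `6 ρ` in total.
      parts = summation-by-parts g ρ (three + three) (λ {x} {y} → MinP.⊓-congʳ ρ)
        (λ x≤y → MinP.⊓-monoˡ-≤ ρ x≤y) (λ x → MinP.x⊓y≤y x ρ)
        (MinP.x≤y⇒x⊓y≈x (proj₁ 0<ρ)) (proj₁ 0<six) u v counts

      v≤ : ∀ s → s ℕ.< T → v s * g (cap s) ≤ three * [ I s ] [ picked final s ] cap s
      v≤ s s<T = begin
        v s * g (cap s)                              ≈⟨ []-*ʳ (I s) _ _ ⟩
        [ I s ] ([ picked final s ] three * g (cap s)) ≈⟨ []-cong (I s) ([]-*ʳ (picked final s) _ _) ⟩
        [ I s ] [ picked final s ] (three * g (cap s)) ≤⟨ []-mono {I s} (λ e → e) ([]-nonNeg (picked final s) nn)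
            ([]-mono {picked final s} (λ e → e) nn (*-monoˡ-≤ 0≤three (MinP.x⊓y≤x (cap s) ρ))) ⟩
        [ I s ] [ picked final s ] (three * cap s)   ≈⟨ []-cong (I s) ([]-*ˡ (picked final s) _ _) ⟨
        [ I s ] (three * [ picked final s ] cap s)   ≈⟨ []-*ˡ (I s) _ _ ⟨
        three * [ I s ] [ picked final s ] cap s     ∎
        where
        nn : 0# ≤ three * cap s
        nn = *-nonNeg 0≤three (proj₁ (C>0 s s<T))

      ten≤nine : 10 · ρ ≤ (three + three) * ρ + three * ρ
      ten≤nine = begin
        10 · ρ                                        ≤⟨ vol ⟩
        ∑ T (λ s → [ I s ] (min (cap s) ρ * w s))     ≈⟨ ∑-cong T (λ s _ → trans ([]-cong (I s) (*-comm _ _)) (sym ([]-*ʳ (I s) _ _))) ⟩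
        ∑ T (λ s → u s * g (cap s))                   ≤⟨ parts ⟩
        (three + three) * ρ + ∑ T (λ s → v s * g (cap s)) ≤⟨ +-monoʳ-≤ _ (∑-mono T v≤) ⟩
        (three + three) * ρ + ∑ T (λ s → three * [ I s ] [ picked final s ] cap s) ≈⟨ +-congˡ (∑-*ˡ T three _) ⟩
        (three + three) * ρ + three * supply          ≤⟨ +-monoʳ-≤ _ (*-monoˡ-≤ 0≤three (proj₁ (≰⇒> ρ≰supply))) ⟩
        (three + three) * ρ + three * ρ               ∎

      nine<ten : ¬ (10 · ρ ≤ (three + three) * ρ + three * ρ)
      nine<ten le = <⇒≱ 0<ρ (+-cancelʳ-≤ ((three + three) * ρ + three * ρ) (begin
        -- The solver treats `1#` as an atom `o`. The right-hand side is nested so that replacing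
        -- each `1# * ρ` by `ρ` yields the unfolded `10 · ρ`.
        ρ + ((three + three) * ρ + three * ρ)  ≈⟨ solve 2 (λ r o →
            r :+ (((o :+ (o :+ o)) :+ (o :+ (o :+ o))) :* r :+ (o :+ (o :+ o)) :* r)
            := r :+ (o :* r :+ (o :* r :+ (o :* r :+ (o :* r :+ (o :* r :+ (o :* r :+ (o :* r :+ (o :* r :+ o :* r)))))))))
            refl ρ 1# ⟩
        ρ + (1# * ρ + (1# * ρ + (1# * ρ + (1# * ρ + (1# * ρ + (1# * ρ + (1# * ρ + (1# * ρ + 1# * ρ))))))))
          ≈⟨ +-congˡ (+-cong 1ρ (+-cong 1ρ (+-cong 1ρ (+-cong 1ρ (+-cong 1ρ (+-cong 1ρ (+-cong 1ρ (+-cong 1ρ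
              (trans 1ρ (sym (+-identityʳ ρ))))))))))) ⟩
        10 · ρ                                 ≤⟨ le ⟩
        (three + three) * ρ + three * ρ        ≈⟨ +-identityˡ _ ⟨
        0# + ((three + three) * ρ + three * ρ) ∎))
        where
        1ρ : 1# * ρ ≈ ρ
        1ρ = *-identityˡ ρ

    -- A single pick in the interval of capacity at least `ρ` would supply `ρ` alone. Otherwise no
    -- pick counts at the level matching `ρ`, and the weight there stays below 6.
    number-covered : ∀ ρ → 0# < ρ → (b : ℕ → Bool) → (∀ s → s ℕ.< T → b s ≡ true → ρ ≤ cap s) →
      6 · 1# ≤ ∑ T (λ s → [ I s ] [ b s ] w s) → ρ ≤ supply
    number-covered ρ 0<ρ b b⇒ num with ρ ≤? supply
    ... | yes ρ≤supply = ρ≤supply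
    ... | no ρ≰supply with threshold-level ρ 0<ρ
    ...   | i , i≤T , to , from = contradiction absurd λ lt → <⇒≱ lt absurd-≥
      where
      none : ∀ s → s ℕ.< T → [ I s ] [ above i s ] [ picked final s ] three ≈ 0#
      none s s<T with I s in eI | above i s in ea | picked final s in ep
      ... | false | _     | _     = refl
      ... | true  | false | _     = refl
      ... | true  | true  | false = refl
      ... | true  | true  | true  = contradiction (≤-trans (from s s<T ea)
              (≤-trans (≤-reflexive (reflexive (≡.sym here))) (term≤∑ T cap≥0 s s<T))) ρ≰supply
        where
        here : [ I s ] [ picked final s ] cap s ≡ cap s
        here rewrite eI | ep = ≡.refl

      absurd : ∑ T (λ s → [ I s ] weight i s) < three + three
      absurd = begin-strict
        ∑ T (λ s → [ I s ] weight i s) <⟨ interval-count i i≤T ⟩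
        (three + three) + ∑ T (λ s → [ I s ] [ above i s ] [ picked final s ] three)
                                       ≈⟨ +-congˡ (trans (∑-cong T none) (∑-zero T)) ⟩
        (three + three) + 0#           ≈⟨ +-identityʳ _ ⟩
        three + three                  ∎

      absurd-≥ : three + three ≤ ∑ T (λ s → [ I s ] weight i s)
      absurd-≥ = begin
        three + three                  ≈⟨ six ⟩
        6 · 1#                         ≤⟨ num ⟩
        ∑ T (λ s → [ I s ] [ b s ] w s) ≤⟨ ∑-mono T (λ s s<T → []-mono {I s} (λ e → e) (weight≥0 i s s<T)
                                            ([]-mono {b s} (λ e → to s s<T (b⇒ s s<T e)) (W≥0 s s<T) ≤-refl)) ⟩
        ∑ T (λ s → [ I s ] weight i s) ∎
        where
        six : three + three ≈ 6 · 1#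
        six = trans (+-assoc 1# (1# + 1#) three) (+-congˡ (trans (+-assoc 1# 1# three)
          (+-congˡ (+-congˡ (+-congˡ (+-congˡ (sym (+-identityʳ 1#))))))))

-- From indices back to the instance.

lookup-─ : ∀ {n} (p q : Subset n) s → lookup (p ─ q) s ≡ lookup p s ∧ not (lookup q s)
lookup-─ (true  Vec.∷ p) (true  Vec.∷ q) Fin.zero    = ≡.refl
lookup-─ (true  Vec.∷ p) (false Vec.∷ q) Fin.zero    = ≡.refl
lookup-─ (false Vec.∷ p) (true  Vec.∷ q) Fin.zero    = ≡.refl
lookup-─ (false Vec.∷ p) (false Vec.∷ q) Fin.zero    = ≡.refl
lookup-─ (_     Vec.∷ p) (_     Vec.∷ q) (Fin.suc s) = lookup-─ p q s

module Assembly {a c ℓ₁ ℓ₂} {O : Ops a} (F : OrderedField c ℓ₁ ℓ₂) (I : Covering.Instance F)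
  (y : Fin (Covering.Instance.T I) → OrderedField.Carrier F)
  (cube : Covering.InUnitCube F I y) (hyp : Covering.RoundingHypothesis F I y)
  (S : Setup O F (Covering.Instance.T I)) where

  open Covering F
  private module I = Instance I
  open I using (T; R)
  open Setup S
  open Coverage S
  private
    module Sums = Sum (CommutativeRing.+-commutativeMonoid commutativeRing)
    module MaxP = Max totalOrder
    module MinP = Min totalOrder

    sum-split : ∀ {n} (f : Fin n → Carrier) (g : ℕ → Carrier) → sum (λ s → f s + g (toℕ s)) ≈ sum f + ∑ n g
    sum-split {n} f g = trans (Sums.∑-distrib-+ f (λ s → g (toℕ s))) (+-congˡ (sum≈∑ {n} (λ s → g (toℕ s)) g λ s → refl))

  full : Fin T → Bool
  full s = does (y s ≟ 1#)

  module _ (C≈ : ∀ s → ιC (C (toℕ s)) ≈ I.C s) (K≈ : ∀ s → ιK (K (toℕ s)) ≈ I.K s)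
    (W≈ : ∀ s → ιW (W (toℕ s)) ≈ (if full s then 0# else y s))
    (A : Subset T) (A≡ : ∀ s → lookup A s ≡ picked final (toℕ s) ∨ full s) where

    private
      full⇒W≤0 : ∀ s → full s ≡ true → leq (W (toℕ s)) null ≡ true
      full⇒W≤0 s eq = Scale.≤⇒leq σW (≤-reflexive (trans (W≈ s)
        (trans (reflexive (≡.cong (λ b → if b then 0# else y s) eq)) (sym (Scale.ι-null σW)))))

      -- A pick has nonzero weight, whereas `W` vanishes on S⁺; so the two costs and the two
      -- capacities add up without overlap.
      disjoint : ∀ s → picked final (toℕ s) ≡ true → full s ≡ false
      disjoint s ps with full s in eq
      ... | false = ≡.refl
      ... | true  = contradiction (≡.trans (≡.sym (full⇒W≤0 s eq)) (proj₂ (final-picks (toℕ s) ps))) λ ()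

      full⇒≈1 : ∀ s → full s ≡ true → y s ≈ 1#
      full⇒≈1 s = true⇒ (proof (y s ≟ 1#))

      lookup-S⁺ : ∀ s → lookup (S⁺ I y) s ≡ full s
      lookup-S⁺ s = lookup∘tabulate full s

    contains : S⁺ I y ⊆ A
    contains {s} s∈ = lookup⇒[]= s A (≡.trans (A≡ s) (≡.trans
      (≡.cong (picked final (toℕ s) ∨_) (≡.trans (≡.sym (lookup-S⁺ s)) ([]=⇒lookup s∈)))
      (∨-zeroʳ (picked final (toℕ s)))))

    cheap : Σ[ A ] I.K ≤ sum (λ s → y s * I.K s)
    cheap = begin
      Σ[ A ] I.K                                                  ≈⟨ Sums.sum-cong-≋ split-cost ⟩
      sum (λ s → forced s + bought (toℕ s))                       ≈⟨ sum-split forced bought ⟩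
      sum forced + ∑ T bought                                     ≤⟨ +-monoʳ-≤ (sum forced) final-cheap ⟩
      sum forced + ∑ T paid                                       ≈⟨ sum-split forced paid ⟨
      sum (λ s → forced s + paid (toℕ s))                         ≈⟨ Sums.sum-cong-≋ merge-cost ⟩
      sum (λ s → y s * I.K s)                                     ∎
      where
      forced : Fin T → Carrier
      forced s = [ full s ] I.K s

      bought paid : ℕ → Carrier
      bought s = [ picked final s ] ιK (K s)
      paid s = w s * ιK (K s)

      split-cost : ∀ s → [ lookup A s ] I.K s ≈ [ full s ] I.K s + [ picked final (toℕ s) ] ιK (K (toℕ s))
      split-cost s rewrite A≡ s with picked final (toℕ s) in eq
      ... | false = sym (+-identityʳ _)
      ... | true rewrite disjoint s eq = sym (trans (+-identityˡ _) (K≈ s))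

      merge-cost : ∀ s → [ full s ] I.K s + w (toℕ s) * ιK (K (toℕ s)) ≈ y s * I.K s
      merge-cost s with full s in eq | W≈ s
      ... | true  | w≈0 = trans (+-congˡ (trans (*-congʳ w≈0) (zeroˡ _)))
              (trans (+-identityʳ _) (trans (sym (*-identityˡ _)) (*-congʳ (sym (full⇒≈1 s eq)))))
      ... | false | w≈y = trans (+-identityˡ _) (*-cong w≈y (K≈ s))

    module _ (a b : Fin (suc T)) (a<b : toℕ a ℕ.< toℕ b) where
      private
        J : ℕ → Bool
        J = interval (toℕ a) (toℕ b)

        lookup-J : ∀ s → lookup (⦅ a , b ]) s ≡ J (toℕ s)
        lookup-J s = lookup∘tabulate _ s

        b≤T : toℕ b ℕ.≤ T
        b≤T = ℕ.<⇒≤pred (Fin.toℕ<n b)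

        forced supply ρ : Carrier
        forced = Σ[ S⁺ I y ∩ ⦅ a , b ] ] I.C
        supply = ∑ T (λ s → [ J s ] [ picked final s ] cap s)
        ρ = R̃ I y a b

        split-supply : Σ[ A ∩ ⦅ a , b ] ] I.C ≈ forced + supply
        split-supply = trans (Sums.sum-cong-≋ pointwise)
          (sum-split (λ s → [ lookup (S⁺ I y ∩ ⦅ a , b ]) s ] I.C s) (λ s → [ J s ] [ picked final s ] cap s))
          where
          pointwise : ∀ s → [ lookup (A ∩ ⦅ a , b ]) s ] I.C s
            ≈ [ lookup (S⁺ I y ∩ ⦅ a , b ]) s ] I.C s + [ J (toℕ s) ] [ picked final (toℕ s) ] cap (toℕ s)
          pointwise s rewrite lookup-zipWith _∧_ s A ⦅ a , b ] | lookup-zipWith _∧_ s (S⁺ I y) ⦅ a , b ]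
            | lookup-J s | lookup-S⁺ s | A≡ s with picked final (toℕ s) in eq | J (toℕ s)
          ... | true  | true  rewrite disjoint s eq = sym (trans (+-identityˡ _) (C≈ s))
          ... | true  | false rewrite disjoint s eq = sym (+-identityˡ 0#)
          ... | false | true  = sym (+-identityʳ _)
          ... | false | false = sym (+-identityʳ _)

        supply≥0 : 0# ≤ supply
        supply≥0 = ∑-nonNeg T λ s s<T → []-nonNeg (J s) ([]-nonNeg (picked final s) (proj₁ (C>0 s s<T)))

        volume≈ : Σ[ ⦅ a , b ] ─ S⁺ I y ] (λ s → min (I.C s) ρ * y s) ≈ ∑ T (λ s → [ J s ] (min (cap s) ρ * w s))
        volume≈ = sum≈∑ _ (λ s → [ J s ] (min (cap s) ρ * w s)) pointwise
          where
          pointwise : ∀ s → [ lookup (⦅ a , b ] ─ S⁺ I y) s ] (min (I.C s) ρ * y s)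
            ≈ [ J (toℕ s) ] (min (cap (toℕ s)) ρ * w (toℕ s))
          pointwise s rewrite lookup-─ ⦅ a , b ] (S⁺ I y) s | lookup-J s | lookup-S⁺ s with J (toℕ s) | full s | W≈ s
          ... | false | _     | _   = refl
          ... | true  | true  | w≈0 = sym (trans (*-congˡ w≈0) (zeroʳ _))
          ... | true  | false | w≈y = *-cong (MinP.⊓-congʳ ρ (sym (C≈ s))) (sym w≈y)

        large : ℕ → Bool
        large s = does (ρ ≤? cap s)

        number≈ : Σ[ (⦅ a , b ] ─ S⁺ I y) ∩ CapacityAtLeast I y ρ ] y ≈ ∑ T (λ s → [ J s ] [ large s ] w s)
        number≈ = sum≈∑ _ (λ s → [ J s ] [ large s ] w s) pointwise
          where
          same : ∀ s → does (ρ ≤? I.C s) ≡ large (toℕ s)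
          same s with ρ ≤? cap (toℕ s)
          ... | yes ρ≤ = ⇒true (proof (ρ ≤? I.C s)) (≤-respʳ-≈ (C≈ s) ρ≤)
          ... | no ρ≰  = ⇒false (proof (ρ ≤? I.C s)) λ ρ≤ → ρ≰ (≤-respʳ-≈ (sym (C≈ s)) ρ≤)
          pointwise : ∀ s → [ lookup ((⦅ a , b ] ─ S⁺ I y) ∩ CapacityAtLeast I y ρ) s ] y s
            ≈ [ J (toℕ s) ] [ large (toℕ s) ] w (toℕ s)
          pointwise s rewrite lookup-zipWith _∧_ s (⦅ a , b ] ─ S⁺ I y) (CapacityAtLeast I y ρ)
            | lookup-─ ⦅ a , b ] (S⁺ I y) s | lookup-J s | lookup-S⁺ s
            | lookup∘tabulate (λ s → does (ρ ≤? I.C s)) s | same s with J (toℕ s) | full s | large (toℕ s) | W≈ s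
          ... | false | _     | _     | _   = refl
          ... | true  | true  | true  | w≈0 = sym w≈0
          ... | true  | true  | false | w≈0 = refl
          ... | true  | false | true  | w≈y = sym w≈y
          ... | true  | false | false | w≈y = refl

        ρ≤supply : ρ ≤ supply
        ρ≤supply with ρ ≤? 0#
        -- The hypothesis speaks only of intervals with a positive remaining requirement.
        ... | yes ρ≤0 = ≤-trans ρ≤0 supply≥0
        ... | no ρ≰0 with hyp a b a<b (≰⇒> ρ≰0)
        ...   | inj₁ vol = volume-covered a<b b≤T ρ (≰⇒> ρ≰0) (≤-respʳ-≈ volume≈ vol)
        ...   | inj₂ num = number-covered a<b b≤T ρ (≰⇒> ρ≰0) large
                (λ s _ → true⇒ (proof (ρ ≤? cap s))) (≤-respʳ-≈ number≈ num)

      covered : R a b ≤ Σ[ A ∩ ⦅ a , b ] ] I.C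
      covered = begin
        R a b                    ≤⟨ x-y≤z⇒x≤z+y (≤-trans (MaxP.x≤x⊔y _ 0#) ρ≤supply) ⟩
        supply + forced          ≈⟨ +-comm supply forced ⟩
        forced + supply          ≈⟨ split-supply ⟨
        Σ[ A ∩ ⦅ a , b ] ] I.C   ∎

    rounds : Rounds I y A
    rounds = contains , covered , cheap

-- Existence over an arbitrary ordered field.

extend : ∀ {a} {A : Set a} {n} → (Fin n → A) → A → ℕ → A
extend {n = n} f d s with s ℕ.<? n
... | yes s<n = f (fromℕ< s<n)
... | no _    = d

extend-toℕ : ∀ {a} {A : Set a} {n} (f : Fin n → A) d s → extend f d (toℕ s) ≡ f s
extend-toℕ {n = n} f d s with toℕ s ℕ.<? n
... | yes s<n = ≡.cong f (Fin.fromℕ<-toℕ s s<n)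
... | no s≮n  = contradiction (Fin.toℕ<n s) s≮n

extend-all : ∀ {a p} {A : Set a} {n} (P : A → Set p) (f : Fin n → A) d → (∀ s → P (f s)) → ∀ s → s ℕ.< n → P (extend f d s)
extend-all {n = n} P f d Pf s s<n with s ℕ.<? n
... | yes _   = Pf _
... | no s≮n  = contradiction s<n s≮n

module Existence {c ℓ₁ ℓ₂} (F : OrderedField c ℓ₁ ℓ₂) where
  open OrderedField F
  open OrderedFieldProperties F
  open Covering F

  fieldOps : Ops c
  fieldOps = record { Number = Carrier ; plus = _+_ ; minus = _-_ ; null = 0# ; leq = λ x y → does (x ≤? y) }

  identity : Scale fieldOps F
  identity = record
    { ι       = λ x → x
    ; ι-null  = refl
    ; ι-plus  = λ x y → refl
    ; ι-minus = λ x y _ → refl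
    ; ι-leq   = λ x y → proof (x ≤? y)
    }

  module _ (I : Instance) (y : Fin (Instance.T I) → Carrier) (cube : InUnitCube I y) where
    open Instance I

    fractional : Fin T → Carrier
    fractional s = if does (y s ≟ 1#) then 0# else y s

    fractional-bounds : ∀ s → 0# ≤ fractional s × fractional s < 1#
    fractional-bounds s with y s ≟ 1#
    ... | yes _   = ≤-refl , 0<1
    ... | no y≉1  = proj₁ (cube s) , proj₂ (cube s) , y≉1

    total-capacity : Carrier
    total-capacity = ∑ T (extend C 0#)

    extend-C>0 : ∀ s → s ℕ.< T → 0# < extend C 0# s
    extend-C>0 = extend-all (0# <_) C 0# C>0

    setup : Setup fieldOps F T
    setup = record
      { σC = identity ; σK = identity ; σW = identity
      ; C = extend C 0# ; K = extend K 0# ; W = extend fractional 0#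
      ; one = 1# ; top = 1# + total-capacity
      ; C>0 = extend-C>0
      ; C<top = λ s s<T → begin-strict
          extend C 0# s        ≈⟨ +-identityˡ _ ⟨
          0# + extend C 0# s   <⟨ +-mono-<-≤ 0<1 (term≤∑ T (λ t t<T → proj₁ (extend-C>0 t t<T)) s s<T) ⟩
          1# + total-capacity  ∎
      ; top≥0 = +-nonNeg 0≤1 (∑-nonNeg T λ t t<T → proj₁ (extend-C>0 t t<T))
      ; K≥0 = extend-all (0# ≤_) K 0# K≥0
      ; W≥0 = extend-all (0# ≤_) fractional 0# λ s → proj₁ (fractional-bounds s)
      ; W<1 = extend-all (_< 1#) fractional 0# λ s → proj₂ (fractional-bounds s)
      ; one≈1 = refl
      }

    exists : RoundingHypothesis I y → ∃ λ (S : Subset T) → Rounds I y S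
    exists hyp = A , Assembly.rounds F I y cube hyp setup
        (λ s → reflexive (extend-toℕ C 0# s)) (λ s → reflexive (extend-toℕ K 0# s))
        (λ s → reflexive (extend-toℕ fractional 0# s)) A (lookup∘tabulate _)
      where
      open Coverage setup using (picked; final)
      A : Subset T
      A = Vec.tabulate λ s → picked final (toℕ s) ∨ does (y s ≟ 1#)

-- Polynomial time on the random access machine.

module Machine where

  open import Data.List.Base using (map)
  open import Data.Nat.Base
  open import Data.Nat.Induction using (<-rec)
  open import Data.Nat.Logarithm using (⌈log₂_⌉; ⌈log₂⌉-mono-≤; ⌈log₂2^n⌉≡n; ⌈log₂⌈n/2⌉⌉≡⌈log₂n⌉∸1)
  open import Data.Nat.Properties hiding (≤ᵇ⇒≤; ≤⇒≤ᵇ)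
  open import Data.Nat.Tactic.RingSolver using (solve-∀)
  open import Data.Vec.Base using (Vec; []; _∷_)
  open import Relation.Binary.PropositionalEquality using (refl; sym; trans; cong; cong₂; subst)

  n<2^n : ∀ n → n < 2 ^ n
  n<2^n zero    = s≤s z≤n
  n<2^n (suc n) = ≤-trans (+-mono-≤ (m^n>0 2 n) (n<2^n n)) (≤-reflexive (cong (2 ^ n +_) (sym (+-identityʳ (2 ^ n)))))

  <2^-mono : ∀ {v a b} → a ≤ b → v < 2 ^ a → v < 2 ^ b
  <2^-mono a≤b v< = <-≤-trans v< (^-monoʳ-≤ 2 a≤b)

  +-<2^ : ∀ {u v} a → u < 2 ^ a → v < 2 ^ a → u + v < 2 ^ suc a
  +-<2^ {u} {v} a u< v< = subst (u + v <_) (cong (2 ^ a +_) (sym (+-identityʳ _))) (+-mono-< u< v<)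

  *-<2^ : ∀ {u v} a b → u < 2 ^ a → v < 2 ^ b → u * v < 2 ^ (a + b)
  *-<2^ {u} {v} a b u< v< = subst (u * v <_) (sym (^-distribˡ-+-* 2 a b)) (*-mono-< u< v<)

  size≤ : ∀ {v b} → v < 2 ^ b → size v ≤ suc b
  size≤ {v} {b} v< = s≤s (subst (⌈log₂ suc v ⌉ ≤_) (⌈log₂2^n⌉≡n b) (⌈log₂⌉-mono-≤ v<))

  nodes : Expr → ℕ
  nodes (lit _)  = 1
  nodes (mem e)  = suc (nodes e)
  nodes (d ⊕ e)  = suc (nodes d + nodes e)
  nodes (d ⊖ e)  = suc (nodes d + nodes e)
  nodes (d ⊛ e)  = suc (nodes d + nodes e)

  data Bounded (β : ℕ) (m : Memory) : Expr → Set where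
    lit : ∀ {n} → n < 2 ^ β → Bounded β m (lit n)
    mem : ∀ {e} → ⟦ mem e ⟧ m < 2 ^ β → Bounded β m e → Bounded β m (mem e)
    add : ∀ {d e} → ⟦ d ⊕ e ⟧ m < 2 ^ β → Bounded β m d → Bounded β m e → Bounded β m (d ⊕ e)
    sub : ∀ {d e} → ⟦ d ⊖ e ⟧ m < 2 ^ β → Bounded β m d → Bounded β m e → Bounded β m (d ⊖ e)
    mul : ∀ {d e} → ⟦ d ⊛ e ⟧ m < 2 ^ β → Bounded β m d → Bounded β m e → Bounded β m (d ⊛ e)

  bounded-mono : ∀ {β β′ m e} → β ≤ β′ → Bounded β m e → Bounded β′ m e
  bounded-mono le (lit v)     = lit (<2^-mono le v)
  bounded-mono le (mem v p)   = mem (<2^-mono le v) (bounded-mono le p)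
  bounded-mono le (add v p q) = add (<2^-mono le v) (bounded-mono le p) (bounded-mono le q)
  bounded-mono le (sub v p q) = sub (<2^-mono le v) (bounded-mono le p) (bounded-mono le q)
  bounded-mono le (mul v p q) = mul (<2^-mono le v) (bounded-mono le p) (bounded-mono le q)

  value< : ∀ {β m e} → Bounded β m e → ⟦ e ⟧ m < 2 ^ β
  value< (lit v)     = v
  value< (mem v _)   = v
  value< (add v _ _) = v
  value< (sub v _ _) = v
  value< (mul v _ _) = v

  cost≤ : ∀ {β m e} → Bounded β m e → cost e m ≤ nodes e * suc β
  cost≤ {β} (lit v) = ≤-trans (size≤ v) (≤-reflexive (sym (+-identityʳ (suc β))))
  cost≤ (mem v p)   = +-mono-≤ (size≤ v) (cost≤ p)
  cost≤ {β} {m} {d ⊕ e} (add v p q) = +-mono-≤ (size≤ v)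
    (≤-trans (+-mono-≤ (cost≤ p) (cost≤ q)) (≤-reflexive (sym (*-distribʳ-+ (suc β) (nodes d) (nodes e)))))
  cost≤ {β} {m} {d ⊖ e} (sub v p q) = +-mono-≤ (size≤ v)
    (≤-trans (+-mono-≤ (cost≤ p) (cost≤ q)) (≤-reflexive (sym (*-distribʳ-+ (suc β) (nodes d) (nodes e)))))
  cost≤ {β} {m} {d ⊛ e} (mul v p q) = +-mono-≤ (size≤ v)
    (≤-trans (+-mono-≤ (cost≤ p) (cost≤ q)) (≤-reflexive (sym (*-distribʳ-+ (suc β) (nodes d) (nodes e)))))

  -- An exponent bound: a product is charged for its first factor, which has to be small.
  growth : Expr → ℕ
  growth (lit n) = n
  growth (mem e) = growth e
  growth (d ⊕ e) = suc (growth d + growth e)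
  growth (d ⊖ e) = growth d + growth e
  growth (d ⊛ e) = suc (growth d) + (growth d + growth e)

  -- Bounds at once the number of charged values and the growth of the exponent, so that `work` has
  -- a single quantity to track.
  weight : Expr → ℕ
  weight e = nodes e + growth e

  -- Uniqueness of quotient and remainder. It separates the cells of different tables, and the
  -- entries `T * i + p` in the table of choices.
  radix-injective : ∀ {n p p′} i i′ → p < n → p′ < n → n * i + p ≡ n * i′ + p′ → i ≡ i′ × p ≡ p′
  radix-injective {n} {p} {p′} zero zero p< p′< eq rewrite *-zeroʳ n = refl , eq
  radix-injective {n} {p} {p′} zero (suc i′) p< p′< eq rewrite *-zeroʳ n | *-suc n i′ =
    contradiction p< (≤⇒≯ (subst (n ≤_) (sym eq) (≤-trans (m≤m+n n (n * i′)) (m≤m+n _ p′))))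
  radix-injective {n} {p} {p′} (suc i) zero p< p′< eq rewrite *-zeroʳ n | *-suc n i =
    contradiction p′< (≤⇒≯ (subst (n ≤_) eq (≤-trans (m≤m+n n (n * i)) (m≤m+n _ p))))
  radix-injective {n} {p} {p′} (suc i) (suc i′) p< p′< eq rewrite *-suc n i | *-suc n i′ | +-assoc n (n * i) p | +-assoc n (n * i′) p′ =
    let i≡ , p≡ = radix-injective i i′ p< p′< (+-cancelˡ-≡ n _ _ eq) in cong suc i≡ , p≡

  -- Counted from the bottom of the environment, so that a variable keeps its cell when further
  -- variables are bound.
  slot : ∀ {d} → Fin d → ℕ
  slot {suc d} Fin.zero    = d
  slot {suc d} (Fin.suc x) = slot x

  slot< : ∀ {d} (x : Fin d) → slot x < d
  slot< {suc d} Fin.zero    = n<1+n d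
  slot< {suc d} (Fin.suc x) = m<n⇒m<1+n (slot< x)

  -- A language for polynomial time: loops run over the indices below T, and one factor of every product
  -- is bounded by the input, so that bit lengths grow by at most a constant multiple of the input size per step.
  module Language (w : ℕ) where

    data Bx (d : ℕ) : Set

    data Ex (d : ℕ) : Set where
      lit       : ℕ → Ex d
      len       : Ex d
      var       : Fin d → Ex d
      inp       : Fin 6 → Ex d → Ex d
      tbl       : Fin w → Ex d → Ex d
      _⊞_ _⊟_   : Ex d → Ex d → Ex d
      inp*      : Fin 6 → Ex d → Ex d → Ex d
      len*      : Ex d → Ex d
      cond      : Bx d → Ex d → Ex d → Ex d

    data Bx d where
      le  : Ex d → Ex d → Bx d
      and : Bx d → Bx d → Bx d
      neg : Bx d → Bx d

    data Com (d : ℕ) : Set where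
      asg  : Fin w → Ex d → Ex d → Com d
      _⍮_  : Com d → Com d → Com d
      when : Bx d → Com d → Com d
      for  : Com (suc d) → Com d
      fold : Ex d → Ex (suc (suc d)) → Com (suc d) → Com d

    infixr 3 _⍮_
    infixl 6 _⊞_ _⊟_

    State : Set
    State = Fin w → ℕ → ℕ

    _⟨_,_≔_⟩ : State → Fin w → ℕ → ℕ → State
    (σ ⟨ j , n ≔ v ⟩) j′ = if does (j′ Fin.≟ j) then σ j′ [ n ↦ v ] else σ j′

    module Semantics (T : ℕ) (input : Fin 6 → ℕ → ℕ) where
      val  : ∀ {d} → Vec ℕ d → State → Ex d → ℕ
      valᵇ : ∀ {d} → Vec ℕ d → State → Bx d → Bool
      val ρ σ (lit n)       = n
      val ρ σ len           = T
      val ρ σ (var x)       = lookup ρ x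
      val ρ σ (inp k e)     = input k (val ρ σ e)
      val ρ σ (tbl j e)     = σ j (val ρ σ e)
      val ρ σ (e ⊞ e′)      = val ρ σ e + val ρ σ e′
      val ρ σ (e ⊟ e′)      = val ρ σ e ∸ val ρ σ e′
      val ρ σ (inp* k e e′) = input k (val ρ σ e) * val ρ σ e′
      val ρ σ (len* e)      = T * val ρ σ e
      val ρ σ (cond b e e′) = if valᵇ ρ σ b then val ρ σ e else val ρ σ e′
      valᵇ ρ σ (le e e′)    = val ρ σ e ≤ᵇ val ρ σ e′
      valᵇ ρ σ (and b b′)   = valᵇ ρ σ b ∧ valᵇ ρ σ b′
      valᵇ ρ σ (neg b)      = not (valᵇ ρ σ b)

      exec : ∀ {d} → Com d → Vec ℕ d → State → State
      exec (asg j e e′)   ρ σ = σ ⟨ j , val ρ σ e ≔ val ρ σ e′ ⟩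
      exec (c ⍮ c′)       ρ σ = exec c′ ρ (exec c ρ σ)
      exec (when b c)     ρ σ = if valᵇ ρ σ b then exec c ρ σ else σ
      exec (for c)        ρ σ = loop T (λ i → exec c (i ∷ ρ)) σ
      exec (fold e₀ e c)  ρ σ = exec c (loop T (λ i a → val (i ∷ a ∷ ρ) σ e) (val ρ σ e₀) ∷ ρ) σ

    -- Cell 0 holds a base address; above it, residue 0 modulo the radix is reserved for T and the variables.
    radix : ℕ
    radix = suc w

    reserved : ℕ → Expr
    reserved n = mem (mem (lit 0) ⊕ lit (radix * n + 0))

    address : Fin w → Expr → Expr
    address j e = mem (lit 0) ⊕ (lit radix ⊛ e ⊕ lit (suc (toℕ j)))

    -- Machine expressions do not branch: a condition becomes a bit, computed by truncated
    -- subtraction, and `cond` a sum of both values weighted by the bit and its complement.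
    ⌜_⌝  : ∀ {d} → Ex d → Expr
    ⌜_⌝ᵇ : ∀ {d} → Bx d → Expr

    -- The first factor is 1 if `e` is below `T` and 0 otherwise, so a read past the knapsacks
    -- yields 0 and not the contents of foreign cells. Being a bit, it is the factor that stands
    -- first and has to be small.
    input-cell : Fin 6 → Expr → Expr
    input-cell k e = (lit 1 ⊖ ((lit 1 ⊕ e) ⊖ reserved 0)) ⊛ mem (lit 6 ⊛ e ⊕ lit (suc (toℕ k)))

    ⌜ lit n ⌝       = lit n
    ⌜ len ⌝         = reserved 0
    ⌜ var x ⌝       = reserved (suc (slot x))
    ⌜ inp k e ⌝     = input-cell k ⌜ e ⌝
    ⌜ tbl j e ⌝     = mem (address j ⌜ e ⌝)
    ⌜ e ⊞ e′ ⌝      = ⌜ e ⌝ ⊕ ⌜ e′ ⌝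
    ⌜ e ⊟ e′ ⌝      = ⌜ e ⌝ ⊖ ⌜ e′ ⌝
    ⌜ inp* k e e′ ⌝ = input-cell k ⌜ e ⌝ ⊛ ⌜ e′ ⌝
    ⌜ len* e ⌝      = reserved 0 ⊛ ⌜ e ⌝
    ⌜ cond b e e′ ⌝ = ⌜ b ⌝ᵇ ⊛ ⌜ e ⌝ ⊕ (lit 1 ⊖ ⌜ b ⌝ᵇ) ⊛ ⌜ e′ ⌝
    ⌜ le e e′ ⌝ᵇ    = lit 1 ⊖ (⌜ e ⌝ ⊖ ⌜ e′ ⌝)
    ⌜ and b b′ ⌝ᵇ   = ⌜ b ⌝ᵇ ⊛ ⌜ b′ ⌝ᵇ
    ⌜ neg b ⌝ᵇ      = lit 1 ⊖ ⌜ b ⌝ᵇ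

    variable-address : ℕ → Expr
    variable-address n = mem (lit 0) ⊕ lit (radix * suc n + 0)

    countedLoop : ℕ → Program → Program
    countedLoop n P = variable-address n ≔ lit 0 ⨾
      while (reserved 0 ⊖ reserved (suc n)) (P ⨾ variable-address n ≔ reserved (suc n) ⊕ lit 1)

    compile : ∀ {d} → Com d → Program
    compile (asg j e e′)      = address j ⌜ e ⌝ ≔ ⌜ e′ ⌝
    compile (c ⍮ c′)          = compile c ⨾ compile c′
    compile (when b c)        = if ⌜ b ⌝ᵇ (compile c) skip
    compile {d} (for c)       = countedLoop d (compile c)
    compile {d} (fold e₀ e c) = variable-address d ≔ ⌜ e₀ ⌝ ⨾
      countedLoop (suc d) (variable-address d ≔ ⌜ e ⌝) ⨾ compile c

    work : ∀ {d} → ℕ → Com d → ℕ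
    loopWork : ℕ → ℕ → ℕ → ℕ
    loopWork T n k = weight (variable-address n) + weight (lit 0)
      + (weight (reserved 0 ⊖ reserved (suc n)) + T * (weight (reserved 0 ⊖ reserved (suc n))
         + (k + (weight (variable-address n) + weight (reserved (suc n) ⊕ lit 1)))))
    work T (asg j e e′)      = weight (address j ⌜ e ⌝) + weight ⌜ e′ ⌝
    work T (c ⍮ c′)          = work T c + work T c′
    -- The extra unit pays for `skip` in the other branch.
    work T (when b c)        = weight ⌜ b ⌝ᵇ + suc (work T c)
    work {d} T (for c)       = loopWork T d (work T c)
    work {d} T (fold e₀ e c) = weight (variable-address d) + weight ⌜ e₀ ⌝
      + (loopWork T (suc d) (weight (variable-address d) + weight ⌜ e ⌝) + work T c)

    -- Correctness and cost of compiled programs.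

    module Correctness (T : ℕ) (input : Fin 6 → ℕ → ℕ) (input-end : ∀ k s → T ≤ s → input k s ≡ 0)
      (H : ℕ) (6T<H : 6 * T < H) (ω : ℕ) (0<ω : 0 < ω) (T<2^ω : T < 2 ^ ω) (input< : ∀ k s → input k s < 2 ^ ω) where
      open Semantics T input

      cell : ℕ → ℕ → ℕ
      cell j n = H + (radix * n + j)

      cell-injective : ∀ {j j′ n n′} → j < radix → j′ < radix → cell j n ≡ cell j′ n′ → n ≡ n′ × j ≡ j′
      cell-injective {n = n} {n′} j< j′< eq = radix-injective n n′ j< j′< (+-cancelˡ-≡ H _ _ eq)

      low≢cell : ∀ {a} j n → a ≤ 6 * T → a ≢ cell j n
      low≢cell j n a≤ = <⇒≢ (≤-<-trans a≤ (<-≤-trans 6T<H (m≤m+n H _)))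

      record Represents {d} (ρ : Vec ℕ d) (σ : State) (m : Memory) (μ : ℕ) : Set where
        field
          base      : m 0 ≡ H
          extent    : m (cell 0 0) ≡ T
          variables : ∀ x → m (cell 0 (suc (slot x))) ≡ lookup ρ x
          tables    : ∀ j n → m (cell (suc (toℕ j)) n) ≡ σ j n
          sizes     : ∀ a → m a < 2 ^ μ
          ω≤μ       : ω ≤ μ

      -- Kept apart from `Represents` because the final copying overwrites input cells while the
      -- tables must stay intact.
      Inputs : Memory → Set
      Inputs m = ∀ k s → s < T → m (6 * s + suc (toℕ k)) ≡ input k s

      input-address : ∀ (k : Fin 6) s → s < T → 6 * s + suc (toℕ k) ≤ 6 * T
      input-address k s s<T = ≤-trans (+-monoʳ-≤ (6 * s) (Fin.toℕ<n k))
        (≤-trans (≤-reflexive (trans (+-comm (6 * s) 6) (sym (*-suc 6 s)))) (*-monoʳ-≤ 6 s<T))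

      module _ {d} {ρ : Vec ℕ d} {σ : State} {m : Memory} {μ : ℕ} (R : Represents ρ σ m μ) where
        open Represents R

        reserved-eval : ∀ n → ⟦ reserved n ⟧ m ≡ m (cell 0 n)
        reserved-eval n rewrite base = refl

        address-eval : ∀ j e → ⟦ address j e ⟧ m ≡ cell (suc (toℕ j)) (⟦ e ⟧ m)
        address-eval j e rewrite base = refl

        variable-eval : ∀ n → ⟦ variable-address n ⟧ m ≡ cell 0 (suc n)
        variable-eval n rewrite base = refl

        len-eval : ⟦ reserved 0 ⟧ m ≡ T
        len-eval = trans (reserved-eval 0) extent

        var-eval : ∀ x → ⟦ reserved (suc (slot x)) ⟧ m ≡ lookup ρ x
        var-eval x = trans (reserved-eval (suc (slot x))) (variables x)

        toBit : Bool → ℕ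
        toBit b = if b then 1 else 0

        le-eval : ∀ x y → 1 ∸ (x ∸ y) ≡ toBit (x ≤ᵇ y)
        le-eval x y with x ≤? y
        ... | yes x≤y rewrite ≤⇒≤ᵇ x≤y | m≤n⇒m∸n≡0 x≤y = refl
        ... | no x≰y rewrite ≰⇒≤ᵇ (≰⇒> x≰y) = m≤n⇒m∸n≡0 (m<n⇒0<n∸m (≰⇒> x≰y))

        module _ (In : Inputs m) where
          input-eval : ∀ k e {v} → ⟦ e ⟧ m ≡ v → ⟦ input-cell k e ⟧ m ≡ input k v
          input-eval k e {v} refl rewrite len-eval with suc v ≤? T
          ... | yes v<T rewrite m≤n⇒m∸n≡0 v<T = trans (+-identityʳ _) (In k v v<T)
          ... | no v≮T rewrite m≤n⇒m∸n≡0 {1} (m<n⇒0<n∸m (≰⇒> v≮T)) = sym (input-end k v (≮⇒≥ v≮T))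

          val-correct  : ∀ (e : Ex d) → ⟦ ⌜ e ⌝ ⟧ m ≡ val ρ σ e
          valᵇ-correct : ∀ (b : Bx d) → ⟦ ⌜ b ⌝ᵇ ⟧ m ≡ toBit (valᵇ ρ σ b)
          val-correct (lit n)       = refl
          val-correct len           = len-eval
          val-correct (var x)       = var-eval x
          val-correct (inp k e)     = input-eval k ⌜ e ⌝ (val-correct e)
          val-correct (tbl j e)     = trans (cong m (address-eval j ⌜ e ⌝)) (trans (tables j _) (cong (σ j) (val-correct e)))
          val-correct (e ⊞ e′)      = cong₂ _+_ (val-correct e) (val-correct e′)
          val-correct (e ⊟ e′)      = cong₂ _∸_ (val-correct e) (val-correct e′)
          val-correct (inp* k e e′) = cong₂ _*_ (input-eval k ⌜ e ⌝ (val-correct e)) (val-correct e′)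
          val-correct (len* e)      = cong₂ _*_ len-eval (val-correct e)
          val-correct (cond b e e′) rewrite valᵇ-correct b with valᵇ ρ σ b
          ... | true  = trans (trans (+-identityʳ _) (+-identityʳ _)) (val-correct e)
          ... | false = trans (+-identityʳ _) (val-correct e′)
          valᵇ-correct (le e e′)    = trans (cong₂ (λ x y → 1 ∸ (x ∸ y)) (val-correct e) (val-correct e′)) (le-eval (val ρ σ e) (val ρ σ e′))
          valᵇ-correct (and b b′) rewrite valᵇ-correct b | valᵇ-correct b′ with valᵇ ρ σ b | valᵇ ρ σ b′
          ... | true  | true  = refl
          ... | true  | false = refl
          ... | false | _     = refl
          valᵇ-correct (neg b) rewrite valᵇ-correct b with valᵇ ρ σ b
          ... | true  = refl
          ... | false = refl

      -- The exponent that `n` units of work may reach from `μ`. Each unit adds `ω` bits, so lengths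
      -- grow linearly in the work.
      β : ℕ → ℕ → ℕ
      β μ n = μ + ω * n

      β-mono : ∀ μ {n n′} → n ≤ n′ → β μ n ≤ β μ n′
      β-mono μ n≤n′ = +-monoʳ-≤ μ (*-monoʳ-≤ ω n≤n′)

      β-suc : ∀ μ n → suc (β μ n) ≤ β μ (suc n)
      β-suc μ n = ≤-trans (≤-reflexive (sym (+-suc μ (ω * n))))
        (+-monoʳ-≤ μ (≤-trans (+-monoˡ-≤ (ω * n) 0<ω) (≤-reflexive (sym (*-suc ω n)))))

      β-+ : ∀ μ k n → ω * k + β μ n ≡ β μ (k + n)
      β-+ μ k n = trans (sym (+-assoc (ω * k) μ (ω * n))) (trans (cong (_+ ω * n) (+-comm (ω * k) μ))
        (trans (+-assoc μ (ω * k) (ω * n)) (cong (μ +_) (sym (*-distribˡ-+ ω k n)))))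

      n≤ωn : ∀ n → n ≤ ω * n
      n≤ωn n = ≤-trans (≤-reflexive (sym (*-identityˡ n))) (*-monoˡ-≤ n 0<ω)

      small : ∀ {v n} → v < 2 ^ ω → v < 2 ^ (ω * suc n)
      small {v} {n} = <2^-mono (≤-trans (m≤m+n ω (ω * n)) (≤-reflexive (sym (*-suc ω n))))

      bit-small : ∀ {v n} → v ≤ 1 → v < 2 ^ (ω * suc n)
      bit-small {n = n} v≤1 = small {n = n} (<-≤-trans (s≤s v≤1) (^-monoʳ-≤ 2 0<ω))

      lit-small : ∀ n → n < 2 ^ (ω * suc n)
      lit-small n = <2^-mono (≤-trans (n≤1+n n) (n≤ωn (suc n))) (n<2^n n)

      -- A record, so that `μ` and `n` can be recovered from the type; the number `β μ n` alone does
      -- not determine them.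
      record Fits (m : Memory) (μ n : ℕ) (e : Expr) : Set where
        constructor fit
        field bounded : Bounded (β μ n) m e

      fits-mono : ∀ {m μ n n′ e} → n ≤ n′ → Fits m μ n e → Fits m μ n′ e
      fits-mono {μ = μ} n≤n′ (fit p) = fit (bounded-mono (β-mono μ n≤n′) p)

      fits-lit : ∀ {m μ} n → Fits m μ n (lit n)
      fits-lit {μ = μ} n = fit (lit (<2^-mono (≤-trans (n≤ωn n) (m≤n+m (ω * n) μ)) (n<2^n n)))

      fits-add : ∀ {m μ n n′ d e} → Fits m μ n d → Fits m μ n′ e → Fits m μ (suc (n + n′)) (d ⊕ e)
      fits-add {μ = μ} {n} {n′} p q = fit (add (<2^-mono (β-suc μ (n + n′)) (+-<2^ (β μ (n + n′))
          (value< (Fits.bounded (fits-mono (m≤m+n n n′) p))) (value< (Fits.bounded (fits-mono (m≤n+m n′ n) q)))))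
        (Fits.bounded (fits-mono (m≤n⇒m≤1+n (m≤m+n n n′)) p)) (Fits.bounded (fits-mono (m≤n⇒m≤1+n (m≤n+m n′ n)) q)))

      fits-sub : ∀ {m μ n n′ d e} → Fits m μ n d → Fits m μ n′ e → Fits m μ (n + n′) (d ⊖ e)
      fits-sub {m} {μ} {n} {n′} {d} {e} p q = fit (sub (≤-<-trans (m∸n≤m (⟦ d ⟧ m) (⟦ e ⟧ m)) (value< p′)) p′
        (Fits.bounded (fits-mono (m≤n+m n′ n) q)))
        where p′ = Fits.bounded (fits-mono (m≤m+n n n′) p)

      -- The bound on the first factor does not involve `μ`, so `μ` occurs only once in the exponent
      -- of the product. If both factors carried it, repeated products would double the bit length.
      fits-mul : ∀ {m μ n n′ d e} → ⟦ d ⟧ m < 2 ^ (ω * suc n) → Fits m μ n d → Fits m μ n′ e →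
        Fits m μ (suc n + (n + n′)) (d ⊛ e)
      fits-mul {m} {μ} {n} {n′} {d} {e} small p q = fit (mul
        (<2^-mono (≤-trans (≤-reflexive (β-+ μ (suc n) n′)) (β-mono μ (+-monoʳ-≤ (suc n) (m≤n+m n′ n))))
          (*-<2^ (ω * suc n) (β μ n′) small (value< (Fits.bounded q))))
        (Fits.bounded (fits-mono (≤-trans (m≤m+n n n′) (m≤n+m (n + n′) (suc n))) p))
        (Fits.bounded (fits-mono (≤-trans (m≤n+m n′ n) (m≤n+m (n + n′) (suc n))) q)))

      module _ {m : Memory} {μ : ℕ} (sizes : ∀ a → m a < 2 ^ μ) where
        fits-mem : ∀ {n e} → Fits m μ n e → Fits m μ n (mem e)
        fits-mem (fit p) = fit (mem (<2^-mono (m≤m+n μ _) (sizes _)) p)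

        fits-reserved : ∀ n → Fits m μ (growth (reserved n)) (reserved n)
        fits-reserved n = fits-mem (fits-add (fits-mem (fits-lit 0)) (fits-lit (radix * n + 0)))

        fits-variable : ∀ n → Fits m μ (growth (variable-address n)) (variable-address n)
        fits-variable n = fits-add (fits-mem (fits-lit 0)) (fits-lit (radix * suc n + 0))

        fits-address : ∀ j e → Fits m μ (growth e) e → Fits m μ (growth (address j e)) (address j e)
        fits-address j e p = fits-add (fits-mem (fits-lit 0))
          (fits-add (fits-mul (lit-small radix) (fits-lit radix) p) (fits-lit (suc (toℕ j))))

        fits-input : ∀ k e → Fits m μ (growth e) e → Fits m μ (growth (input-cell k e)) (input-cell k e)
        fits-input k e p = fits-mul
          (bit-small (m∸n≤m 1 (suc (⟦ e ⟧ m) ∸ ⟦ reserved 0 ⟧ m)))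
          (fits-sub (fits-lit 1) (fits-sub (fits-add (fits-lit 1) p) (fits-reserved 0)))
          (fits-mem (fits-add (fits-mul (lit-small 6) (fits-lit 6) p) (fits-lit (suc (toℕ k)))))

      module _ {d} {ρ : Vec ℕ d} {σ : State} {m : Memory} {μ : ℕ} (R : Represents ρ σ m μ) (In : Inputs m) where
        private sizes = Represents.sizes R

        bit≤1 : ∀ b → ⟦ ⌜ b ⌝ᵇ ⟧ m ≤ 1
        bit≤1 b rewrite valᵇ-correct R In b with valᵇ ρ σ b
        ... | true  = s≤s z≤n
        ... | false = z≤n

        fits  : ∀ (e : Ex d) → Fits m μ (growth ⌜ e ⌝) ⌜ e ⌝
        fitsᵇ : ∀ (b : Bx d) → Fits m μ (growth ⌜ b ⌝ᵇ) ⌜ b ⌝ᵇ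
        fits (lit n)       = fits-lit n
        fits len           = fits-reserved sizes 0
        fits (var x)       = fits-reserved sizes (suc (slot x))
        fits (inp k e)     = fits-input sizes k ⌜ e ⌝ (fits e)
        fits (tbl j e)     = fits-mem sizes (fits-address sizes j ⌜ e ⌝ (fits e))
        fits (e ⊞ e′)      = fits-add (fits e) (fits e′)
        fits (e ⊟ e′)      = fits-sub (fits e) (fits e′)
        fits (inp* k e e′) = fits-mul
          (small (subst (_< 2 ^ ω) (sym (input-eval R In k ⌜ e ⌝ refl)) (input< k _)))
          (fits-input sizes k ⌜ e ⌝ (fits e)) (fits e′)
        fits (len* e)      = fits-mul
          (small (subst (_< 2 ^ ω) (sym (len-eval R)) T<2^ω)) (fits-reserved sizes 0) (fits e)
        fits (cond b e e′) = fits-add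
          (fits-mul (bit-small (bit≤1 b)) (fitsᵇ b) (fits e))
          (fits-mul (bit-small (m∸n≤m 1 (⟦ ⌜ b ⌝ᵇ ⟧ m)))
            (fits-sub (fits-lit 1) (fitsᵇ b)) (fits e′))
        fitsᵇ (le e e′)    = fits-sub (fits-lit 1) (fits-sub (fits e) (fits e′))
        fitsᵇ (and b b′)   = fits-mul (bit-small (bit≤1 b)) (fitsᵇ b) (fitsᵇ b′)
        fitsᵇ (neg b)      = fits-sub (fits-lit 1) (fitsᵇ b)

      weaken-sizes : ∀ {d} {ρ : Vec ℕ d} {σ m μ μ′} → μ ≤ μ′ → Represents ρ σ m μ → Represents ρ σ m μ′
      weaken-sizes μ≤μ′ R = record
        { Represents R ; sizes = λ a → <2^-mono μ≤μ′ (Represents.sizes R a) ; ω≤μ = ≤-trans (Represents.ω≤μ R) μ≤μ′ }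

      forget : ∀ {d} {ρ : Vec ℕ d} {v σ m μ} → Represents (v ∷ ρ) σ m μ → Represents ρ σ m μ
      forget R = record { Represents R ; variables = λ x → Represents.variables R (Fin.suc x) }

      update-sizes : ∀ {m : Memory} {μ v} a → (∀ b → m b < 2 ^ μ) → v < 2 ^ μ → ∀ b → (m [ a ↦ v ]) b < 2 ^ μ
      update-sizes {m} {μ} {v} a sizes v< b with b ≟ a
      ... | yes refl = subst (_< 2 ^ μ) (sym (update-same m a v)) v<
      ... | no b≢a   = subst (_< 2 ^ μ) (sym (update-other m v b≢a)) (sizes b)

      low-unchanged : ∀ {m : Memory} {a} j n v → a ≤ 6 * T → (m [ cell j n ↦ v ]) a ≡ m a
      low-unchanged {m} j n v a≤ = update-other m v (low≢cell j n a≤)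

      inputs-unchanged : ∀ m j n v → Inputs m → Inputs (m [ cell j n ↦ v ])
      inputs-unchanged m j n v In k s s<T = trans (low-unchanged {m} j n v (input-address k s s<T)) (In k s s<T)

      module _ {d} {ρ : Vec ℕ d} {σ : State} {m : Memory} {μ : ℕ} (R : Represents ρ σ m μ) where
        open Represents R

        private
          0<radix : 0 < radix
          0<radix = s≤s z≤n

          table<radix : ∀ (j : Fin w) → suc (toℕ j) < radix
          table<radix j = s≤s (Fin.toℕ<n j)

          reserved-other : ∀ {n n′} v → n′ ≢ n → (m [ cell 0 n ↦ v ]) (cell 0 n′) ≡ m (cell 0 n′)
          reserved-other v n′≢n = update-other m v λ eq → n′≢n (proj₁ (cell-injective 0<radix 0<radix eq))

        set-reserved : ∀ {d′} {ρ′ : Vec ℕ d′} n v → v < 2 ^ μ →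
          (∀ x → (m [ cell 0 (suc n) ↦ v ]) (cell 0 (suc (slot x))) ≡ lookup ρ′ x) →
          Represents ρ′ σ (m [ cell 0 (suc n) ↦ v ]) μ
        set-reserved n v v< vars = record
          { base      = trans (low-unchanged {m} 0 (suc n) v z≤n) base
          ; extent    = trans (reserved-other v λ ()) extent
          ; variables = vars
          ; tables    = λ j k → trans (update-other m v λ eq → 1+n≢0 (proj₂ (cell-injective (table<radix j) 0<radix eq))) (tables j k)
          ; sizes     = update-sizes {μ = μ} (cell 0 (suc n)) sizes v<
          ; ω≤μ       = ω≤μ
          }

        set-new : ∀ v → v < 2 ^ μ → Represents (v ∷ ρ) σ (m [ cell 0 (suc d) ↦ v ]) μ
        set-new v v< = set-reserved d v v< λ where
          Fin.zero    → update-same m (cell 0 (suc d)) v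
          (Fin.suc x) → trans (reserved-other v λ eq → <⇒≢ (slot< x) (suc-injective eq)) (variables x)

        set-table : ∀ j n v → v < 2 ^ μ → Represents ρ (σ ⟨ j , n ≔ v ⟩) (m [ cell (suc (toℕ j)) n ↦ v ]) μ
        set-table j n v v< = record
          { base      = trans (low-unchanged {m} (suc (toℕ j)) n v z≤n) base
          ; extent    = trans (other 0) extent
          ; variables = λ x → trans (other (suc (slot x))) (variables x)
          ; tables    = tabs
          ; sizes     = update-sizes {μ = μ} (cell (suc (toℕ j)) n) sizes v<
          ; ω≤μ       = ω≤μ
          }
          where
          other : ∀ k → (m [ cell (suc (toℕ j)) n ↦ v ]) (cell 0 k) ≡ m (cell 0 k)
          other k = update-other m v λ eq → 1+n≢0 (sym (proj₂ (cell-injective {n = k} 0<radix (table<radix j) eq)))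
          tabs : ∀ j′ n′ → (m [ cell (suc (toℕ j)) n ↦ v ]) (cell (suc (toℕ j′)) n′) ≡ (σ ⟨ j , n ≔ v ⟩) j′ n′
          tabs j′ n′ with j′ Fin.≟ j | n′ ≟ n
          ... | no j′≢j  | _        = trans (update-other m v λ eq → j′≢j (Fin.toℕ-injective (suc-injective
                  (proj₂ (cell-injective {n = n′} (table<radix j′) (table<radix j) eq))))) (tables j′ n′)
          ... | yes refl | yes refl = trans (update-same m (cell (suc (toℕ j)) n) v) (sym (update-same (σ j) n v))
          ... | yes refl | no n′≢n  = trans (update-other m v λ eq → n′≢n
                  (proj₁ (cell-injective {n = n′} (table<radix j) (table<radix j) eq)))
                  (trans (tables j n′) (sym (update-other (σ j) v n′≢n)))

      -- In the loop of a `fold` the index is bound above the accumulator, so it is the second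
      -- variable that each round replaces.
      set-second : ∀ {d} {ρ : Vec ℕ d} {i a σ m μ} → Represents (i ∷ a ∷ ρ) σ m μ → ∀ v → v < 2 ^ μ →
        Represents (i ∷ v ∷ ρ) σ (m [ cell 0 (suc d) ↦ v ]) μ
      set-second {d} {m = m} R v v< = set-reserved R d v v< λ where
          Fin.zero              → trans (other (suc d) λ eq → 1+n≢n eq) (Represents.variables R Fin.zero)
          (Fin.suc Fin.zero)    → update-same m (cell 0 (suc d)) v
          (Fin.suc (Fin.suc x)) → trans (other (slot x) (<⇒≢ (slot< x))) (Represents.variables R (Fin.suc (Fin.suc x)))
        where
        other : ∀ n → n ≢ d → (m [ cell 0 (suc d) ↦ v ]) (cell 0 (suc n)) ≡ m (cell 0 (suc n))
        other n n≢d = update-other m v λ eq →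
          n≢d (suc-injective (proj₁ (cell-injective {n = suc n} (s≤s z≤n) (s≤s z≤n) eq)))

      Runs : ∀ {d} → (Memory → Set) → Program → Memory → Vec ℕ d → State → ℕ → ℕ → Set
      Runs J P m ρ σ μ B = ∃ λ m′ → ∃ λ t → ⟨ P , m ⟩⇓⟨ m′ , t ⟩ × Represents ρ σ m′ μ × J m′ × t ≤ B

      β-β : ∀ μ n n′ → β (β μ n) n′ ≡ β μ (n + n′)
      β-β μ n n′ = trans (+-assoc μ (ω * n) (ω * n′)) (cong (μ +_) (sym (*-distribˡ-+ ω n n′)))

      cost-fits : ∀ {m μ B e k} → Fits m μ (growth e) e → weight e ≤ k → β μ k ≤ B → cost e m ≤ weight e * suc B
      cost-fits {m} {μ} {B} {e} {k} (fit p) e≤k β≤B = ≤-trans (cost≤ p)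
        (*-mono-≤ (m≤m+n (nodes e) (growth e)) (s≤s (≤-trans (β-mono μ (≤-trans (m≤n+m (growth e) (nodes e)) e≤k)) β≤B)))

      fits-value : ∀ {m μ n e v} k → ⟦ e ⟧ m ≡ v → Fits m μ n e → n ≤ k → v < 2 ^ β μ k
      fits-value {μ = μ} k refl (fit p) n≤k = <2^-mono (β-mono μ n≤k) (value< p)

      assignment-cost : ∀ {m μ B} a e → Fits m μ (growth a) a → Fits m μ (growth e) e →
        β μ (weight a + weight e) ≤ B → cost a m + cost e m ≤ (weight a + weight e) * suc B
      assignment-cost {B = B} a e p q β≤B = ≤-trans
        (+-mono-≤ (cost-fits {e = a} p (m≤m+n (weight a) (weight e)) β≤B) (cost-fits {e = e} q (m≤n+m (weight e) (weight a)) β≤B))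
        (≤-reflexive (sym (*-distribʳ-+ (suc B) (weight a) (weight e))))

      <T⇒< : ∀ {i μ} → ω ≤ μ → i ≤ T → i < 2 ^ μ
      <T⇒< ω≤μ i≤T = <2^-mono ω≤μ (≤-<-trans i≤T T<2^ω)

      assign′ : ∀ {a e m x v} → ⟦ a ⟧ m ≡ x → ⟦ e ⟧ m ≡ v → ⟨ a ≔ e , m ⟩⇓⟨ m [ x ↦ v ] , cost a m + cost e m ⟩
      assign′ refl refl = assign

      -- Serves every counted loop: `for` changes the state and keeps the environment, `fold` keeps
      -- the state and changes the accumulator in the environment. `J` stands for the inputs or, in
      -- the final copying, for the part copied so far.
      module _ {d} (P : Program) (ρs : ℕ → Vec ℕ d) (σs : ℕ → State) (μ k B : ℕ) (β≤B : β μ (loopWork T d k) ≤ B)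
        (J : ℕ → Memory → Set) (J-stable : ∀ i m v → J i m → J i (m [ cell 0 (suc d) ↦ v ]))
        (body : ∀ i m → i < T → Represents (i ∷ ρs i) (σs i) m (β μ (i * k)) → J i m →
                Runs (J (suc i)) P m (i ∷ ρs (suc i)) (σs (suc i)) (β μ (suc i * k)) (k * suc B)) where

        private
          test : Expr
          test = reserved 0 ⊖ reserved (suc d)
          step : Program
          step = P ⨾ variable-address d ≔ reserved (suc d) ⊕ lit 1
          wt wi wa : ℕ
          wt = weight test
          wi = weight (variable-address d) + weight (reserved (suc d) ⊕ lit 1)
          wa = weight (variable-address d) + weight (lit 0)

          loop-bound : ∀ n → n ≤ T * (wt + (k + wi)) → n + wt ≤ loopWork T d k
          loop-bound n n≤ = ≤-trans (≤-reflexive (+-comm n wt)) (≤-trans (+-monoʳ-≤ wt n≤) (m≤n+m _ wa))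

          test-bound : ∀ i → i ≤ T → i * k + wt ≤ loopWork T d k
          test-bound i i≤T = loop-bound (i * k) (*-mono-≤ i≤T (≤-trans (m≤m+n k wi) (m≤n+m (k + wi) wt)))

          step-bound : ∀ i → i < T → suc i * k + wi ≤ loopWork T d k
          step-bound i i<T = ≤-trans (≤-trans (+-mono-≤ (*-monoˡ-≤ k i<T)
              (≤-trans (≤-reflexive (sym (*-identityˡ wi))) (*-monoˡ-≤ wi (≤-trans (s≤s z≤n) i<T))))
              (≤-trans (≤-reflexive (sym (*-distribˡ-+ T k wi))) (*-monoʳ-≤ T (m≤n+m (k + wi) wt))))
            (≤-trans (m≤n+m _ wt) (m≤n+m _ wa))

          within : ∀ n n′ → n + n′ ≤ loopWork T d k → β (β μ n) n′ ≤ B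
          within n n′ n+n′≤ = ≤-trans (≤-reflexive (β-β μ n n′)) (≤-trans (β-mono μ n+n′≤) β≤B)

          fits-test : ∀ {m μ} → (∀ a → m a < 2 ^ μ) → Fits m μ (growth test) test
          fits-test sizes = fits-sub (fits-reserved sizes 0) (fits-reserved sizes (suc d))

          test-cost : ∀ {ρ : Vec ℕ (suc d)} {σ m i} → i ≤ T → Represents ρ σ m (β μ (i * k)) → cost test m ≤ wt * suc B
          test-cost {m = m} {i} i≤T R = cost-fits {μ = β μ (i * k)} {e = test} (fits-test (Represents.sizes R)) ≤-refl
            (within (i * k) wt (test-bound i i≤T))

          iterate : ∀ r i m → r + i ≡ T → Represents (i ∷ ρs i) (σs i) m (β μ (i * k)) → J i m →
            Runs (J T) (while test step) m (ρs T) (σs T) (β μ (T * k)) ((wt + r * (wt + (k + wi))) * suc B)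
          iterate zero    i m refl R In =
            m , cost test m , while-false (trans (cong₂ _∸_ (len-eval R) (var-eval R Fin.zero)) (n∸n≡0 T)) , forget R , In
            , ≤-trans (test-cost ≤-refl R) (≤-reflexive (cong (_* suc B) (sym (+-identityʳ wt))))
          iterate (suc r) i m eq R In with body i m i<T R In
            where
            i<T : i < T
            i<T = subst (suc i ≤_) eq (s≤s (m≤n+m i r))
          ... | m₁ , t₁ , run₁ , R₁ , In₁ , t₁≤ with iterate r (suc i) m₂ (trans (+-suc r i) eq) R₂ In₂
            where
            i<T : i < T
            i<T = subst (suc i ≤_) eq (s≤s (m≤n+m i r))
            m₂ : Memory
            m₂ = m₁ [ cell 0 (suc d) ↦ suc i ]
            R₂ : Represents (suc i ∷ ρs (suc i)) (σs (suc i)) m₂ (β μ (suc i * k))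
            R₂ = set-new (forget R₁) (suc i) (<T⇒< (Represents.ω≤μ R₁) i<T)
            In₂ : J (suc i) m₂
            In₂ = J-stable (suc i) m₁ (suc i) In₁
          ... | m₃ , t₃ , run₃ , R₃ , In₃ , t₃≤ = m₃ , _ , while-true nonzero (seq run₁ incr) run₃ , R₃ , In₃ , total
            where
            i<T : i < T
            i<T = subst (suc i ≤_) eq (s≤s (m≤n+m i r))
            nonzero : ⟦ test ⟧ m ≢ 0
            nonzero z = <⇒≢ (m<n⇒0<n∸m i<T) (sym (trans (sym (cong₂ _∸_ (len-eval R) (var-eval R Fin.zero))) z))
            incr : ⟨ variable-address d ≔ reserved (suc d) ⊕ lit 1 , m₁ ⟩⇓⟨ m₁ [ cell 0 (suc d) ↦ suc i ]
              , cost (variable-address d) m₁ + cost (reserved (suc d) ⊕ lit 1) m₁ ⟩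
            incr = assign′ {variable-address d} {reserved (suc d) ⊕ lit 1} (variable-eval R₁ d)
              (trans (cong (_+ 1) (var-eval R₁ Fin.zero)) (+-comm i 1))
            incr≤ : cost (variable-address d) m₁ + cost (reserved (suc d) ⊕ lit 1) m₁ ≤ wi * suc B
            incr≤ = assignment-cost {μ = β μ (suc i * k)} (variable-address d) (reserved (suc d) ⊕ lit 1)
              (fits-variable (Represents.sizes R₁) d)
              (fits-add (fits-reserved (Represents.sizes R₁) (suc d)) (fits-lit 1))
              (within (suc i * k) wi (step-bound i i<T))
            arith : ∀ a b c e s → a * s + ((b * s + c * s) + e * s) ≡ (a + ((b + c) + e)) * s
            arith = solve-∀
            regroup : ∀ a b c → a + (b + (a + c)) ≡ a + ((a + b) + c)
            regroup = solve-∀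
            total = ≤-trans (+-mono-≤ (test-cost (<⇒≤ i<T) R) (+-mono-≤ (+-mono-≤ t₁≤ incr≤) t₃≤))
              (≤-reflexive (trans (arith wt k wi (wt + r * (wt + (k + wi))) (suc B))
                (cong (_* suc B) (regroup wt (k + wi) (r * (wt + (k + wi)))))))

        run-loop : ∀ m → Represents (ρs 0) (σs 0) m μ → J 0 m →
          Runs (J T) (countedLoop d P) m (ρs T) (σs T) (β μ (loopWork T d k)) (loopWork T d k * suc B)
        run-loop m R In with iterate T 0 (m [ cell 0 (suc d) ↦ 0 ]) (+-identityʳ T)
          (subst (Represents _ _ _) (sym μ≡) (set-new R 0 (m^n>0 2 μ))) (J-stable 0 m 0 In)
          where
          μ≡ : β μ 0 ≡ μ
          μ≡ = trans (cong (μ +_) (*-zeroʳ ω)) (+-identityʳ μ)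
        ... | m₁ , t , run₁ , R₁ , In₁ , t≤ = m₁ , _
          , seq (assign′ {variable-address d} {lit 0} (variable-eval R d) refl) run₁
          , weaken-sizes (β-mono μ (≤-trans (m≤m+n (T * k) wt) (test-bound T ≤-refl))) R₁ , In₁
          , ≤-trans (+-mono-≤ (assignment-cost {μ = μ} (variable-address d) (lit 0) (fits-variable (Represents.sizes R) d) (fits-lit 0)
                (≤-trans (β-mono μ (m≤m+n wa _)) β≤B)) t≤)
              (≤-reflexive (sym (*-distribʳ-+ (suc B) wa (wt + T * (wt + (k + wi))))))

      -- The exponent bound `B` is fixed in advance for the whole program, so every unit of work
      -- costs at most `suc B`; `μ` grows along the way but never beyond `B`.
      run : ∀ {d} (c : Com d) ρ σ m μ B → Represents ρ σ m μ → Inputs m → β μ (work T c) ≤ B →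
        Runs Inputs (compile c) m ρ (exec c ρ σ) (β μ (work T c)) (work T c * suc B)
      run (asg j e e′) ρ σ m μ B R In β≤B = _ , _
        , assign′ {address j ⌜ e ⌝} {⌜ e′ ⌝} (trans (address-eval R j ⌜ e ⌝) (cong (cell (suc (toℕ j))) (val-correct R In e)))
            (val-correct R In e′)
        , set-table (weaken-sizes (m≤m+n μ _) R) j (val ρ σ e) (val ρ σ e′)
            (fits-value (work T (asg j e e′)) (val-correct R In e′) (fits R In e′) e′≤)
        , inputs-unchanged m (suc (toℕ j)) (val ρ σ e) (val ρ σ e′) In
        , assignment-cost (address j ⌜ e ⌝) ⌜ e′ ⌝ (fits-address (Represents.sizes R) j ⌜ e ⌝ (fits R In e)) (fits R In e′) β≤B
        where
        e′≤ : growth ⌜ e′ ⌝ ≤ weight (address j ⌜ e ⌝) + weight ⌜ e′ ⌝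
        e′≤ = ≤-trans (m≤n+m (growth ⌜ e′ ⌝) (nodes ⌜ e′ ⌝)) (m≤n+m (weight ⌜ e′ ⌝) (weight (address j ⌜ e ⌝)))
      run (c ⍮ c′) ρ σ m μ B R In β≤B
        with run c ρ σ m μ B R In (≤-trans (β-mono μ (m≤m+n (work T c) (work T c′))) β≤B)
      ... | m₁ , t₁ , run₁ , R₁ , In₁ , t₁≤
        with run c′ ρ (exec c ρ σ) m₁ (β μ (work T c)) B R₁ In₁ (≤-trans (≤-reflexive (β-β μ (work T c) (work T c′))) β≤B)
      ... | m₂ , t₂ , run₂ , R₂ , In₂ , t₂≤ = m₂ , _ , seq run₁ run₂
        , subst (Represents _ _ _) (β-β μ (work T c) (work T c′)) R₂ , In₂
        , ≤-trans (+-mono-≤ t₁≤ t₂≤) (≤-reflexive (sym (*-distribʳ-+ (suc B) (work T c) (work T c′))))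
      run (when b c) ρ σ m μ B R In β≤B with valᵇ ρ σ b in eq
      ... | true with run c ρ σ m μ B R In (≤-trans (β-mono μ (≤-trans (n≤1+n (work T c)) (m≤n+m _ (weight ⌜ b ⌝ᵇ)))) β≤B)
      ...   | m₁ , t₁ , run₁ , R₁ , In₁ , t₁≤ = m₁ , _ , if-true (λ z → 1+n≢0 (trans (sym isTrue) z)) run₁
        , weaken-sizes (β-mono μ (≤-trans (n≤1+n (work T c)) (m≤n+m _ (weight ⌜ b ⌝ᵇ)))) R₁ , In₁
        , ≤-trans (+-mono-≤ (cost-fits {e = ⌜ b ⌝ᵇ} (fitsᵇ R In b) (m≤m+n (weight ⌜ b ⌝ᵇ) _) β≤B)
            (≤-trans t₁≤ (*-monoˡ-≤ (suc B) (n≤1+n (work T c)))))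
          (≤-reflexive (sym (*-distribʳ-+ (suc B) (weight ⌜ b ⌝ᵇ) (suc (work T c)))))
        where
        isTrue : ⟦ ⌜ b ⌝ᵇ ⟧ m ≡ 1
        isTrue = trans (valᵇ-correct R In b) (cong (toBit R) eq)
      run (when b c) ρ σ m μ B R In β≤B | false = m , _ , if-false (trans (valᵇ-correct R In b) (cong (toBit R) eq)) skip
        , weaken-sizes (m≤m+n μ _) R , In
        , ≤-trans (+-mono-≤ (cost-fits {e = ⌜ b ⌝ᵇ} (fitsᵇ R In b) (m≤m+n (weight ⌜ b ⌝ᵇ) _) β≤B)
            (≤-trans (s≤s z≤n) (m≤m+n (suc B) (work T c * suc B))))
          (≤-reflexive (sym (*-distribʳ-+ (suc B) (weight ⌜ b ⌝ᵇ) (suc (work T c)))))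
      run {d} (for c) ρ σ m μ B R In β≤B = run-loop (compile c) (λ _ → ρ) (λ i → loop i (λ i → exec c (i ∷ ρ)) σ)
        μ (work T c) B β≤B (λ _ → Inputs) (λ _ m v → inputs-unchanged m 0 (suc d) v) body m R In
        where
        body : ∀ i m → i < T → Represents (i ∷ ρ) (loop i (λ i → exec c (i ∷ ρ)) σ) m (β μ (i * work T c)) → Inputs m →
          Runs Inputs (compile c) m (i ∷ ρ) (loop (suc i) (λ i → exec c (i ∷ ρ)) σ) (β μ (suc i * work T c)) (work T c * suc B)
        body≤ : ∀ i → i < T → suc i * work T c ≤ loopWork T d (work T c)
        body≤ i i<T = ≤-trans (*-mono-≤ i<T (≤-trans (m≤m+n (work T c) _) (m≤n+m _ (weight (reserved 0 ⊖ reserved (suc d))))))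
          (≤-trans (m≤n+m _ (weight (reserved 0 ⊖ reserved (suc d)))) (m≤n+m _ (weight (variable-address d) + weight (lit 0))))
        body i m i<T R In = m₁ , t₁ , run₁ , subst (Represents (i ∷ ρ) _ m₁) μ≡ R₁ , In₁ , t₁≤
          where
          μ≡ : β (β μ (i * work T c)) (work T c) ≡ β μ (suc i * work T c)
          μ≡ = trans (β-β μ (i * work T c) (work T c)) (cong (β μ) (+-comm (i * work T c) (work T c)))
          once : Runs Inputs (compile c) m (i ∷ ρ) (loop (suc i) (λ i → exec c (i ∷ ρ)) σ)
            (β (β μ (i * work T c)) (work T c)) (work T c * suc B)
          once = run c (i ∷ ρ) (loop i (λ i → exec c (i ∷ ρ)) σ) m (β μ (i * work T c)) B R In
            (≤-trans (≤-reflexive μ≡) (≤-trans (β-mono μ (body≤ i i<T)) β≤B))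
          m₁ = proj₁ once
          t₁ = proj₁ (proj₂ once)
          run₁ = proj₁ (proj₂ (proj₂ once))
          R₁ = proj₁ (proj₂ (proj₂ (proj₂ once)))
          In₁ = proj₁ (proj₂ (proj₂ (proj₂ (proj₂ once))))
          t₁≤ = proj₂ (proj₂ (proj₂ (proj₂ (proj₂ once))))
      run {d} (fold e₀ e c) ρ σ m μ B R In β≤B = m₃ , _ , seq run₁ (seq run₂ run₃)
        , subst (Represents _ _ _) μ≡ (forget R₃) , In₃
        , ≤-trans (+-mono-≤ t₁≤ (+-mono-≤ t₂≤ t₃≤)) (≤-reflexive (arith w₁ w₂ w₃ (suc B)))
        where
        w₁ k w₂ w₃ : ℕ
        w₁ = weight (variable-address d) + weight ⌜ e₀ ⌝
        k  = weight (variable-address d) + weight ⌜ e ⌝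
        w₂ = loopWork T (suc d) k
        w₃ = work T c
        arith : ∀ a b c s → a * s + (b * s + c * s) ≡ (a + (b + c)) * s
        arith = solve-∀

        acc : ℕ → ℕ
        acc n = loop n (λ i a → val (i ∷ a ∷ ρ) σ e) (val ρ σ e₀)

        m₁ : Memory
        m₁ = m [ cell 0 (suc d) ↦ acc 0 ]
        run₁ : ⟨ variable-address d ≔ ⌜ e₀ ⌝ , m ⟩⇓⟨ m₁ , cost (variable-address d) m + cost ⌜ e₀ ⌝ m ⟩
        run₁ = assign′ {variable-address d} {⌜ e₀ ⌝} (variable-eval R d) (val-correct R In e₀)
        R₁ : Represents (acc 0 ∷ ρ) σ m₁ (β μ w₁)
        R₁ = set-new (weaken-sizes (m≤m+n μ _) R) (acc 0)
          (fits-value w₁ (val-correct R In e₀) (fits R In e₀)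
            (≤-trans (m≤n+m (growth ⌜ e₀ ⌝) (nodes ⌜ e₀ ⌝)) (m≤n+m (weight ⌜ e₀ ⌝) (weight (variable-address d)))))
        In₁ : Inputs m₁
        In₁ = inputs-unchanged m 0 (suc d) (acc 0) In
        t₁≤ : cost (variable-address d) m + cost ⌜ e₀ ⌝ m ≤ w₁ * suc B
        t₁≤ = assignment-cost (variable-address d) ⌜ e₀ ⌝ (fits-variable (Represents.sizes R) d) (fits R In e₀)
          (≤-trans (β-mono μ (m≤m+n w₁ (w₂ + w₃))) β≤B)

        β₂≤B : β (β μ w₁) w₂ ≤ B
        β₂≤B = ≤-trans (≤-reflexive (β-β μ w₁ w₂)) (≤-trans (β-mono μ (+-monoʳ-≤ w₁ (m≤m+n w₂ w₃))) β≤B)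

        body≤ : ∀ i → i < T → suc i * k ≤ w₂
        body≤ i i<T = ≤-trans (*-mono-≤ i<T (≤-trans (m≤m+n k _) (m≤n+m _ (weight (reserved 0 ⊖ reserved (suc (suc d)))))))
          (≤-trans (m≤n+m _ (weight (reserved 0 ⊖ reserved (suc (suc d))))) (m≤n+m _ (weight (variable-address (suc d)) + weight (lit 0))))

        body : ∀ i m → i < T → Represents (i ∷ acc i ∷ ρ) σ m (β (β μ w₁) (i * k)) → Inputs m →
          Runs Inputs (variable-address d ≔ ⌜ e ⌝) m (i ∷ acc (suc i) ∷ ρ) σ (β (β μ w₁) (suc i * k)) (k * suc B)
        body i m i<T R In = _ , _ , assign′ {variable-address d} {⌜ e ⌝} (variable-eval R d) (val-correct R In e)
          , subst (Represents _ _ _) ν≡ (set-second (weaken-sizes (m≤m+n ν _) R) (acc (suc i))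
              (fits-value k (val-correct R In e) (fits R In e)
                (≤-trans (m≤n+m (growth ⌜ e ⌝) (nodes ⌜ e ⌝)) (m≤n+m (weight ⌜ e ⌝) (weight (variable-address d))))))
          , inputs-unchanged m 0 (suc d) (acc (suc i)) In
          , assignment-cost (variable-address d) ⌜ e ⌝ (fits-variable (Represents.sizes R) d) (fits R In e)
              (≤-trans (≤-reflexive ν≡) (≤-trans (β-mono (β μ w₁) (body≤ i i<T)) β₂≤B))
          where
          ν : ℕ
          ν = β (β μ w₁) (i * k)
          ν≡ : β ν k ≡ β (β μ w₁) (suc i * k)
          ν≡ = trans (β-β (β μ w₁) (i * k) k) (cong (β (β μ w₁)) (+-comm (i * k) k))

        second : Runs Inputs (countedLoop (suc d) (variable-address d ≔ ⌜ e ⌝)) m₁ (acc T ∷ ρ) σ (β (β μ w₁) w₂) (w₂ * suc B)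
        second = run-loop (variable-address d ≔ ⌜ e ⌝) (λ i → acc i ∷ ρ) (λ _ → σ) (β μ w₁) k B β₂≤B
          (λ _ → Inputs) (λ _ m v → inputs-unchanged m 0 (suc (suc d)) v) body m₁ R₁ In₁
        m₂ : Memory
        m₂ = proj₁ second
        run₂ = proj₁ (proj₂ (proj₂ second))
        R₂ : Represents (acc T ∷ ρ) σ m₂ (β (β μ w₁) w₂)
        R₂ = proj₁ (proj₂ (proj₂ (proj₂ second)))
        In₂ : Inputs m₂
        In₂ = proj₁ (proj₂ (proj₂ (proj₂ (proj₂ second))))
        t₂≤ = proj₂ (proj₂ (proj₂ (proj₂ (proj₂ second))))

        μ≡ : β (β (β μ w₁) w₂) w₃ ≡ β μ (w₁ + (w₂ + w₃))
        μ≡ = trans (cong (λ x → β x w₃) (β-β μ w₁ w₂)) (trans (β-β μ (w₁ + w₂) w₃) (cong (β μ) (+-assoc w₁ w₂ w₃)))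

        third : Runs Inputs (compile c) m₂ (acc T ∷ ρ) (exec c (acc T ∷ ρ) σ) (β (β (β μ w₁) w₂) w₃) (w₃ * suc B)
        third = run c (acc T ∷ ρ) σ m₂ (β (β μ w₁) w₂) B R₂ In₂ (≤-trans (≤-reflexive μ≡) β≤B)
        m₃ : Memory
        m₃ = proj₁ third
        run₃ = proj₁ (proj₂ (proj₂ third))
        R₃ : Represents (acc T ∷ ρ) (exec c (acc T ∷ ρ) σ) m₃ (β (β (β μ w₁) w₂) w₃)
        R₃ = proj₁ (proj₂ (proj₂ (proj₂ third)))
        In₃ : Inputs m₃
        In₃ = proj₁ (proj₂ (proj₂ (proj₂ (proj₂ third))))
        t₃≤ = proj₂ (proj₂ (proj₂ (proj₂ (proj₂ third))))

  -- Input sizes, polynomials and the complete program.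

  -- Strong induction along `⌈ n /2⌉`, which lowers the logarithm by one and is at least half of
  -- `n`.
  n≤2^⌈log₂n⌉ : ∀ n → n ≤ 2 ^ ⌈log₂ n ⌉
  n≤2^⌈log₂n⌉ = <-rec _ λ where
      zero          _   → z≤n
      (suc zero)    _   → m^n>0 2 ⌈log₂ 1 ⌉
      (suc (suc n)) rec → step n (rec (⌈n/2⌉<n n))
    where
    step : ∀ n → let h = ⌈ suc (suc n) /2⌉ in h ≤ 2 ^ ⌈log₂ h ⌉ → suc (suc n) ≤ 2 ^ ⌈log₂ suc (suc n) ⌉
    step n ih = begin
      suc (suc n)             ≡⟨ ⌊n/2⌋+⌈n/2⌉≡n (suc (suc n)) ⟨
      ⌊ suc (suc n) /2⌋ + h   ≤⟨ +-monoˡ-≤ h (⌊n/2⌋≤⌈n/2⌉ (suc (suc n))) ⟩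
      h + h                   ≤⟨ +-mono-≤ ih ih ⟩
      2 ^ ⌈log₂ h ⌉ + 2 ^ ⌈log₂ h ⌉ ≡⟨ cong (2 ^ ⌈log₂ h ⌉ +_) (+-identityʳ _) ⟨
      2 ^ suc ⌈log₂ h ⌉       ≡⟨ cong (λ x → 2 ^ suc x) (⌈log₂⌈n/2⌉⌉≡⌈log₂n⌉∸1 (suc (suc n))) ⟩
      2 ^ suc (⌈log₂ suc (suc n) ⌉ ∸ 1) ≡⟨ cong (2 ^_) (m+[n∸m]≡n (⌈log₂⌉-mono-≤ {2} {suc (suc n)} (s≤s (s≤s z≤n)))) ⟩
      2 ^ ⌈log₂ suc (suc n) ⌉ ∎
      where
      open ≤-Reasoning
      h = ⌈ suc (suc n) /2⌉

  n<2^size : ∀ n → n < 2 ^ size n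
  n<2^size n = ≤-trans (n≤2^⌈log₂n⌉ (suc n)) (^-monoʳ-≤ 2 (n≤1+n ⌈log₂ suc n ⌉))

  load<2^inputSize : ∀ xs a → load xs a < 2 ^ inputSize xs
  load<2^inputSize []       a       = s≤s z≤n
  load<2^inputSize (x ∷ xs) zero    = <2^-mono (m≤m+n (size x) (inputSize xs)) (n<2^size x)
  load<2^inputSize (x ∷ xs) (suc a) = <2^-mono (m≤n+m (inputSize xs) (size x)) (load<2^inputSize xs a)

  length≤inputSize : ∀ xs → length xs ≤ inputSize xs
  length≤inputSize []       = z≤n
  length≤inputSize (x ∷ xs) = +-mono-≤ {1} {size x} (s≤s z≤n) (length≤inputSize xs)

  load-end : ∀ xs a → length xs ≤ a → load xs a ≡ 0
  load-end []       a       _         = refl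
  load-end (x ∷ xs) (suc a) (s≤s le) = load-end xs a le

  infixl 6 _+ₚ_
  infixl 7 _*ₚ_

  _+ₚ_ : Polynomial → Polynomial → Polynomial
  []      +ₚ q       = q
  (a ∷ p) +ₚ []      = a ∷ p
  (a ∷ p) +ₚ (b ∷ q) = (a + b) ∷ (p +ₚ q)

  eval-+ₚ : ∀ p q n → eval (p +ₚ q) n ≡ eval p n + eval q n
  eval-+ₚ []      q       n = refl
  eval-+ₚ (a ∷ p) []      n = sym (+-identityʳ _)
  eval-+ₚ (a ∷ p) (b ∷ q) n rewrite eval-+ₚ p q n = lemma a b n (eval p n) (eval q n)
    where
    lemma : ∀ a b n x y → a + b + n * (x + y) ≡ a + n * x + (b + n * y)
    lemma = solve-∀

  _*ₚ_ : Polynomial → Polynomial → Polynomial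
  []      *ₚ q = []
  (a ∷ p) *ₚ q = map (a *_) q +ₚ (0 ∷ (p *ₚ q))

  eval-map : ∀ a p n → eval (map (a *_) p) n ≡ a * eval p n
  eval-map a []      n = sym (*-zeroʳ a)
  eval-map a (b ∷ p) n rewrite eval-map a p n = lemma a b n (eval p n)
    where
    lemma : ∀ a b n x → a * b + n * (a * x) ≡ a * (b + n * x)
    lemma = solve-∀

  eval-*ₚ : ∀ p q n → eval (p *ₚ q) n ≡ eval p n * eval q n
  eval-*ₚ []      q n = refl
  eval-*ₚ (a ∷ p) q n rewrite eval-+ₚ (map (a *_) q) (0 ∷ (p *ₚ q)) n | eval-map a q n | eval-*ₚ p q n =
    lemma a n (eval p n) (eval q n)
    where
    lemma : ∀ a n x y → a * y + n * (x * y) ≡ (a + n * x) * y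
    lemma = solve-∀

  eval-mono : ∀ p {m n} → m ≤ n → eval p m ≤ eval p n
  eval-mono []      m≤n = z≤n
  eval-mono (a ∷ p) m≤n = +-monoʳ-≤ a (*-mono-≤ m≤n (eval-mono p m≤n))

  eval-const : ∀ a n → eval (a ∷ []) n ≡ a
  eval-const a n = trans (cong (a +_) (*-zeroʳ n)) (+-identityʳ a)

  module Polytime (w : ℕ) where
    open Language w

    const : ℕ → Polynomial
    const a = a ∷ []

    -- Prefixing the coefficient 0 multiplies by the variable, here the number `T` of rounds.
    loopPoly : ℕ → Polynomial → Polynomial
    loopPoly n k = const (weight (variable-address n) + weight (lit 0))
      +ₚ (const (weight (reserved 0 ⊖ reserved (suc n))) +ₚ (0 ∷ (const (weight (reserved 0 ⊖ reserved (suc n)))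
         +ₚ (k +ₚ const (weight (variable-address n) + weight (reserved (suc n) ⊕ lit 1))))))

    eval-loopPoly : ∀ n k T → eval (loopPoly n k) T ≡ loopWork T n (eval k T)
    eval-loopPoly n k T = trans (eval-+ₚ (const a) (const b +ₚ (0 ∷ r)) T) (cong₂ _+_ (eval-const a T)
        (trans (eval-+ₚ (const b) (0 ∷ r) T) (cong₂ (λ x y → x + T * y) (eval-const b T)
          (trans (eval-+ₚ (const b) (k +ₚ const c) T) (cong₂ _+_ (eval-const b T)
            (trans (eval-+ₚ k (const c) T) (cong (eval k T +_) (eval-const c T))))))))
      where
      a = weight (variable-address n) + weight (lit 0)
      b = weight (reserved 0 ⊖ reserved (suc n))
      c = weight (variable-address n) + weight (reserved (suc n) ⊕ lit 1)
      r = const b +ₚ (k +ₚ const c)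

    workPoly : ∀ {d} → Com d → Polynomial
    workPoly (asg j e e′)      = const (weight (address j ⌜ e ⌝) + weight ⌜ e′ ⌝)
    workPoly (c ⍮ c′)          = workPoly c +ₚ workPoly c′
    workPoly (when b c)        = const (suc (weight ⌜ b ⌝ᵇ)) +ₚ workPoly c
    workPoly {d} (for c)       = loopPoly d (workPoly c)
    workPoly {d} (fold e₀ e c) = const (weight (variable-address d) + weight ⌜ e₀ ⌝)
      +ₚ (loopPoly (suc d) (const (weight (variable-address d) + weight ⌜ e ⌝)) +ₚ workPoly c)

    eval-workPoly : ∀ {d} (c : Com d) T → eval (workPoly c) T ≡ work T c
    eval-workPoly (asg j e e′) T = eval-const (weight (address j ⌜ e ⌝) + weight ⌜ e′ ⌝) T
    eval-workPoly (c ⍮ c′) T = trans (eval-+ₚ (workPoly c) (workPoly c′) T) (cong₂ _+_ (eval-workPoly c T) (eval-workPoly c′ T))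
    eval-workPoly (when b c) T = trans (eval-+ₚ (const (suc (weight ⌜ b ⌝ᵇ))) (workPoly c) T)
      (trans (cong₂ _+_ (eval-const (suc (weight ⌜ b ⌝ᵇ)) T) (eval-workPoly c T)) (sym (+-suc (weight ⌜ b ⌝ᵇ) (work T c))))
    eval-workPoly {d} (for c) T = trans (eval-loopPoly d (workPoly c) T) (cong (loopWork T d) (eval-workPoly c T))
    eval-workPoly {d} (fold e₀ e c) T = trans (eval-+ₚ (const a) (l +ₚ workPoly c) T) (cong₂ _+_ (eval-const a T)
      (trans (eval-+ₚ l (workPoly c) T) (cong₂ _+_
        (trans (eval-loopPoly (suc d) (const b) T) (cong (loopWork T (suc d)) (eval-const b T))) (eval-workPoly c T))))
      where
      a = weight (variable-address d) + weight ⌜ e₀ ⌝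
      b = weight (variable-address d) + weight ⌜ e ⌝
      l = loopPoly (suc d) (const b)

    -- The input consists of `1 + 6 T + 2 (T + 1)²` numbers and fits below `8 (T + 1)²`. All cells
    -- from there on are 0, so the tables start out empty.
    baseAddress : Expr
    baseAddress = lit 8 ⊛ ((mem (lit 0) ⊕ lit 1) ⊛ (mem (lit 0) ⊕ lit 1))

    -- `T` is saved at the base address before cell 0, its place in the input, receives that
    -- address; cell 0 still holds `T` when the address is computed for the second time.
    prelude : Program
    prelude = baseAddress ≔ mem (lit 0) ⨾ lit 0 ≔ baseAddress

    module Output (out : Fin w) where
      copyTo copyFrom : Expr
      copyTo   = lit 1 ⊕ reserved 1
      copyFrom = mem (address out (lit 1 ⊕ reserved 1))

      -- The loop copies the entries from index 1 on. Index 0 comes last, because until then cell 0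
      -- holds the base address through which the tables are reached.
      copyAll : Program
      copyAll = countedLoop 0 (copyTo ≔ copyFrom) ⨾ lit 0 ≔ mem (address out (lit 0))

      program : Com 0 → Program
      program c = prelude ⨾ compile c ⨾ copyAll

      firstWork secondWork preludeWork copyWork lastWork : ℕ
      firstWork = weight baseAddress + weight (mem (lit 0))
      secondWork = weight (lit 0) + weight baseAddress
      preludeWork = firstWork + secondWork
      copyWork = weight copyTo + weight copyFrom
      lastWork = weight (lit 0) + weight (mem (address out (lit 0)))

      totalWork : ℕ → Com 0 → ℕ
      totalWork T c = preludeWork + (work T c + (loopWork T 0 copyWork + lastWork))

      totalPoly : Com 0 → Polynomial
      totalPoly c = const preludeWork +ₚ (workPoly c +ₚ (loopPoly 0 (const copyWork) +ₚ const lastWork))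

      eval-totalPoly : ∀ c T → eval (totalPoly c) T ≡ totalWork T c
      eval-totalPoly c T = trans (eval-+ₚ (const preludeWork) (workPoly c +ₚ l) T) (cong₂ _+_ (eval-const preludeWork T)
        (trans (eval-+ₚ (workPoly c) l T) (cong₂ _+_ (eval-workPoly c T)
          (trans (eval-+ₚ (loopPoly 0 (const copyWork)) (const lastWork) T) (cong₂ _+_
            (trans (eval-loopPoly 0 (const copyWork) T) (cong (loopWork T 0) (eval-const copyWork T))) (eval-const lastWork T))))))
        where
        l = loopPoly 0 (const copyWork) +ₚ const lastWork

      -- Work `W` times `suc B`, where `B = n + n * W` is the exponent reached from `n` when every
      -- unit of work adds `n` bits.
      timePoly : Com 0 → Polynomial
      timePoly c = totalPoly c *ₚ ((1 ∷ 1 ∷ []) +ₚ (0 ∷ totalPoly c))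

      eval-timePoly : ∀ c n → eval (timePoly c) n ≡ eval (totalPoly c) n * suc (n + n * eval (totalPoly c) n)
      eval-timePoly c n = trans (eval-*ₚ (totalPoly c) ((1 ∷ 1 ∷ []) +ₚ (0 ∷ totalPoly c)) n)
        (cong (eval (totalPoly c) n *_) (trans (eval-+ₚ (1 ∷ 1 ∷ []) (0 ∷ totalPoly c) n)
          (cong (λ x → suc x + n * eval (totalPoly c) n) (lemma n))))
        where
        lemma : ∀ n → n * (1 + n * 0) ≡ n
        lemma = solve-∀

      module Execution (T : ℕ) (xs : List ℕ) (T≡ : load xs 0 ≡ T) (T≤n : T ≤ inputSize xs) (0<n : 0 < inputSize xs)
        (length≤H : length xs ≤ 8 * ((T + 1) * (T + 1))) (c : Com 0) where

        H n : ℕ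
        H = 8 * ((T + 1) * (T + 1))
        n = inputSize xs

        input : Fin 6 → ℕ → ℕ
        input k s = if suc s ≤ᵇ T then load xs (6 * s + suc (toℕ k)) else 0

        private
          input-end : ∀ k s → T ≤ s → input k s ≡ 0
          input-end k s T≤s rewrite ≰⇒≤ᵇ (s≤s T≤s) = refl

          input< : ∀ k s → input k s < 2 ^ n
          input< k s with suc s ≤ᵇ T
          ... | true  = load<2^inputSize xs _
          ... | false = m^n>0 2 n

          T<2^n : T < 2 ^ n
          T<2^n = subst (_< 2 ^ n) T≡ (load<2^inputSize xs 0)

          6T<H : 6 * T < H
          6T<H = begin-strict
            6 * T             ≤⟨ *-monoˡ-≤ T (m≤m+n 6 2) ⟩
            8 * T             <⟨ *-monoʳ-< 8 (m<m+n T {1} (s≤s z≤n)) ⟩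
            8 * (T + 1)       ≤⟨ *-monoʳ-≤ 8 (m≤m*n (T + 1) (T + 1) {{>-nonZero (m≤n+m 1 T)}}) ⟩
            H                 ∎
            where open ≤-Reasoning

        open Semantics T input
        open Correctness T input input-end H 6T<H n 0<n T<2^n input<

        private
          W B : ℕ
          W = totalWork T c
          B = β n W

          m₀ m₁ m₂ : Memory
          m₀ = load xs
          m₁ = m₀ [ H ↦ T ]
          m₂ = m₁ [ 0 ↦ H ]

          0≢H : 0 ≢ H
          0≢H = <⇒≢ (≤-<-trans z≤n 6T<H)

          m₁0 : m₁ 0 ≡ T
          m₁0 = trans (update-other m₀ T 0≢H) T≡

          sizes₀ : ∀ a → m₀ a < 2 ^ n
          sizes₀ = load<2^inputSize xs

          sizes₁ : ∀ a → m₁ a < 2 ^ n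
          sizes₁ = update-sizes {μ = n} H sizes₀ T<2^n

          base-value : ∀ m → m 0 ≡ T → ⟦ baseAddress ⟧ m ≡ H
          base-value m eq rewrite eq = refl

          fits-base : ∀ {m} → m 0 ≡ T → (∀ a → m a < 2 ^ n) → Fits m n (growth baseAddress) baseAddress
          fits-base {m} eq sizes = fits-mul (lit-small 8) (fits-lit 8) (fits-mul T+1-small T+1 T+1)
            where
            T+1 : Fits m n 2 (mem (lit 0) ⊕ lit 1)
            T+1 = fits-add (fits-mem sizes (fits-lit 0)) (fits-lit 1)
            T+1-small : m 0 + 1 < 2 ^ (n * 3)
            T+1-small = <2^-mono (≤-trans (β-suc 0 1) (*-monoʳ-≤ n (s≤s (s≤s z≤n))))
              (+-<2^ (n * 1) (subst (λ x → m 0 < 2 ^ x) (sym (*-identityʳ n)) (sizes 0)) (bit-small {n = 0} ≤-refl))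

          prelude-run : ⟨ prelude , m₀ ⟩⇓⟨ m₂ , (cost baseAddress m₀ + cost (mem (lit 0)) m₀) + (cost (lit 0) m₁ + cost baseAddress m₁) ⟩
          prelude-run = seq (assign′ {baseAddress} {mem (lit 0)} (base-value m₀ T≡) T≡)
            (assign′ {lit 0} {baseAddress} refl (base-value m₁ m₁0))

          prelude-cost : (cost baseAddress m₀ + cost (mem (lit 0)) m₀) + (cost (lit 0) m₁ + cost baseAddress m₁) ≤ preludeWork * suc B
          prelude-cost = ≤-trans (+-mono-≤
            (assignment-cost {m₀} {n} baseAddress (mem (lit 0)) (fits-base T≡ sizes₀) (fits-mem sizes₀ (fits-lit 0))
              (β-mono n {firstWork} {W} (≤-trans (m≤m+n firstWork secondWork) prelude≤W)))
            (assignment-cost {m₁} {n} (lit 0) baseAddress (fits-lit 0) (fits-base m₁0 sizes₁)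
              (β-mono n {secondWork} {W} (≤-trans (m≤n+m secondWork firstWork) prelude≤W))))
            (≤-reflexive (sym (*-distribʳ-+ (suc B) firstWork secondWork)))
            where
            prelude≤W : preludeWork ≤ W
            prelude≤W = m≤m+n preludeWork (work T c + (loopWork T 0 copyWork + lastWork))

          H≡ : cell 0 0 ≡ H
          H≡ = trans (cong (H +_) (trans (+-identityʳ _) (*-zeroʳ radix))) (+-identityʳ H)

          initial : Represents [] (λ _ _ → 0) m₂ (β n preludeWork)
          initial = record
            { base      = update-same m₁ 0 H
            ; extent    = trans (cong m₂ H≡) (trans (update-other m₁ H (λ eq → 0≢H (sym eq))) (update-same m₀ H T))
            ; variables = λ ()
            ; tables    = λ j k → trans (update-other m₁ H (λ eq → 0≢cell j k (sym eq))) (trans (update-other m₀ T (H≢cell j k))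
                            (load-end xs _ (≤-trans length≤H (m≤m+n H _))))
            ; sizes     = update-sizes {μ = β n preludeWork} 0 (λ a → <2^-mono (m≤m+n n _) (sizes₁ a))
                            (fits-value preludeWork (base-value m₁ m₁0) (fits-base m₁0 sizes₁)
                              (≤-trans (m≤n+m (growth baseAddress) (nodes baseAddress))
                                (≤-trans (m≤m+n (weight baseAddress) (weight (mem (lit 0)))) (m≤m+n firstWork secondWork))))
            ; ω≤μ       = m≤m+n n _
            }
            where
            0≢cell : ∀ (j : Fin w) k → 0 ≢ cell (suc (toℕ j)) k
            0≢cell j k = low≢cell (suc (toℕ j)) k z≤n
            H≢cell : ∀ (j : Fin w) k → cell (suc (toℕ j)) k ≢ H
            H≢cell j k eq = 1+n≢0 (proj₂ (cell-injective {n = k} {n′ = 0} (s≤s (Fin.toℕ<n j)) (s≤s z≤n) (trans eq (sym H≡))))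

          inputs : Inputs m₂
          inputs k s s<T rewrite ≤⇒≤ᵇ s<T = trans (update-other m₁ H nonzero)
            (update-other m₀ T (<⇒≢ (≤-<-trans (input-address k s s<T) 6T<H)))
            where
            nonzero : 6 * s + suc (toℕ k) ≢ 0
            nonzero eq = 1+n≢0 (trans (sym (+-suc (6 * s) (toℕ k))) eq)

          w₁ w₂ w₃ w₄ : ℕ
          w₁ = preludeWork
          w₂ = work T c
          w₃ = loopWork T 0 copyWork
          w₄ = lastWork

          within : ∀ k k′ → k + k′ ≤ W → β (β n k) k′ ≤ B
          within k k′ k+k′≤ = ≤-trans (≤-reflexive (β-β n k k′)) (β-mono n k+k′≤)

          σ : State
          σ = exec c [] (λ _ _ → 0)

          main : Runs Inputs (compile c) m₂ [] σ (β (β n w₁) w₂) (w₂ * suc B)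
          main = run c [] (λ _ _ → 0) m₂ (β n w₁) B initial inputs (within w₁ w₂ (+-monoʳ-≤ w₁ (m≤m+n w₂ _)))

          μ : ℕ
          μ = β (β n w₁) w₂

          set-low : ∀ {d} {ρ : Vec ℕ d} {m ν} a v → Represents ρ σ m ν → a ≤ 6 * T → a ≢ 0 → v < 2 ^ ν → Represents ρ σ (m [ a ↦ v ]) ν
          set-low {m = m} {ν} a v R a≤ a≢0 v< = record
            { base      = trans (update-other m v (λ eq → a≢0 (sym eq))) base
            ; extent    = trans (same 0 0) extent
            ; variables = λ x → trans (same 0 _) (variables x)
            ; tables    = λ j k → trans (same _ k) (tables j k)
            ; sizes     = update-sizes {μ = ν} a sizes v<
            ; ω≤μ       = ω≤μ
            }
            where
            open Represents R
            same : ∀ j k → (m [ a ↦ v ]) (cell j k) ≡ m (cell j k)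
            same j k = update-other m v λ eq → low≢cell j k a≤ (sym eq)

          Copied : ℕ → Memory → Set
          Copied i m = ∀ s → 0 < s → s ≤ i → s ≤ T → m s ≡ σ out s

          low : ∀ {s} → s ≤ T → s ≤ 6 * T
          low s≤T = ≤-trans s≤T (m≤m+n T (5 * T))

          copied-stable : ∀ i m v → Copied i m → Copied i (m [ cell 0 1 ↦ v ])
          copied-stable i m v copied s 0<s s≤i s≤T = trans (low-unchanged {m} 0 1 v (low s≤T)) (copied s 0<s s≤i s≤T)

          copy-body : ∀ i m → i < T → Represents (i ∷ []) σ m (β μ (i * copyWork)) → Copied i m →
            Runs (Copied (suc i)) (copyTo ≔ copyFrom) m (i ∷ []) σ (β μ (suc i * copyWork)) (copyWork * suc B)
          copy-body i m i<T R copied = m [ suc i ↦ v ] , _ , assign′ {copyTo} {copyFrom} to from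
            , set-low (suc i) v (weaken-sizes (β-mono μ (m≤n+m (i * copyWork) copyWork)) R) (low i<T) (λ ())
                (<2^-mono (β-mono μ (m≤n+m (i * copyWork) copyWork)) (subst (_< 2 ^ β μ (i * copyWork)) (tables out (suc i)) (sizes _)))
            , copied′
            , assignment-cost {m} {β μ (i * copyWork)} copyTo copyFrom
                (fits-add (fits-lit 1) (fits-reserved sizes 1))
                (fits-mem sizes (fits-address sizes out copyTo (fits-add (fits-lit 1) (fits-reserved sizes 1))))
                bound
            where
            open Represents R
            v : ℕ
            v = σ out (suc i)
            to : ⟦ copyTo ⟧ m ≡ suc i
            to = cong suc (var-eval R Fin.zero)
            from : ⟦ copyFrom ⟧ m ≡ v
            from = trans (cong m (address-eval R out copyTo)) (trans (tables out _) (cong (σ out) to))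
            copied′ : Copied (suc i) (m [ suc i ↦ v ])
            copied′ s 0<s s≤1+i s≤T with s ≟ suc i
            ... | yes refl = update-same m (suc i) v
            ... | no s≢    = trans (update-other m v s≢) (copied s 0<s (<⇒≤pred (≤∧≢⇒< s≤1+i s≢)) s≤T)
            step≤ : i * copyWork + copyWork ≤ w₃
            step≤ = ≤-trans (≤-reflexive (+-comm (i * copyWork) copyWork)) (≤-trans (*-mono-≤ i<T
              (≤-trans (m≤m+n copyWork _) (m≤n+m _ (weight (reserved 0 ⊖ reserved 1)))))
              (≤-trans (m≤n+m _ (weight (reserved 0 ⊖ reserved 1))) (m≤n+m _ (weight (variable-address 0) + weight (lit 0)))))
            bound : β (β μ (i * copyWork)) copyWork ≤ B
            bound = ≤-trans (≤-reflexive (trans (β-β μ (i * copyWork) copyWork) (cong (λ x → β x (i * copyWork + copyWork)) (β-β n w₁ w₂))))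
              (within (w₁ + w₂) _ (≤-trans (+-monoʳ-≤ (w₁ + w₂) step≤)
                (≤-trans (≤-reflexive (+-assoc w₁ w₂ w₃)) (+-monoʳ-≤ w₁ (+-monoʳ-≤ w₂ (m≤m+n w₃ w₄))))))

          m₃ : Memory
          m₃ = proj₁ main
          R₃ : Represents [] σ m₃ μ
          R₃ = proj₁ (proj₂ (proj₂ (proj₂ main)))

          copying : Runs (Copied T) (countedLoop 0 (copyTo ≔ copyFrom)) m₃ [] σ (β μ w₃) (w₃ * suc B)
          copying = run-loop (copyTo ≔ copyFrom) (λ _ → []) (λ _ → σ) μ copyWork B
            (≤-trans (≤-reflexive (cong (λ x → β x w₃) (β-β n w₁ w₂))) (within (w₁ + w₂) w₃
              (≤-trans (≤-reflexive (+-assoc w₁ w₂ w₃)) (+-monoʳ-≤ w₁ (+-monoʳ-≤ w₂ (m≤m+n w₃ w₄))))))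
            Copied copied-stable copy-body m₃ R₃ λ s 0<s s≤0 → contradiction s≤0 (<⇒≱ 0<s)

          m₄ m₅ : Memory
          m₄ = proj₁ copying
          m₅ = m₄ [ 0 ↦ σ out 0 ]
          R₄ : Represents [] σ m₄ (β μ w₃)
          R₄ = proj₁ (proj₂ (proj₂ (proj₂ copying)))

          last-run : ⟨ lit 0 ≔ mem (address out (lit 0)) , m₄ ⟩⇓⟨ m₅ , cost (lit 0) m₄ + cost (mem (address out (lit 0))) m₄ ⟩
          last-run = assign′ {lit 0} {mem (address out (lit 0))} refl
            (trans (cong m₄ (address-eval R₄ out (lit 0))) (Represents.tables R₄ out 0))

          last-cost : cost (lit 0) m₄ + cost (mem (address out (lit 0))) m₄ ≤ w₄ * suc B
          last-cost = assignment-cost {m₄} {β μ w₃} (lit 0) (mem (address out (lit 0))) (fits-lit 0)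
            (fits-mem (Represents.sizes R₄) (fits-address (Represents.sizes R₄) out (lit 0) (fits-lit 0)))
            (≤-trans (≤-reflexive (trans (β-β μ w₃ w₄) (trans (cong (λ x → β x (w₃ + w₄)) (β-β n w₁ w₂))
              (trans (β-β n (w₁ + w₂) (w₃ + w₄)) (cong (β n) (+-assoc w₁ w₂ (w₃ + w₄))))))) ≤-refl)

          time≤ : ∀ {t₁ t₂ t₃ t₄} → t₁ ≤ w₁ * suc B → t₂ ≤ w₂ * suc B → t₃ ≤ w₃ * suc B → t₄ ≤ w₄ * suc B →
            t₁ + (t₂ + (t₃ + t₄)) ≤ eval (timePoly c) n
          time≤ {t₁} {t₂} {t₃} {t₄} p₁ p₂ p₃ p₄ = begin
            t₁ + (t₂ + (t₃ + t₄))                                      ≤⟨ +-mono-≤ p₁ (+-mono-≤ p₂ (+-mono-≤ p₃ p₄)) ⟩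
            w₁ * suc B + (w₂ * suc B + (w₃ * suc B + w₄ * suc B))      ≡⟨ arith w₁ w₂ w₃ w₄ (suc B) ⟩
            W * suc B                                                  ≤⟨ *-mono-≤ W≤ (s≤s (+-monoʳ-≤ n (*-monoʳ-≤ n W≤))) ⟩
            eval (totalPoly c) n * suc (n + n * eval (totalPoly c) n)  ≡⟨ eval-timePoly c n ⟨
            eval (timePoly c) n                                        ∎
            where
            open ≤-Reasoning
            arith : ∀ a b c d s → a * s + (b * s + (c * s + d * s)) ≡ (a + (b + (c + d))) * s
            arith = solve-∀
            W≤ : W ≤ eval (totalPoly c) n
            W≤ = ≤-trans (≤-reflexive (sym (eval-totalPoly c T))) (eval-mono (totalPoly c) T≤n)

          result : ∀ s → s < T → m₅ s ≡ σ out s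
          result zero    _   = update-same m₄ 0 (σ out 0)
          result (suc s) s<T = trans (update-other m₄ {0} {suc s} (σ out 0) (λ ()))
            (proj₁ (proj₂ (proj₂ (proj₂ (proj₂ copying)))) (suc s) (s≤s z≤n) (<⇒≤ s<T) (<⇒≤ s<T))

        computes : ∃ λ m → ∃ λ t → ⟨ program c , load xs ⟩⇓⟨ m , t ⟩ × t ≤ eval (timePoly c) (inputSize xs)
          × (∀ s → s < T → m s ≡ exec c [] (λ _ _ → 0) out s)
        computes = m₅ , _
          , seq prelude-run (seq (proj₁ (proj₂ (proj₂ main))) (seq (proj₁ (proj₂ (proj₂ copying))) last-run))
          , time≤ prelude-cost (proj₂ (proj₂ (proj₂ (proj₂ (proj₂ main)))))
              (proj₂ (proj₂ (proj₂ (proj₂ (proj₂ copying))))) last-cost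
          , result

  loop-cong : ∀ {a} {A : Set a} n {f g : ℕ → A → A} {x} → (∀ i → i < n → ∀ y → f i y ≡ g i y) → loop n f x ≡ loop n g x
  loop-cong zero    eq = refl
  loop-cong (suc n) {f} {g} eq = trans (eq n (n<1+n n) _) (cong (g n) (loop-cong n λ i i<n → eq i (m<n⇒m<1+n i<n)))

  module Frame (w : ℕ) (T : ℕ) (input : Fin 6 → ℕ → ℕ) where
    open Language w
    open Semantics T input

    writes : ∀ {d} → Com d → Fin w → Bool
    writes (asg j _ _)  j′ = does (j′ Fin.≟ j)
    writes (c ⍮ c′)     j′ = writes c j′ ∨ writes c′ j′
    writes (when _ c)   j′ = writes c j′
    writes (for c)      j′ = writes c j′
    writes (fold _ _ c) j′ = writes c j′

    frame : ∀ {d} (c : Com d) j → writes c j ≡ false → ∀ ρ σ → exec c ρ σ j ≡ σ j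
    frame (asg j _ _) j′ eq ρ σ rewrite eq = refl
    frame (c ⍮ c′) j eq ρ σ with writes c j in eq₁ | writes c′ j in eq₂
    ... | false | false = trans (frame c′ j eq₂ ρ _) (frame c j eq₁ ρ σ)
    frame (when b c) j eq ρ σ with valᵇ ρ σ b
    ... | true  = frame c j eq ρ σ
    ... | false = refl
    frame (for c) j eq ρ σ = loop-invariant (λ _ σ′ → σ′ j ≡ σ j) T refl λ i σ′ _ eq′ → trans (frame c j eq (i ∷ ρ) σ′) eq′
    frame (fold e₀ e c) j eq ρ σ = frame c j eq _ σ

  -- The algorithm as a program.

  natOps : Ops _
  natOps = record { Number = ℕ ; plus = _+_ ; minus = _∸_ ; null = 0 ; leq = _≤ᵇ_ }

  open Language 11

  -- Levels are kept in tL, cut times in tX, cell starts in tS, choices in tA, picks in tP,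
  -- the common denominator of y in tD 0 and the current reduction in tE 0.
  pattern tC = 0F
  pattern tK = 1F
  pattern tY = 2F
  pattern tW = 3F
  pattern tL = 4F
  pattern tX = 5F
  pattern tS = 6F
  pattern tA = 7F
  pattern tP = 8F
  pattern tD = 9F
  pattern tE = Fin.suc 9F

  private
    variable
      d : ℕ

  v0 : Ex (1 + d)
  v0 = var 0F
  v1 : Ex (2 + d)
  v1 = var 1F
  v2 : Ex (3 + d)
  v2 = var 2F
  v3 : Ex (4 + d)
  v3 = var 3F

  eqE : Ex d → Ex d → Bx d
  eqE a b = and (le a b) (le b a)

  -- The numerators and denominators of C, K and y are the input rows 0/1, 2/3 and 4/5.
  scaled : Fin 11 → Fin 6 → Fin 6 → Com 1
  scaled j num den = fold (lit 1) (cond (eqE v0 v2) (inp* num v0 v1) (inp* den v0 v1)) (asg j v1 v0)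

  prepare : Com 0
  prepare = fold (lit 1) (inp* 5F v0 v1) (asg tD (lit 0) v0) ⍮
    for (scaled tC 0F 1F ⍮ scaled tK 2F 3F ⍮ scaled tY 4F 5F ⍮
         asg tW v0 (cond (le (tbl tD (lit 0)) (tbl tY v0)) (lit 0) (tbl tY v0))) ⍮
    -- The entry `tD 0` serves here merely as a positive number, which lifts `top` strictly above
    -- the total capacity.
    fold (tbl tD (lit 0)) (v1 ⊞ tbl tC v0) (asg tL (lit 0) v0)

  starts : Ex (suc d) → Com d
  starts τ = for (asg tS v0 (cond (le τ (tbl tX v0)) v0 (cond (le (lit 1) v0) (tbl tS (v0 ⊟ lit 1)) (lit 0))))

  nextLevel : Com 1
  nextLevel = fold (lit 0)
    (cond (and (neg (le (tbl tL v2) (tbl tC v0))) (neg (le (tbl tC v0) v1))) (tbl tC v0) v1)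
    (asg tL (lit 1 ⊞ v1) v0)

  activeE : Ex d → Ex d → Ex d
  activeE i s = cond (le (tbl tL (lit 1 ⊞ i)) (tbl tC s)) (tbl tW s) (lit 0)

  -- The starts are recomputed for every `x`, since a split at an earlier point of the same sweep
  -- may have moved them.
  splitAt : Com 2
  splitAt = starts (len ⊟ v2) ⍮
    fold (lit 0) (cond (and (eqE (tbl tS v0) (tbl tS v2)) (le (lit 1 ⊞ v0) v2)) (v1 ⊞ activeE v3 v0) v1)
    (fold (lit 0) (cond (and (eqE (tbl tS v0) (tbl tS v3)) (le v3 v0)) (v1 ⊞ activeE (var 4F) v0) v1)
    (when (and (le (tbl tD (lit 0)) v1) (le (tbl tD (lit 0)) v0)) (asg tX v2 (len ⊟ v3))))

  cutting : Com 0
  cutting = for (nextLevel ⍮ for splitAt)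

  -- Row `i` here has the mark `i + 1`; the level read is the one at `clock` of this mark.
  memberE : Ex d → Ex d → Ex d → Bx d
  memberE i p s = and (eqE (tbl tS s) p)
    (and (le (tbl tL (lit 1 ⊞ (len ⊟ (lit 1 ⊞ i)))) (tbl tC s)) (neg (le (tbl tW s) (lit 0))))

  -- The amount is read from `tE` because the cost of the chosen knapsack itself becomes 0 in the
  -- course of the sweep.
  subtract : Com 3
  subtract = for (when (memberE v3 v2 v0) (asg tK v0 (tbl tK v0 ⊟ tbl tE (lit 0))))

  -- The choice is stored at `T * i + p` at once: later reductions overwrite the costs it depends
  -- on, whereas the picks are made afterwards and in reverse order.
  reduceAt : Com 2
  reduceAt = when (le (lit 1 ⊞ v1) (tbl tX v0))
    (fold (lit 0) (cond (and (memberE v3 v2 v0) (neg (and (le (lit 1) v1) (le (tbl tK (v1 ⊟ lit 1)) (tbl tK v0)))))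
                     (lit 1 ⊞ v0) v1)
    (asg tA (len* v2 ⊞ v1) (v0 ⊟ lit 1) ⍮ asg tE (lit 0) (tbl tK (v0 ⊟ lit 1)) ⍮ subtract))

  reducing : Com 0
  reducing = for (starts (lit 1 ⊞ v1) ⍮ for reduceAt)

  pickAt : Com 2
  pickAt = when (le (lit 1 ⊞ (len ⊟ (lit 1 ⊞ v1))) (tbl tX (len ⊟ (lit 1 ⊞ v0))))
    (fold (lit 0) (cond (and (memberE (len ⊟ (lit 1 ⊞ v3)) (len ⊟ (lit 1 ⊞ v2)) v0) (le (lit 1) (tbl tP v0))) (lit 1) v1)
    (when (neg (le (lit 1) v0)) (asg tP (tbl tA (len* (len ⊟ (lit 1 ⊞ v2)) ⊞ (len ⊟ (lit 1 ⊞ v1)))) (lit 1))))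

  picking : Com 0
  picking = for (starts (lit 1 ⊞ (len ⊟ (lit 1 ⊞ v1))) ⍮ for pickAt)

  addForced : Com 0
  addForced = for (when (le (tbl tD (lit 0)) (tbl tY v0)) (asg tP v0 (lit 1)))

  rounding : Com 0
  rounding = prepare ⍮ cutting ⍮ reducing ⍮ picking ⍮ addForced

  -- The program computes the algorithm.

  module CommonDenominator (T : ℕ) (input : Fin 6 → ℕ → ℕ) where
    -- The numerator of `s` times all other denominators. This is the numerator over the common
    -- denominator, found without a division.
    product : Fin 6 → Fin 6 → ℕ → ℕ
    product num den s = loop T (λ t a → if t == s then input num t * a else input den t * a) 1

    denominator : Fin 6 → ℕ
    denominator den = loop T (λ t a → input den t * a) 1

    product-step : ∀ num den n s → n ≤ s →
      loop n (λ t a → if t == s then input num t * a else input den t * a) 1 ≡ loop n (λ t a → input den t * a) 1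
    product-step num den n s n≤s = loop-cong n λ t t<n a →
      cong (λ c → if c then input num t * a else input den t * a) (≢⇒== (<⇒≢ (<-≤-trans t<n n≤s)))

    -- Before index `s` the two partial products agree, at `s` one takes the numerator in place of
    -- the denominator, and all later factors are the same.
    product-* : ∀ num den s → s < T → product num den s * input den s ≡ input num s * denominator den
    product-* num den s s<T = go T s<T
      where
      part all : ℕ → ℕ
      part n = loop n (λ t a → if t == s then input num t * a else input den t * a) 1
      all n = loop n (λ t a → input den t * a) 1
      go : ∀ n → s < n → part n * input den s ≡ input num s * all n
      go (suc n) s<1+n with n ≟ s
      ... | yes refl rewrite ≡⇒== {n} refl | product-step num den n n ≤-refl =
        trans (*-assoc (input num n) (all n) (input den n)) (cong (input num n *_) (*-comm (all n) (input den n)))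
      ... | no n≢s rewrite ≢⇒== n≢s = begin
        input den n * part n * input den s   ≡⟨ *-assoc (input den n) (part n) (input den s) ⟩
        input den n * (part n * input den s) ≡⟨ cong (input den n *_) (go n (≤∧≢⇒< (<⇒≤pred s<1+n) λ eq → n≢s (sym eq))) ⟩
        input den n * (input num s * all n)  ≡⟨ *-assoc (input den n) (input num s) (all n) ⟨
        input den n * input num s * all n    ≡⟨ cong (_* all n) (*-comm (input den n) (input num s)) ⟩
        input num s * input den n * all n    ≡⟨ *-assoc (input num s) (input den n) (all n) ⟩
        input num s * (input den n * all n)  ∎
        where open ≡.≡-Reasoning

    denominator>0 : ∀ den → (∀ s → s < T → 0 < input den s) → 0 < denominator den
    denominator>0 den pos = loop-invariant (λ _ a → 0 < a) T (s≤s z≤n) λ t a t<T 0<a → *-mono-≤ (pos t t<T) 0<a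

  module Refinement (T : ℕ) (input : Fin 6 → ℕ → ℕ) where
    open Semantics T input
    open Frame 11 T input
    open CommonDenominator T input

    starts-spec : ∀ (τ : Ex (suc d)) t ρ σ → (∀ s σ → val (s ∷ ρ) σ τ ≡ t) →
      ∀ s → s < T → exec (starts τ) ρ σ tS s ≡ start (λ x → t ≤ᵇ σ tX x) s
    starts-spec {d} τ t ρ σ τ≡ s s<T = proj₂ (loop-invariant Inv T (refl , λ s ()) step) s s<T
      where
      X : ℕ → Bool
      X x = t ≤ᵇ σ tX x
      Inv : ℕ → State → Set
      Inv n σ′ = σ′ tX ≡ σ tX × (∀ s → s < n → σ′ tS s ≡ start X s)
      body : Com (suc d)
      body = asg tS v0 (cond (le τ (tbl tX v0)) v0 (cond (le (lit 1) v0) (tbl tS (v0 ⊟ lit 1)) (lit 0)))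
      value : ∀ n σ′ → Inv n σ′ →
        (if val (n ∷ ρ) σ′ τ ≤ᵇ σ′ tX n then n else (if 1 ≤ᵇ n then σ′ tS (n ∸ 1) else 0)) ≡ start X n
      value zero σ′ _ with val (zero ∷ ρ) σ′ τ ≤ᵇ σ′ tX zero
      ... | true  = refl
      ... | false = refl
      value (suc n) σ′ (eqX , eqS) rewrite τ≡ (suc n) σ′ | eqX | eqS n (n<1+n n) = refl
      step : ∀ n σ′ → n < T → Inv n σ′ → Inv (suc n) (exec body (n ∷ ρ) σ′)
      step n σ′ _ inv@(eqX , eqS) = eqX , λ s s<1+n → at s s<1+n (s ≟ n)
        where
        at : ∀ s → s < suc n → _ → exec body (n ∷ ρ) σ′ tS s ≡ start X s
        at s s<1+n (yes refl) = trans (update-same (σ′ tS) n _) (value n σ′ inv)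
        at s s<1+n (no s≢n)   = trans (update-other (σ′ tS) _ s≢n) (eqS s (≤∧≢⇒< (<⇒≤pred s<1+n) s≢n))

    -- The state left by `prepare` is a variable here, known only to have no cuts and no picks: the
    -- program follows the algorithm whatever numbers the other tables contain.
    module From (σ₁ : State) (uncut : σ₁ tX ≡ λ _ → 0) (unpicked : σ₁ tP ≡ λ _ → 0) where
      private
        one top : ℕ
        one = σ₁ tD 0
        top = σ₁ tL 0

      open Algorithm natOps T (σ₁ tC) (σ₁ tW) one top public
      open Rounding (σ₁ tK) public

      record Fixed (σ : State) : Set where
        field
          C≡ : σ tC ≡ σ₁ tC
          W≡ : σ tW ≡ σ₁ tW
          D≡ : σ tD ≡ σ₁ tD

      fixed-frame : ∀ (c : Com d) ρ {σ} → writes c tC ≡ false → writes c tW ≡ false → writes c tD ≡ false → Fixed σ → Fixed (exec c ρ σ)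
      fixed-frame c ρ wC wW wD fx = record
        { C≡ = trans (frame c tC wC ρ _) (Fixed.C≡ fx)
        ; W≡ = trans (frame c tW wW ρ _) (Fixed.W≡ fx)
        ; D≡ = trans (frame c tD wD ρ _) (Fixed.D≡ fx)
        }

      module _ (i : ℕ) where
        private
          τ r : ℕ
          τ = T ∸ i
          r = level (suc i)

        split-step : ∀ x σ → x < T → Fixed σ → σ tL (suc i) ≡ r → exec splitAt (x ∷ i ∷ []) σ tX ≡ split τ r x (σ tX)
        split-step x σ x<T fx L≡ = trans (result ((one′ ≤ᵇ pre) ∧ (one′ ≤ᵇ suf)))
            (trans (cong (λ f → if (one′ ≤ᵇ pre) ∧ (one′ ≤ᵇ suf) then f [ x ↦ τ ] else f) X≡)
              (cong (λ b → if b then σ tX [ x ↦ τ ] else σ tX) (cong₂ _∧_ (cong₂ _≤ᵇ_ D0 pre≡) (cong₂ _≤ᵇ_ D0 suf≡))))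
          where
          σ′ : State
          σ′ = exec (starts (len ⊟ v2)) (x ∷ i ∷ []) σ
          fx′ : Fixed σ′
          fx′ = fixed-frame (starts (len ⊟ v2)) (x ∷ i ∷ []) refl refl refl fx
          open Fixed fx′
          X : ℕ → Bool
          X = Cut (σ tX) τ
          X≡ : σ′ tX ≡ σ tX
          X≡ = frame (starts (len ⊟ v2)) tX refl (x ∷ i ∷ []) σ
          L≡′ : σ′ tL (suc i) ≡ r
          L≡′ = trans (cong (λ f → f (suc i)) (frame (starts (len ⊟ v2)) tL refl (x ∷ i ∷ []) σ)) L≡
          S≡ : ∀ s → s < T → σ′ tS s ≡ start X s
          S≡ = starts-spec (len ⊟ v2) τ (x ∷ i ∷ []) σ (λ _ _ → refl)
          one′ pre suf : ℕ
          one′ = σ′ tD 0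
          act : ℕ → ℕ
          act s = if σ′ tL (suc i) ≤ᵇ σ′ tC s then σ′ tW s else 0
          pre = loop T (λ s m → if (σ′ tS s == σ′ tS x) ∧ (suc s ≤ᵇ x) then m + act s else m) 0
          suf = loop T (λ s m → if (σ′ tS s == σ′ tS x) ∧ (x ≤ᵇ s) then m + act s else m) 0
          D0 : one′ ≡ one
          D0 = cong (λ f → f 0) D≡
          act≡ : ∀ s → act s ≡ active r s
          act≡ s rewrite L≡′ | C≡ | W≡ = refl
          pre≡ : pre ≡ before X r x
          pre≡ = loop-cong T λ s s<T m → cong₂ (λ b v → if b ∧ (suc s ≤ᵇ x) then m + v else m)
            (cong₂ _==_ (S≡ s s<T) (S≡ x x<T)) (act≡ s)
          suf≡ : suf ≡ after X r x
          suf≡ = loop-cong T λ s s<T m → cong₂ (λ b v → if b ∧ (x ≤ᵇ s) then m + v else m)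
            (cong₂ _==_ (S≡ s s<T) (S≡ x x<T)) (act≡ s)
          result : ∀ b → (if b then σ′ ⟨ tX , x ≔ τ ⟩ else σ′) tX ≡ (if b then σ′ tX [ x ↦ τ ] else σ′ tX)
          result true  = refl
          result false = refl

      record CutState (i : ℕ) (σ : State) : Set where
        field
          fixed  : Fixed σ
          levels : ∀ j → j ≤ i → σ tL j ≡ level j
          cuts   : σ tX ≡ cutTime i

      cutting-spec : CutState T (exec cutting [] σ₁)
      cutting-spec = loop-invariant CutState T
        (record { fixed = record { C≡ = refl ; W≡ = refl ; D≡ = refl } ; levels = λ { zero z≤n → refl } ; cuts = uncut }) step
        where
        step : ∀ i σ → i < T → CutState i σ → CutState (suc i) (exec (nextLevel ⍮ for splitAt) (i ∷ []) σ)
        step i σ i<T st = record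
          { fixed  = proj₁ swept
          ; levels = λ j j≤ → trans (cong (λ f → f j) (proj₁ (proj₂ swept))) (levels′ j j≤)
          ; cuts   = proj₂ (proj₂ swept)
          }
          where
          open CutState st
          σ′ : State
          σ′ = exec nextLevel (i ∷ []) σ
          fx′ : Fixed σ′
          fx′ = fixed-frame nextLevel (i ∷ []) refl refl refl fixed
          value : loop T (λ s m → if not (σ tL i ≤ᵇ σ tC s) ∧ not (σ tC s ≤ᵇ m) then σ tC s else m) 0 ≡ level (suc i)
          value rewrite levels i ≤-refl | Fixed.C≡ fixed = refl
          levels′ : ∀ j → j ≤ suc i → σ′ tL j ≡ level j
          levels′ j j≤ with j ≟ suc i
          ... | yes refl = trans (update-same (σ tL) (suc i) _) value
          ... | no j≢    = trans (update-other (σ tL) _ j≢) (levels j (<⇒≤pred (≤∧≢⇒< j≤ j≢)))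
          swept : Fixed (exec (for splitAt) (i ∷ []) σ′) × exec (for splitAt) (i ∷ []) σ′ tL ≡ σ′ tL
            × exec (for splitAt) (i ∷ []) σ′ tX ≡ cutTime (suc i)
          swept = loop-invariant
            (λ x τ → Fixed τ × τ tL ≡ σ′ tL × τ tX ≡ loop x (split (T ∸ i) (level (suc i))) (cutTime i)) T
            (fx′ , refl , cuts)
            λ x τ x<T (fx , L≡ , X≡) → fixed-frame splitAt (x ∷ i ∷ []) refl refl refl fx
              , trans (frame splitAt tL refl (x ∷ i ∷ []) τ) L≡
              , trans (split-step i x τ x<T fx (trans (cong (λ f → f (suc i)) L≡) (levels′ (suc i) ≤-refl)))
                  (cong (split (T ∸ i) (level (suc i)) x) X≡)

      cutState-frame : ∀ (c : Com d) ρ {σ} → writes c tC ≡ false → writes c tW ≡ false → writes c tD ≡ false →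
        writes c tL ≡ false → writes c tX ≡ false → CutState T σ → CutState T (exec c ρ σ)
      cutState-frame c ρ wC wW wD wL wX st = record
        { fixed  = fixed-frame c ρ wC wW wD fixed
        ; levels = λ j j≤ → trans (cong (λ f → f j) (frame c tL wL ρ _)) (levels j j≤)
        ; cuts   = trans (frame c tX wX ρ _) cuts
        }
        where open CutState st

      Starts : ℕ → State → Set
      Starts i σ = ∀ s → s < T → σ tS s ≡ start (CutAt (suc i)) s

      starts-ready : ∀ (τ : Ex (suc d)) i ρ σ → (∀ s σ → val (s ∷ ρ) σ τ ≡ suc i) → CutState T σ →
        CutState T (exec (starts τ) ρ σ) × Starts i (exec (starts τ) ρ σ)
      starts-ready τ i ρ σ τ≡ st = cutState-frame (starts τ) ρ refl refl refl refl refl st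
        , λ s s<T → trans (starts-spec τ (suc i) ρ σ τ≡ s s<T) (cong (λ f → start (Cut f (suc i)) s) (CutState.cuts st))

      member : ℕ → ℕ → ℕ → State → Bool
      member i p s σ = (σ tS s == p) ∧ ((σ tL (suc (T ∸ suc i)) ≤ᵇ σ tC s) ∧ not (σ tW s ≤ᵇ 0))

      member≡ : ∀ {i p s σ} → i < T → s < T → CutState T σ → Starts i σ → member i p s σ ≡ inCell (suc i) p s
      member≡ {i} {p} {s} {σ} i<T s<T st S≡
        rewrite S≡ s s<T | CutState.levels st (suc (T ∸ suc i)) (∸-monoʳ-< {T} (s≤s z≤n) i<T)
          | Fixed.C≡ (CutState.fixed st) | Fixed.W≡ (CutState.fixed st) = refl

      subtract-spec : ∀ {b p i} σ → i < T → CutState T σ → Starts i σ →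
        ∀ s → exec subtract (b ∷ p ∷ i ∷ []) σ tK s
          ≡ (if inCell (suc i) p s ∧ (suc s ≤ᵇ T) then σ tK s ∸ σ tE 0 else σ tK s)
      subtract-spec {b} {p} {i} σ i<T st S≡ = proj₂ (proj₂ (proj₂ (loop-invariant Inv T (st , S≡ , refl , first) step)))
        where
        new : ℕ → ℕ → ℕ
        -- The table is updated in place: after `n` rounds the entries below `n` are new and the
        -- others old.
        new n s = if inCell (suc i) p s ∧ (suc s ≤ᵇ n) then σ tK s ∸ σ tE 0 else σ tK s
        Inv : ℕ → State → Set
        Inv n σ′ = CutState T σ′ × Starts i σ′ × σ′ tE ≡ σ tE × (∀ s → σ′ tK s ≡ new n s)
        first : ∀ s → σ tK s ≡ new 0 s
        first s with inCell (suc i) p s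
        ... | true  = refl
        ... | false = refl
        body : Com 4
        body = when (memberE v3 v2 v0) (asg tK v0 (tbl tK v0 ⊟ tbl tE (lit 0)))
        new-other : ∀ n s → s ≢ n → new n s ≡ new (suc n) s
        new-other n s s≢n with suc s ≤? n
        ... | yes s<n rewrite ≤⇒≤ᵇ s<n | ≤⇒≤ᵇ (m<n⇒m<1+n s<n) = refl
        ... | no s≮n rewrite ≰⇒≤ᵇ (≰⇒> s≮n) | ≰⇒≤ᵇ (s≤s (≤∧≢⇒< (≮⇒≥ s≮n) λ eq → s≢n (sym eq))) = refl
        new-self : ∀ n → inCell (suc i) p n ≡ true → new (suc n) n ≡ σ tK n ∸ σ tE 0
        new-self n eq rewrite eq | ≤⇒≤ᵇ (≤-refl {suc n}) = refl
        new-not : ∀ n m → inCell (suc i) p n ≡ false → new m n ≡ σ tK n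
        new-not n m eq rewrite eq = refl
        old-self : ∀ n → new n n ≡ σ tK n
        old-self n rewrite ≰⇒≤ᵇ (n<1+n n) with inCell (suc i) p n
        ... | true  = refl
        ... | false = refl
        step : ∀ n σ′ → n < T → Inv n σ′ → Inv (suc n) (exec body (n ∷ b ∷ p ∷ i ∷ []) σ′)
        step n σ′ n<T (st , S≡ , E≡ , K≡) =
            cutState-frame body (n ∷ b ∷ p ∷ i ∷ []) refl refl refl refl refl st
          , (λ s s<T → trans (cong (λ f → f s) (frame body tS refl (n ∷ b ∷ p ∷ i ∷ []) σ′)) (S≡ s s<T))
          , trans (frame body tE refl (n ∷ b ∷ p ∷ i ∷ []) σ′) E≡
          , at (member i p n σ′) (member≡ {p = p} {σ = σ′} i<T n<T st S≡)
          where
          at : ∀ c → c ≡ inCell (suc i) p n → ∀ s → (if c then σ′ ⟨ tK , n ≔ σ′ tK n ∸ σ′ tE 0 ⟩ else σ′) tK s ≡ new (suc n) s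
          at c eq s with s ≟ n
          at true eq s | yes refl = trans (update-same (σ′ tK) n _)
            (trans (cong₂ (λ x f → x ∸ f 0) (trans (K≡ n) (old-self n)) E≡) (sym (new-self n (sym eq))))
          at false eq s | yes refl = trans (trans (K≡ n) (old-self n)) (sym (new-not n (suc n) (sym eq)))
          at true eq s | no s≢n = trans (update-other (σ′ tK) _ s≢n) (trans (K≡ s) (new-other n s s≢n))
          at false eq s | no s≢n = trans (K≡ s) (new-other n s s≢n)

      cheapest-cong : ∀ {τ p k k′} → (∀ s → k s ≡ k′ s) → cheapest τ p k ≡ cheapest τ p k′
      cheapest-cong {τ} {p} k≗ = loop-cong T λ s _ b →
        cong₂ (λ x y → if inCell τ p s ∧ not ((1 ≤ᵇ b) ∧ (x ≤ᵇ y)) then suc s else b) (k≗ (b ∸ 1)) (k≗ s)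

      -- Nothing is recorded where no cut is; `pickAt` makes the same test before it reads the
      -- entry.
      Args : ℕ → ℕ → State → Set
      Args i p σ = CutAt (suc i) p ≡ true → σ tA (T * i + p) ≡ choice i p

      record ColumnState (i p : ℕ) (σ : State) : Set where
        field
          cutState : CutState T σ
          starting : Starts i σ
          costs    : ∀ s → σ tK s ≡ cost′ i p s
          rows     : ∀ i′ p′ → i′ < i → p′ < T → Args i′ p′ σ
          columns  : ∀ p′ → p′ < p → Args i p′ σ

      reduce-step : ∀ i p σ → i < T → p < T → ColumnState i p σ → ColumnState i (suc p) (exec reduceAt (p ∷ i ∷ []) σ)
      reduce-step i p σ i<T p<T st = at (suc i ≤ᵇ σ tX p) (cong (λ f → suc i ≤ᵇ f p) (CutState.cuts cutState))
        where
        open ColumnState st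
        b δ : ℕ
        b = loop T (λ s b → if member i p s σ ∧ not ((1 ≤ᵇ b) ∧ (σ tK (b ∸ 1) ≤ᵇ σ tK s)) then suc s else b) 0
        δ = σ tK (b ∸ 1)
        b≡ : b ≡ cheapest (suc i) p (cost′ i p)
        b≡ = trans (loop-cong T λ s s<T b → cong (λ c → if c ∧ not ((1 ≤ᵇ b) ∧ (σ tK (b ∸ 1) ≤ᵇ σ tK s)) then suc s else b)
          (member≡ {p = p} {σ = σ} i<T s<T cutState starting)) (cheapest-cong costs)
        σ′ σ″ : State
        σ′ = σ ⟨ tA , T * i + p ≔ b ∸ 1 ⟩ ⟨ tE , 0 ≔ δ ⟩
        σ″ = exec subtract (b ∷ p ∷ i ∷ []) σ′
        cutState′ : CutState T σ′
        cutState′ = record { fixed = record { Fixed (CutState.fixed cutState) } ; levels = CutState.levels cutState ; cuts = CutState.cuts cutState }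

        args-other : ∀ i′ p′ → p′ < T → (i′ ≢ i ⊎ p′ ≢ p) → σ″ tA (T * i′ + p′) ≡ σ tA (T * i′ + p′)
        args-other i′ p′ p′<T ne = trans (cong (λ f → f (T * i′ + p′)) (frame subtract tA refl (b ∷ p ∷ i ∷ []) σ′))
          (update-other (σ tA) (b ∸ 1) λ eq → differ ne (radix-injective i′ i p′<T p<T eq))
          where
          differ : (i′ ≢ i ⊎ p′ ≢ p) → ¬ (i′ ≡ i × p′ ≡ p)
          differ (inj₁ ne) (eq , _) = ne eq
          differ (inj₂ ne) (_ , eq) = ne eq

        at : ∀ c → c ≡ CutAt (suc i) p → ColumnState i (suc p) (if c then σ″ else σ)
        at false eq = record
          { ColumnState st
          ; costs   = λ s → trans (costs s) (cong (λ c → if (c ∧ inCell (suc i) p s) ∧ (suc s ≤ᵇ T)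
              then cost′ i p s ∸ cost′ i p (cheapest (suc i) p (cost′ i p) ∸ 1) else cost′ i p s) eq)
          ; columns = cols
          }
          where
          cols : ∀ p′ → p′ < suc p → Args i p′ σ
          cols p′ p′<1+p with p′ ≟ p
          ... | yes refl = λ isCut → contradiction (trans eq isCut) λ ()
          ... | no p′≢p  = columns p′ (≤∧≢⇒< (<⇒≤pred p′<1+p) p′≢p)
        at true eq = record
          { cutState = cutState-frame subtract (b ∷ p ∷ i ∷ []) refl refl refl refl refl cutState′
          ; starting = λ s s<T → trans (cong (λ f → f s) (frame subtract tS refl (b ∷ p ∷ i ∷ []) σ′)) (starting s s<T)
          ; costs    = λ s → trans (subtract-spec {b} {p} {i} σ′ i<T cutState′ starting s) (reduced s)
          ; rows     = λ i′ p′ i′<i p′<T isCut → trans (args-other i′ p′ p′<T (inj₁ (<⇒≢ i′<i))) (rows i′ p′ i′<i p′<T isCut)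
          ; columns  = cols
          }
          where
          δ≡ : δ ≡ cost′ i p (cheapest (suc i) p (cost′ i p) ∸ 1)
          δ≡ = trans (costs (b ∸ 1)) (cong (λ x → cost′ i p (x ∸ 1)) b≡)
          reduced : ∀ s → (if inCell (suc i) p s ∧ (suc s ≤ᵇ T) then σ tK s ∸ δ else σ tK s) ≡ reduce (suc i) p (cost′ i p) s
          reduced s = trans (cong₂ (λ x y → if inCell (suc i) p s ∧ (suc s ≤ᵇ T) then x ∸ y else x) (costs s) δ≡)
            (cong (λ c → if (c ∧ inCell (suc i) p s) ∧ (suc s ≤ᵇ T)
              then cost′ i p s ∸ cost′ i p (cheapest (suc i) p (cost′ i p) ∸ 1) else cost′ i p s) eq)
          cols : ∀ p′ → p′ < suc p → Args i p′ σ″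
          cols p′ p′<1+p with p′ ≟ p
          ... | yes refl = λ _ → trans (cong (λ f → f (T * i + p)) (frame subtract tA refl (b ∷ p ∷ i ∷ []) σ′))
                  (trans (update-same (σ tA) (T * i + p) (b ∸ 1)) (cong (_∸ 1) b≡))
          ... | no p′≢p  = λ isCut → trans (args-other i p′ (≤-trans p′<1+p p<T) (inj₂ p′≢p))
                  (columns p′ (≤∧≢⇒< (<⇒≤pred p′<1+p) p′≢p) isCut)

      record RowState (i : ℕ) (σ : State) : Set where
        field
          cutState : CutState T σ
          costs    : ∀ s → σ tK s ≡ rowCost i s
          rows     : ∀ i′ p′ → i′ < i → p′ < T → Args i′ p′ σ

      reducing-spec : ∀ {σ} → CutState T σ → σ tK ≡ σ₁ tK → RowState T (exec reducing [] σ)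
      reducing-spec st K≡ = loop-invariant RowState T
        (record { cutState = st ; costs = λ s → cong (λ f → f s) K≡ ; rows = λ i′ p′ () }) step
        where
        step : ∀ i σ → i < T → RowState i σ → RowState (suc i) (exec (starts (lit 1 ⊞ v1) ⍮ for reduceAt) (i ∷ []) σ)
        step i σ i<T st = record
          { cutState = ColumnState.cutState done
          ; costs    = ColumnState.costs done
          ; rows     = all-rows
          }
          where
          open RowState st
          σ′ : State
          σ′ = exec (starts (lit 1 ⊞ v1)) (i ∷ []) σ
          ready : CutState T σ′ × Starts i σ′
          ready = starts-ready (lit 1 ⊞ v1) i (i ∷ []) σ (λ _ _ → refl) cutState
          done : ColumnState i T (exec (for reduceAt) (i ∷ []) σ′)
          done = loop-invariant (ColumnState i) T
            (record { cutState = proj₁ ready ; starting = proj₂ ready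
                    ; costs = λ s → trans (cong (λ f → f s) (frame (starts (lit 1 ⊞ v1)) tK refl (i ∷ []) σ)) (costs s)
                    ; rows = λ i′ p′ i′<i p′<T isCut →
                        trans (cong (λ f → f (T * i′ + p′)) (frame (starts (lit 1 ⊞ v1)) tA refl (i ∷ []) σ)) (rows i′ p′ i′<i p′<T isCut)
                    ; columns = λ p′ () })
            λ p σ p<T → reduce-step i p σ i<T p<T
          all-rows : ∀ i′ p′ → i′ < suc i → p′ < T → Args i′ p′ (exec (for reduceAt) (i ∷ []) σ′)
          all-rows i′ p′ i′<1+i p′<T with i′ ≟ i
          ... | yes refl = ColumnState.columns done p′ p′<T
          ... | no i′≢i  = ColumnState.rows done i′ p′ (≤∧≢⇒< (<⇒≤pred i′<1+i) i′≢i) p′<T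

      AllArgs : State → Set
      AllArgs σ = ∀ i p → i < T → p < T → Args i p σ

      pick-step : ∀ j q σ → j < T → q < T → let i = T ∸ suc j in CutState T σ → Starts i σ → AllArgs σ →
        exec pickAt (q ∷ j ∷ []) σ tP ≡ pick i (T ∸ suc q) (σ tP)
      pick-step j q σ j<T q<T st S≡ args = at (suc i ≤ᵇ σ tX p) (cong (λ f → suc i ≤ᵇ f p) (CutState.cuts st))
        where
        i p h : ℕ
        i = T ∸ suc j
        p = T ∸ suc q
        i<T : i < T
        i<T = ∸-monoʳ-< (s≤s z≤n) j<T
        p<T : p < T
        p<T = ∸-monoʳ-< (s≤s z≤n) q<T
        h = loop T (λ s h → if member i p s σ ∧ (1 ≤ᵇ σ tP s) then 1 else h) 0
        h≡ : h ≡ hit (suc i) p (σ tP)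
        h≡ = loop-cong T λ s s<T h → cong (λ c → if c ∧ (1 ≤ᵇ σ tP s) then 1 else h) (member≡ {p = p} {σ = σ} i<T s<T st S≡)
        inner : ∀ c → (if c then σ ⟨ tP , σ tA (T * i + p) ≔ 1 ⟩ else σ) tP ≡ (if c then σ tP [ σ tA (T * i + p) ↦ 1 ] else σ tP)
        inner true  = refl
        inner false = refl
        at : ∀ c → c ≡ CutAt (suc i) p →
          (if c then (if not (1 ≤ᵇ h) then σ ⟨ tP , σ tA (T * i + p) ≔ 1 ⟩ else σ) else σ) tP ≡ pick i p (σ tP)
        at false eq = cong (λ c → if c ∧ not (1 ≤ᵇ hit (suc i) p (σ tP)) then σ tP [ choice i p ↦ 1 ] else σ tP) eq
        at true eq = trans (inner (not (1 ≤ᵇ h))) (trans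
          (cong₂ (λ x y → if not (1 ≤ᵇ x) then σ tP [ y ↦ 1 ] else σ tP) h≡ (args i p i<T p<T (sym eq)))
          (cong (λ c → if c ∧ not (1 ≤ᵇ hit (suc i) p (σ tP)) then σ tP [ choice i p ↦ 1 ] else σ tP) eq))

      PickState : ℕ → State → Set
      PickState j σ = CutState T σ × AllArgs σ × σ tP ≡ rowPick j

      picking-spec : ∀ {σ} → CutState T σ → AllArgs σ → σ tP ≡ σ₁ tP → PickState T (exec picking [] σ)
      picking-spec st args P≡ = loop-invariant PickState T (st , args , trans P≡ unpicked) step
        where
        args-frame : ∀ (c : Com d) ρ σ → writes c tA ≡ false → AllArgs σ → AllArgs (exec c ρ σ)
        args-frame c ρ σ wA args i p i<T p<T isCut = trans (cong (λ f → f (T * i + p)) (frame c tA wA ρ σ)) (args i p i<T p<T isCut)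
        τ : Ex 2
        τ = lit 1 ⊞ (len ⊟ (lit 1 ⊞ v1))
        step : ∀ j σ → j < T → PickState j σ → PickState (suc j) (exec (starts τ ⍮ for pickAt) (j ∷ []) σ)
        step j σ j<T (st , args , P≡) = proj₁ done , proj₁ (proj₂ (proj₂ done)) , proj₂ (proj₂ (proj₂ done))
          where
          i : ℕ
          i = T ∸ suc j
          σ′ : State
          σ′ = exec (starts τ) (j ∷ []) σ
          ready : CutState T σ′ × Starts i σ′
          ready = starts-ready τ i (j ∷ []) σ (λ _ _ → refl) st
          Inner : ℕ → State → Set
          Inner q σ = CutState T σ × Starts i σ × AllArgs σ × σ tP ≡ loop q (λ q → pick i (T ∸ suc q)) (rowPick j)
          done : Inner T (exec (for pickAt) (j ∷ []) σ′)
          done = loop-invariant Inner T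
            (proj₁ ready , proj₂ ready , args-frame (starts τ) (j ∷ []) σ refl args , trans (frame (starts τ) tP refl (j ∷ []) σ) P≡)
            λ q σ q<T (st , S≡ , args , P≡) → cutState-frame pickAt (q ∷ j ∷ []) refl refl refl refl refl st
              , (λ s s<T → trans (cong (λ f → f s) (frame pickAt tS refl (q ∷ j ∷ []) σ)) (S≡ s s<T))
              , args-frame pickAt (q ∷ j ∷ []) σ refl args
              , trans (pick-step j q σ j<T q<T st S≡ args) (cong (pick i (T ∸ suc q)) P≡)

      addForced-spec : ∀ {σ} → σ tP ≡ rowPick T → σ tD ≡ σ₁ tD → σ tY ≡ σ₁ tY → ∀ s → s < T →
        exec addForced [] σ tP s ≡ (if one ≤ᵇ σ₁ tY s then 1 else rowPick T s)
      addForced-spec {σ} P≡ D≡ Y≡ s s<T = trans (proj₂ (proj₂ (loop-invariant Inv T (D≡ , Y≡ , first) step)) s)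
        (cong (λ c → if c ∧ (one ≤ᵇ σ₁ tY s) then 1 else rowPick T s) (≤⇒≤ᵇ s<T))
        where
        new : ℕ → ℕ → ℕ
        new n s = if (suc s ≤ᵇ n) ∧ (one ≤ᵇ σ₁ tY s) then 1 else rowPick T s
        Inv : ℕ → State → Set
        Inv n σ = σ tD ≡ σ₁ tD × σ tY ≡ σ₁ tY × (∀ s → σ tP s ≡ new n s)
        first : ∀ s → σ tP s ≡ new 0 s
        first s = cong (λ f → f s) P≡
        body : Com 1
        body = when (le (tbl tD (lit 0)) (tbl tY v0)) (asg tP v0 (lit 1))
        step : ∀ n σ → n < T → Inv n σ → Inv (suc n) (exec body (n ∷ []) σ)
        step n σ n<T (D≡ , Y≡ , P≡) = trans (frame body tD refl (n ∷ []) σ) D≡ , trans (frame body tY refl (n ∷ []) σ) Y≡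
          , at (σ tD 0 ≤ᵇ σ tY n) (cong₂ (λ f g → f 0 ≤ᵇ g n) D≡ Y≡)
          where
          new-other : ∀ s → s ≢ n → new n s ≡ new (suc n) s
          new-other s s≢n with suc s ≤? n
          ... | yes s<n rewrite ≤⇒≤ᵇ s<n | ≤⇒≤ᵇ (m<n⇒m<1+n s<n) = refl
          ... | no s≮n rewrite ≰⇒≤ᵇ (≰⇒> s≮n) | ≰⇒≤ᵇ (s≤s (≤∧≢⇒< (≮⇒≥ s≮n) λ eq → s≢n (sym eq))) = refl
          at : ∀ c → c ≡ (one ≤ᵇ σ₁ tY n) → ∀ s → (if c then σ ⟨ tP , n ≔ 1 ⟩ else σ) tP s ≡ new (suc n) s
          at c eq s with s ≟ n
          at true eq s | yes refl rewrite ≤⇒≤ᵇ (≤-refl {suc n}) | sym eq = update-same (σ tP) n 1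
          at false eq s | yes refl rewrite ≤⇒≤ᵇ (≤-refl {suc n}) | sym eq = trans (P≡ n) (cong (λ c → if c ∧ (one ≤ᵇ σ₁ tY n) then 1 else rowPick T n) (≰⇒≤ᵇ (n<1+n n)))
          at true eq s | no s≢n = trans (update-other (σ tP) _ s≢n) (trans (P≡ s) (new-other s s≢n))
          at false eq s | no s≢n = trans (P≡ s) (new-other s s≢n)

    prepared : State
    prepared = exec prepare [] (λ _ _ → 0)

    open From prepared (frame prepare tX refl [] _) (frame prepare tP refl [] _) public

    rounding-spec : ∀ s → s < T →
      exec rounding [] (λ _ _ → 0) tP s ≡ (if prepared tD 0 ≤ᵇ prepared tY s then 1 else rowPick T s)
    rounding-spec s s<T = addForced-spec (proj₂ (proj₂ pst)) D≡ Y≡ s s<T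
      where
      σ₂ σ₃ σ₄ : State
      σ₂ = exec cutting [] prepared
      σ₃ = exec reducing [] σ₂
      σ₄ = exec picking [] σ₃
      rst : RowState T σ₃
      rst = reducing-spec cutting-spec (frame cutting tK refl [] prepared)
      pst : PickState T σ₄
      pst = picking-spec (RowState.cutState rst) (RowState.rows rst)
        (trans (frame reducing tP refl [] σ₂) (frame cutting tP refl [] prepared))
      D≡ : σ₄ tD ≡ prepared tD
      D≡ = Fixed.D≡ (CutState.fixed (proj₁ pst))
      Y≡ : σ₄ tY ≡ prepared tY
      Y≡ = trans (frame picking tY refl [] σ₃) (trans (frame reducing tY refl [] σ₂) (frame cutting tY refl [] prepared))

    private
      σ₀ σ₁ σ₂ : State
      σ₀ = λ _ _ → 0
      σ₁ = exec (fold (lit 1) (inp* 5F v0 v1) (asg tD (lit 0) v0)) [] σ₀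

      fill : Com 1
      fill = scaled tC 0F 1F ⍮ scaled tK 2F 3F ⍮ scaled tY 4F 5F ⍮
         asg tW v0 (cond (le (tbl tD (lit 0)) (tbl tY v0)) (lit 0) (tbl tY v0))

      σ₂ = exec (for fill) [] σ₁

      record Filled (n : ℕ) (σ : State) : Set where
        field
          D≡ : σ tD ≡ σ₁ tD
          C≡ : ∀ s → s < n → σ tC s ≡ product 0F 1F s
          K≡ : ∀ s → s < n → σ tK s ≡ product 2F 3F s
          Y≡ : ∀ s → s < n → σ tY s ≡ product 4F 5F s
          W≡ : ∀ s → s < n → σ tW s ≡ (if denominator 5F ≤ᵇ product 4F 5F s then 0 else product 4F 5F s)

      extend-table : ∀ (f : ℕ → ℕ) n v (g : ℕ → ℕ) → v ≡ g n → (∀ s → s < n → f s ≡ g s) → ∀ s → s < suc n → (f [ n ↦ v ]) s ≡ g s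
      extend-table f n v g v≡ eq s s<1+n with s ≟ n
      ... | yes refl = trans (update-same f n v) v≡
      ... | no s≢n   = trans (update-other f v s≢n) (eq s (≤∧≢⇒< (<⇒≤pred s<1+n) s≢n))

      filled : Filled T σ₂
      filled = loop-invariant Filled T
        (record { D≡ = refl ; C≡ = λ s () ; K≡ = λ s () ; Y≡ = λ s () ; W≡ = λ s () })
        λ n σ n<T st → let open Filled st in record
          { D≡ = D≡
          ; C≡ = extend-table (σ tC) n _ (product 0F 1F) refl C≡
          ; K≡ = extend-table (σ tK) n _ (product 2F 3F) refl K≡
          ; Y≡ = extend-table (σ tY) n _ (product 4F 5F) refl Y≡
          ; W≡ = extend-table (σ tW) n _ _ (cong₂ (λ x y → if x ≤ᵇ y then 0 else y)
                   (cong (λ f → f 0) D≡) (update-same (σ tY) n (product 4F 5F n))) W≡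
          }

    prepared-D : prepared tD 0 ≡ denominator 5F
    prepared-D = cong (λ f → f 0) (Filled.D≡ filled)

    prepared-C : ∀ s → s < T → prepared tC s ≡ product 0F 1F s
    prepared-C = Filled.C≡ filled

    prepared-K : ∀ s → s < T → prepared tK s ≡ product 2F 3F s
    prepared-K = Filled.K≡ filled

    prepared-Y : ∀ s → s < T → prepared tY s ≡ product 4F 5F s
    prepared-Y = Filled.Y≡ filled

    prepared-W : ∀ s → s < T → prepared tW s ≡ (if denominator 5F ≤ᵇ product 4F 5F s then 0 else product 4F 5F s)
    prepared-W = Filled.W≡ filled

    prepared-L : prepared tL 0 ≡ loop T (λ t a → a + prepared tC t) (prepared tD 0)
    prepared-L = refl

open Machine

-- Natural numbers over a common denominator.

module NaturalScale {c ℓ₁ ℓ₂} (F : OrderedField c ℓ₁ ℓ₂) where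
  open OrderedField F
  open OrderedFieldProperties F
  open Mult (CommutativeRing.semiring commutativeRing) using (×-homo-+; ×-congʳ; ×-congˡ; ×-comm-*; ×-assocˡ)

  module _ {r : Carrier} (0<r : 0# < r) where
    multiple≥0 : ∀ n → 0# ≤ n · r
    multiple≥0 zero    = ≤-refl
    multiple≥0 (suc n) = +-nonNeg (proj₁ 0<r) (multiple≥0 n)

    multiple-mono : ∀ {m n} → m ℕ.≤ n → m · r ≤ n · r
    multiple-mono {m} {n} m≤n = begin
      m · r                 ≤⟨ x≤y+x (multiple≥0 (n ∸ m)) ⟩
      (n ∸ m) · r + m · r   ≈⟨ ×-homo-+ r (n ∸ m) m ⟨
      (n ∸ m ℕ.+ m) · r     ≈⟨ ×-congˡ (ℕ.m∸n+n≡m m≤n) ⟩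
      n · r                 ∎

    multiple-mono-< : ∀ {m n} → m ℕ.< n → m · r < n · r
    multiple-mono-< {m} {n} m<n = begin-strict
      m · r        ≈⟨ +-identityˡ _ ⟨
      0# + m · r   <⟨ +-monoˡ-< (m · r) 0<r ⟩
      suc m · r    ≤⟨ multiple-mono m<n ⟩
      n · r        ∎

    multiple-reflects : ∀ m n → Reflects (m · r ≤ n · r) (m ≤ᵇ n)
    multiple-reflects m n with m ≤ᵇ n | ℕ.≤ᵇ-reflects-≤ m n
    ... | true  | ofʸ m≤n = ofʸ (multiple-mono m≤n)
    ... | false | ofⁿ m≰n = ofⁿ (<⇒≱ (multiple-mono-< (ℕ.≰⇒> m≰n)))

    -- In its uses `r` is the reciprocal of a common denominator. As `r` is positive, comparing
    -- numerators decides the order.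
    natScale : Scale natOps F
    natScale = record
      { ι       = _· r
      ; ι-null  = refl
      ; ι-plus  = λ m n → ×-homo-+ r m n
      ; ι-minus = λ m n le → sym (trans (+-congʳ (trans
                    (×-congˡ (≡.sym (ℕ.m∸n+n≡m (≤ᵇ⇒≤ {n} {m} (⇒true (multiple-reflects n m) le))))) (×-homo-+ r (m ∸ n) n)))
                    (x+y-y≈x _ _))
      ; ι-leq   = multiple-reflects
      }

  0<multiple : ∀ n → 0 ℕ.< n → 0# < n · 1#
  0<multiple n 0<n = multiple-mono-< 0<1 0<n

  unit : ∀ D → 0 ℕ.< D → ∃ λ r → 0# < r × D · r ≈ 1#
  unit D 0<D with inverse (D · 1#) (λ eq → proj₂ (0<multiple D 0<D) (sym eq))
  ... | r , eq = r , 0<r , D·r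
    where
    D·r : D · r ≈ 1#
    D·r = trans (×-congʳ D (sym (*-identityʳ r))) (trans (sym (×-comm-* D r 1#)) (trans (*-comm r _) eq))
    0<r : 0# < r
    0<r = ≰⇒> λ r≤0 → <⇒≱ 0<1 (begin
      1#              ≈⟨ eq ⟨
      (D · 1#) * r    ≤⟨ *-monoˡ-≤ (proj₁ (0<multiple D 0<D)) r≤0 ⟩
      (D · 1#) * 0#   ≈⟨ zeroʳ _ ⟩
      0#              ∎)

  *-cancelʳ : ∀ {x y z} → ¬ z ≈ 0# → x * z ≈ y * z → x ≈ y
  *-cancelʳ {x} {y} {z} z≉0 eq with inverse z z≉0
  ... | z⁻¹ , inv = trans (sym (expand x)) (trans (*-congʳ eq) (expand y))
    where
    expand : ∀ x → x * z * z⁻¹ ≈ x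
    expand x = trans (*-assoc x z z⁻¹) (trans (*-congˡ inv) (*-identityʳ x))

  -- After multiplication by `den` both sides become `num`, and `den` cancels because it is
  -- positive.
  quotient : ∀ {X den num D r q} → X ℕ.* den ≡ num ℕ.* D → 0 ℕ.< den → D · r ≈ 1# →
    q * (den · 1#) ≈ num · 1# → X · r ≈ q
  quotient {X} {den} {num} {D} {r} {q} eq 0<den D·r q≈ =
    *-cancelʳ (λ z → proj₂ (0<multiple den 0<den) (sym z)) (begin-equality
      (X · r) * (den · 1#)   ≈⟨ ×-comm-* den (X · r) 1# ⟩
      den · ((X · r) * 1#)   ≈⟨ ×-congʳ den (*-identityʳ _) ⟩
      den · (X · r)          ≈⟨ ×-assocˡ r den X ⟩
      (den ℕ.* X) · r        ≈⟨ ×-congˡ (≡.trans (ℕ.*-comm den X) eq) ⟩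
      (num ℕ.* D) · r        ≈⟨ ×-assocˡ r num D ⟨
      num · (D · r)          ≈⟨ ×-congʳ num D·r ⟩
      num · 1#               ≈⟨ q≈ ⟨
      q * (den · 1#)         ∎)

open OrderedField ℚ-orderedField using (_·_)

toℚᵘ-· : ∀ n → ℚ.toℚᵘ (n · 1ℚ) ℚᵘ.≃ mkℚᵘ (ℤ.+ n) 0
toℚᵘ-· zero    = ℚᵘ.≃-refl
toℚᵘ-· (suc n) = ℚᵘ.≃-trans (ℚ.toℚᵘ-homo-+ 1ℚ (n · 1ℚ)) (ℚᵘ.≃-trans (ℚᵘ.+-congʳ (ℚ.toℚᵘ 1ℚ) (toℚᵘ-· n)) (*≡* (lemma (ℤ.+ n))))
  where
  lemma : ∀ i → (ℤ.1ℤ ℤ.* ℤ.1ℤ ℤ.+ i ℤ.* ℤ.1ℤ) ℤ.* ℤ.1ℤ ≡ (ℤ.1ℤ ℤ.+ i) ℤ.* ℤ.1ℤ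
  lemma = ℤSolver.solve-∀

-- The code of a rational drops the sign, which loses nothing for a nonnegative one.
numerator : ∀ q → 0ℚ ℚ.≤ q → q ℚ.* (↧ₙ q · 1ℚ) ≡ ∣ ↥ q ∣ · 1ℚ
numerator q@(mkℚ n d-1 _) 0≤q = ℚ.toℚᵘ-injective (begin
  ℚ.toℚᵘ (q ℚ.* (suc d-1 · 1ℚ))                ≈⟨ ℚ.toℚᵘ-homo-* q (suc d-1 · 1ℚ) ⟩
  mkℚᵘ n d-1 ℚᵘ.* ℚ.toℚᵘ (suc d-1 · 1ℚ)        ≈⟨ ℚᵘ.*-congˡ {mkℚᵘ n d-1} (toℚᵘ-· (suc d-1)) ⟩
  mkℚᵘ n d-1 ℚᵘ.* mkℚᵘ (ℤ.+ suc d-1) 0         ≈⟨ *≡* reduce ⟩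
  mkℚᵘ (ℤ.+ ∣ n ∣) 0                           ≈⟨ toℚᵘ-· ∣ n ∣ ⟨
  ℚ.toℚᵘ (∣ n ∣ · 1ℚ)                          ∎)
  where
  open ℚᵘ.≃-Reasoning
  0≤n : ℤ.0ℤ ℤ.≤ n
  0≤n = ≡.subst₂ ℤ._≤_ (ℤ.*-zeroˡ (ℤ.+ suc d-1)) (ℤ.*-identityʳ n) (ℚ.drop-*≤* 0≤q)
  reduce : (n ℤ.* ℤ.+ suc d-1) ℤ.* ℤ.1ℤ ≡ ℤ.+ ∣ n ∣ ℤ.* ℤ.+ (suc d-1 ℕ.* 1)
  reduce = ≡.trans (ℤ.*-identityʳ _) (≡.cong₂ ℤ._*_ (≡.sym (ℤ.0≤i⇒+∣i∣≡i 0≤n)) (≡.cong ℤ.+_ (≡.sym (ℕ.*-identityʳ (suc d-1)))))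

-- Reading the encoded instance.

load-++ˡ : ∀ xs {ys} i → i ℕ.< length xs → load (xs ++ ys) i ≡ load xs i
load-++ˡ (x ∷ xs) zero    _       = ≡.refl
load-++ˡ (x ∷ xs) (suc i) (s≤s i<) = load-++ˡ xs i i<

load-++ʳ : ∀ xs {ys} i → load (xs ++ ys) (length xs ℕ.+ i) ≡ load ys i
load-++ʳ []       i = ≡.refl
load-++ʳ (x ∷ xs) i = load-++ʳ xs i

module _ {a} {A : Set a} (f : A → List ℕ) (k : ℕ) (length-f : ∀ x → length (f x) ≡ k) where
  -- All blocks have length `k`, so block `s` begins at `k * s`.
  load-concatMap : ∀ {n} (g : Fin n → A) rest s j → j ℕ.< k →
    load (concatMap f (tabulate g) ++ rest) (k ℕ.* toℕ s ℕ.+ j) ≡ load (f (g s)) j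
  load-concatMap {suc n} g rest Fin.zero j j<k
    rewrite ℕ.*-zeroʳ k | ++-assoc (f (g Fin.zero)) (concatMap f (tabulate λ s → g (Fin.suc s))) rest =
    load-++ˡ (f (g Fin.zero)) j (≡.subst (j ℕ.<_) (≡.sym (length-f _)) j<k)
  load-concatMap {suc n} g rest (Fin.suc s) j j<k
    rewrite ℕ.*-suc k (toℕ s) | ℕ.+-assoc k (k ℕ.* toℕ s) j
      | ++-assoc (f (g Fin.zero)) (concatMap f (tabulate λ s → g (Fin.suc s))) rest =
    ≡.trans (≡.cong (λ l → load (f (g Fin.zero) ++ (concatMap f (tabulate λ s → g (Fin.suc s)) ++ rest)) (l ℕ.+ (k ℕ.* toℕ s ℕ.+ j)))
        (≡.sym (length-f (g Fin.zero))))
      (≡.trans (load-++ʳ (f (g Fin.zero)) (k ℕ.* toℕ s ℕ.+ j)) (load-concatMap (λ s → g (Fin.suc s)) rest s j j<k))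

  length-concatMap : ∀ xs → length (concatMap f xs) ≡ length xs ℕ.* k
  length-concatMap []       = ≡.refl
  length-concatMap (x ∷ xs) = ≡.trans (length-++ (f x)) (≡.cong₂ ℕ._+_ (length-f x) (length-concatMap xs))

-- Gives a name to the code of one knapsack, which `encode` keeps local; both unfold to the same
-- list.
knapsackCode : (I : ℚCovering.Instance) → (Fin (ℚCovering.Instance.T I) → ℚ) → Fin (ℚCovering.Instance.T I) → List ℕ
knapsackCode I y s = encodeℚ (C s) ++ encodeℚ (K s) ++ encodeℚ (y s)
  where open ℚCovering.Instance I

∀toℕ⇒∀< : ∀ {p n} (P : ℕ → Set p) → (∀ (s : Fin n) → P (toℕ s)) → ∀ s → s ℕ.< n → P s
∀toℕ⇒∀< P all s s<n = ≡.subst P (Fin.toℕ-fromℕ< s<n) (all (fromℕ< s<n))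

-- With a positive `d` this puts `top` strictly above every capacity.
total-bounds : ∀ n (f : ℕ → ℕ) d s → s ℕ.< n → d ℕ.+ f s ℕ.≤ loop n (λ t a → a ℕ.+ f t) d
total-bounds (suc n) f d s s<1+n with s ℕ.≟ n
... | yes ≡.refl = ℕ.+-monoˡ-≤ (f s) (loop-invariant (λ _ a → d ℕ.≤ a) n ℕ.≤-refl λ t a _ d≤a → ℕ.≤-trans d≤a (ℕ.m≤m+n a (f t)))
... | no s≢n     = ℕ.≤-trans (total-bounds n f d s (ℕ.≤∧≢⇒< (ℕ.<⇒≤pred s<1+n) s≢n)) (ℕ.m≤m+n _ (f n))

-- The tables as numerators, and the output of the program.

-- The input and the tables are kept as variables here: with the actual ones, type checking would run the program.
module Interpretation (I : ℚCovering.Instance) (y : Fin (ℚCovering.Instance.T I) → ℚ)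
  (cube : ℚCovering.InUnitCube I y) (hyp : ℚCovering.RoundingHypothesis I y) (input : Fin 6 → ℕ → ℕ)
  (input≡ : ∀ k s → input k (toℕ s) ≡ load (knapsackCode I y s) (toℕ k)) where

  open ℚCovering.Instance I
  open CommonDenominator T input
  open OrderedField ℚ-orderedField using (_≟_; _<_)
  open NaturalScale ℚ-orderedField
  private module Q = OrderedFieldProperties ℚ-orderedField

  full : Fin T → Bool
  full s = does (y s ≟ 1ℚ)

  private
    denominator-positive : ∀ k → (∀ s → 0 ℕ.< load (knapsackCode I y s) (toℕ k)) → 0 ℕ.< denominator k
    denominator-positive k pos = denominator>0 k
      (∀toℕ⇒∀< (λ s → 0 ℕ.< input k s) λ s → ≡.subst (0 ℕ.<_) (≡.sym (input≡ k s)) (pos s))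

    DY>0 : 0 ℕ.< denominator 5F
    DY>0 = denominator-positive 5F λ s → s≤s z≤n

    unitC : ∃ λ r → 0ℚ < r × denominator 1F · r ≡ 1ℚ
    unitC = unit (denominator 1F) (denominator-positive 1F λ s → s≤s z≤n)
    unitK : ∃ λ r → 0ℚ < r × denominator 3F · r ≡ 1ℚ
    unitK = unit (denominator 3F) (denominator-positive 3F λ s → s≤s z≤n)
    unitY : ∃ λ r → 0ℚ < r × denominator 5F · r ≡ 1ℚ
    unitY = unit (denominator 5F) DY>0

    σC σK σY : Scale natOps ℚ-orderedField
    σC = natScale (proj₁ (proj₂ unitC))
    σK = natScale (proj₁ (proj₂ unitK))
    σY = natScale (proj₁ (proj₂ unitY))

    scaled-value : ∀ num den {r} (q : Fin T → ℚ) → denominator den · r ≡ 1ℚ →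
      (∀ s → load (knapsackCode I y s) (toℕ num) ≡ ∣ ↥ q s ∣) → (∀ s → load (knapsackCode I y s) (toℕ den) ≡ ↧ₙ (q s)) →
      (∀ s → 0ℚ ℚ.≤ q s) → ∀ s → product num den (toℕ s) · r ≡ q s
    scaled-value num den {r} q D·r num≡ den≡ q≥0 s = quotient {X = product num den (toℕ s)} {den = ↧ₙ (q s)} {num = ∣ ↥ q s ∣} {D = denominator den}
      (≡.trans (≡.cong (product num den (toℕ s) ℕ.*_) (≡.sym (≡.trans (input≡ den s) (den≡ s))))
        (≡.trans (product-* num den (toℕ s) (Fin.toℕ<n s)) (≡.cong (ℕ._* denominator den) (≡.trans (input≡ num s) (num≡ s)))))
      (s≤s z≤n) D·r (numerator (q s) (q≥0 s))

    Y≡ : ∀ s → Scale.ι σY (product 4F 5F (toℕ s)) ≡ y s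
    Y≡ = scaled-value 4F 5F y (proj₂ (proj₂ unitY)) (λ _ → ≡.refl) (λ _ → ≡.refl) (λ s → proj₁ (cube s))

  -- In scaled form the test reads `1 ≤ y s`, which within the unit cube means that `y s` is 1.
  full≡ : ∀ s → (denominator 5F ≤ᵇ product 4F 5F (toℕ s)) ≡ full s
  full≡ s with y s ≟ 1ℚ
  ... | yes eq = Scale.≤⇒leq σY {denominator 5F} {product 4F 5F (toℕ s)} (Q.≤-reflexive (≡.trans (proj₂ (proj₂ unitY)) (≡.trans (≡.sym eq) (≡.sym (Y≡ s)))))
  ... | no neq = Scale.≰⇒leq σY {denominator 5F} {product 4F 5F (toℕ s)} λ le → neq (Q.antisym (proj₂ (cube s))
          (≡.subst₂ ℚ._≤_ (proj₂ (proj₂ unitY)) (Y≡ s) le))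

  module Tables (C′ K′ W′ : ℕ → ℕ) (one top : ℕ)
    (C′≡ : ∀ s → s ℕ.< T → C′ s ≡ product 0F 1F s) (K′≡ : ∀ s → s ℕ.< T → K′ s ≡ product 2F 3F s)
    (W′≡ : ∀ s → s ℕ.< T → W′ s ≡ (if denominator 5F ≤ᵇ product 4F 5F s then 0 else product 4F 5F s))
    (one≡ : one ≡ denominator 5F) (top≡ : top ≡ loop T (λ t a → a ℕ.+ C′ t) one) where

    private
      C≡ : ∀ s → Scale.ι σC (C′ (toℕ s)) ≡ C s
      C≡ s = ≡.trans (≡.cong (Scale.ι σC) (C′≡ (toℕ s) (Fin.toℕ<n s)))
        (scaled-value 0F 1F C (proj₂ (proj₂ unitC)) (λ _ → ≡.refl) (λ _ → ≡.refl) (λ s → proj₁ (C>0 s)) s)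

      K≡ : ∀ s → Scale.ι σK (K′ (toℕ s)) ≡ K s
      K≡ s = ≡.trans (≡.cong (Scale.ι σK) (K′≡ (toℕ s) (Fin.toℕ<n s)))
        (scaled-value 2F 3F K (proj₂ (proj₂ unitK)) (λ _ → ≡.refl) (λ _ → ≡.refl) K≥0 s)

      W≡ : ∀ s → Scale.ι σY (W′ (toℕ s)) ≡ (if full s then 0ℚ else y s)
      W≡ s = ≡.trans (≡.cong (Scale.ι σY) (≡.trans (W′≡ (toℕ s) (Fin.toℕ<n s))
          (≡.cong (λ b → if b then 0 else product 4F 5F (toℕ s)) (full≡ s)))) (choose (full s))
        where
        choose : ∀ b → Scale.ι σY (if b then 0 else product 4F 5F (toℕ s)) ≡ (if b then 0ℚ else y s)
        choose true  = ≡.refl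
        choose false = Y≡ s

      C′<top : ∀ s → s ℕ.< T → C′ s ℕ.< top
      C′<top s s<T = ℕ.<-≤-trans (ℕ.m<n+m (C′ s) (≡.subst (0 ℕ.<_) (≡.sym one≡) DY>0))
        (≡.subst (one ℕ.+ C′ s ℕ.≤_) (≡.sym top≡) (total-bounds T C′ one s s<T))

      setup : Setup natOps ℚ-orderedField T
      setup = record
        { σC = σC ; σK = σK ; σW = σY
        ; C = C′ ; K = K′ ; W = W′ ; one = one ; top = top
        ; C>0 = ∀toℕ⇒∀< (λ s → 0ℚ < Scale.ι σC (C′ s)) λ s → ≡.subst (0ℚ <_) (≡.sym (C≡ s)) (C>0 s)
        ; C<top = λ s s<T → multiple-mono-< (proj₁ (proj₂ unitC)) (C′<top s s<T)
        ; top≥0 = multiple≥0 (proj₁ (proj₂ unitC)) top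
        ; K≥0 = ∀toℕ⇒∀< (λ s → 0ℚ ℚ.≤ Scale.ι σK (K′ s)) λ s → ≡.subst (0ℚ ℚ.≤_) (≡.sym (K≡ s)) (K≥0 s)
        ; W≥0 = λ s _ → multiple≥0 (proj₁ (proj₂ unitY)) (W′ s)
        ; W<1 = ∀toℕ⇒∀< (λ s → Scale.ι σY (W′ s) < 1ℚ) λ s → ≡.subst (_< 1ℚ) (≡.sym (W≡ s))
            (proj₂ (Existence.fractional-bounds ℚ-orderedField I y cube s))
        ; one≈1 = ≡.trans (≡.cong (Scale.ι σY) one≡) (proj₂ (proj₂ unitY))
        }

    picks : ℕ → ℕ
    picks = Algorithm.Rounding.rowPick natOps T C′ W′ one top K′ T

    table-rounds : ∀ A → (∀ s → lookup A s ≡ (1 ≤ᵇ picks (toℕ s)) ∨ full s) → ℚCovering.Rounds I y A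
    table-rounds = Assembly.rounds ℚ-orderedField I y cube hyp setup C≡ K≡ W≡

module _ (I : ℚCovering.Instance) (y : Fin (ℚCovering.Instance.T I) → ℚ)
  (cube : ℚCovering.InUnitCube I y) (hyp : ℚCovering.RoundingHypothesis I y) (input : Fin 6 → ℕ → ℕ)
  (input≡ : ∀ k s → input k (toℕ s) ≡ load (knapsackCode I y s) (toℕ k)) where

  open ℚCovering.Instance I using (T)
  private
    module Refined = Refinement T input
    open Refined using (prepared; rounding-spec; prepared-C; prepared-D; prepared-K; prepared-L; prepared-W; prepared-Y)
    open Interpretation I y cube hyp input input≡
    open Tables (prepared tC) (prepared tK) (prepared tW) (prepared tD 0) (prepared tL 0)
      prepared-C prepared-K prepared-W prepared-D prepared-L

    chosen≢0 : ∀ b v → not (does ((if b then 1 else v) ℕ.≟ 0)) ≡ (1 ≤ᵇ v) ∨ b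
    chosen≢0 true  zero    = ≡.refl
    chosen≢0 true  (suc v) = ≡.refl
    chosen≢0 false zero    = ≡.refl
    chosen≢0 false (suc v) = ≡.refl

    forced≡ : ∀ s → (prepared tD 0 ≤ᵇ prepared tY (toℕ s)) ≡ full s
    forced≡ s = ≡.trans (≡.cong₂ _≤ᵇ_ prepared-D (prepared-Y (toℕ s) (Fin.toℕ<n s))) (full≡ s)

  output-rounds : ∀ m → (∀ s → s ℕ.< T → m s ≡ Language.Semantics.exec 11 T input rounding Vec.[] (λ _ _ → 0) tP s) →
    ℚCovering.Rounds I y (decode T m)
  output-rounds m result = table-rounds (decode T m) λ s → begin
    lookup (decode T m) s                                  ≡⟨ lookup∘tabulate (λ s → not (does (m (toℕ s) ℕ.≟ 0))) s ⟩
    not (does (m (toℕ s) ℕ.≟ 0))                           ≡⟨ ≡.cong nonzero (≡.trans (result (toℕ s) (Fin.toℕ<n s)) (rounding-spec (toℕ s) (Fin.toℕ<n s))) ⟩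
    nonzero (if prepared tD 0 ≤ᵇ prepared tY (toℕ s) then 1 else picks (toℕ s))
                                                           ≡⟨ ≡.cong (λ b → nonzero (if b then 1 else picks (toℕ s))) (forced≡ s) ⟩
    nonzero (if full s then 1 else picks (toℕ s))          ≡⟨ chosen≢0 (full s) (picks (toℕ s)) ⟩
    (1 ≤ᵇ picks (toℕ s)) ∨ full s                          ∎
    where
    open ≡.≡-Reasoning
    nonzero : ℕ → Bool
    nonzero v = not (does (v ℕ.≟ 0))

module Encoding (I : ℚCovering.Instance) (y : Fin (ℚCovering.Instance.T I) → ℚ) where
  open ℚCovering.Instance I

  entry : Fin (suc T) → Fin (suc T) → List ℕ
  entry a b = encodeℚ (if does (toℕ a ℕ.<? toℕ b) then R a b else 0ℚ)

  row : Fin (suc T) → List ℕ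
  row a = concatMap (entry a) (allFin (suc T))

  length-encode : length (encode I y) ≡ suc (T ℕ.* 6 ℕ.+ suc T ℕ.* (suc T ℕ.* 2))
  length-encode = ≡.cong suc (≡.trans (length-++ (concatMap (knapsackCode I y) (allFin T))) (≡.cong₂ ℕ._+_
    (≡.trans (length-concatMap (knapsackCode I y) 6 (λ _ → ≡.refl) (allFin T)) (≡.cong (ℕ._* 6) (length-tabulate {n = T} λ s → s)))
    (≡.trans (length-concatMap row (suc T ℕ.* 2)
        (λ a → ≡.trans (length-concatMap (entry a) 2 (λ _ → ≡.refl) (allFin (suc T))) (≡.cong (ℕ._* 2) (length-tabulate {n = suc T} λ s → s)))
        (allFin (suc T)))
      (≡.cong (ℕ._* (suc T ℕ.* 2)) (length-tabulate {n = suc T} λ s → s)))))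

  length≤ : length (encode I y) ℕ.≤ 8 ℕ.* ((T ℕ.+ 1) ℕ.* (T ℕ.+ 1))
  length≤ = ≡.subst₂ ℕ._≤_ (≡.sym length-encode) (≡.sym (lemma T)) (ℕ.m≤m+n _ _)
    where
    lemma : ∀ t → 8 ℕ.* ((t ℕ.+ 1) ℕ.* (t ℕ.+ 1)) ≡
      suc (t ℕ.* 6 ℕ.+ suc t ℕ.* (suc t ℕ.* 2)) ℕ.+ (6 ℕ.* (t ℕ.* t) ℕ.+ 6 ℕ.* t ℕ.+ 5)
    lemma = ℕSolver.solve-∀

  T<length : T ℕ.< length (encode I y)
  T<length = ≡.subst (T ℕ.<_) (≡.sym length-encode) (s≤s (ℕ.≤-trans (ℕ.m≤m*n T 6) (ℕ.m≤m+n _ _)))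

  module Exec = Polytime.Output.Execution 11 tP T (encode I y) ≡.refl
    (ℕ.≤-trans (ℕ.<⇒≤ T<length) (length≤inputSize (encode I y)))
    (ℕ.≤-trans (s≤s z≤n) (ℕ.≤-trans T<length (length≤inputSize (encode I y))))
    length≤ rounding
  open Exec using (input)

  input-code : ∀ k s → input k (toℕ s) ≡ load (knapsackCode I y s) (toℕ k)
  input-code k s rewrite ≤⇒≤ᵇ (Fin.toℕ<n s) | ℕ.+-suc (6 ℕ.* toℕ s) (toℕ k) =
    load-concatMap (knapsackCode I y) 6 (λ _ → ≡.refl) (λ s → s) _ s (toℕ k) (Fin.toℕ<n k)

  computed : ℚCovering.InUnitCube I y → ℚCovering.RoundingHypothesis I y →
    ∃ λ σ → ∃ λ t → ⟨ Polytime.Output.program 11 tP rounding , load (encode I y) ⟩⇓⟨ σ , t ⟩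
    × t ℕ.≤ eval (Polytime.Output.timePoly 11 tP rounding) (inputSize (encode I y))
    × ℚCovering.Rounds I y (decode T σ)
  computed cube hyp = let m , t , run , t≤ , result = Exec.computes in
    m , t , run , t≤ , output-rounds I y cube hyp input input-code m result


open import Data.Nat.Base using (_≤_)

theorem3 : ∀ {c ℓ₁ ℓ₂} →
    ((F : OrderedField c ℓ₁ ℓ₂) → let open Covering F in
    (I : Instance) (y : Fin (Instance.T I) → OrderedField.Carrier F) →
    InUnitCube I y → RoundingHypothesis I y →
    ∃ λ (S : Subset (Instance.T I)) → Rounds I y S)
    × (Σ Program λ P → Σ Polynomial λ p → let open ℚCovering in
    (I : Instance) (y : Fin (Instance.T I) → ℚ) →
    InUnitCube I y → RoundingHypothesis I y →
    ∃ λ (σ : Memory) → ∃ λ (t : ℕ) →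
    ⟨ P , load (encode I y) ⟩⇓⟨ σ , t ⟩
    × t ≤ eval p (inputSize (encode I y))
    × Rounds I y (decode (Instance.T I) σ))
theorem3 = (λ F I y → Existence.exists F I y)
  , Polytime.Output.program 11 tP rounding , Polytime.Output.timePoly 11 tP rounding
  , λ I y → Encoding.computed I y
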